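{- For any skew shape $\lambda/\mu$ (partitions $\mu\subseteq\lambda$) and any positive integer $n$, \[ s_{\lambda/\mu}\, s_n \;=\; s_{\lambda/\mu}\, h_n \;=\; \sum_{k=0}^{n} (-1)^k \sum_{\substack{\lambda^+/\lambda \ (n-k)\text{ -horizontal strip}\\ \mu/\mu^- \ k\text{ -vertical strip}}} s_{\lambda^+/\mu^- }, \] where the inner sum is over all pairs of partitions $\lambda^+,\mu^-$ such that $\lambda^+/\lambda$ is a horizontal strip of size $n-k$ and $\mu/\mu^-$ is a vertical strip of size $k$.
   Context: Symmetric functions are in variables $x=(x_1,x_2,\dots)$. For partitions $\mu\subseteq\lambda$, the skew Schur function is $s_{\lambda/\mu}=\sum_T x^T$, summed over semistandard Young tableaux $T$ of shape $\lambda/\mu$ (fillings with positive integers, weakly increasing along rows and strictly increasing along columns), where $x^T=\prod_i x_i^{(\text{number of entries } i)}$. $s_n=h_n$ is the complete homogeneous symmetric function. A skew shape $\alpha/\beta$ is a horizontal strip (resp. vertical strip) if no two of its cells lie in the same column (resp. row); a $k$-horizontal/vertical strip is one with $k$ cells (in particular $\alpha\supseteq\beta$ are partitions). -}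

module Defs where

open import Data.Bool using (if_then_else_)
open import Data.Empty using (⊥)
open import Data.Integer as ℤ using (ℤ; 0ℤ; 1ℤ)
open import Data.List using (List; []; _∷_; length; map; filter; foldr; zip; zipWith; concatMap; applyUpTo; upTo; cartesianProductWith)
open import Data.List.Membership.Propositional using (_∈_)
open import Data.List.Membership.Propositional.Properties using (∈-filter⁺; ∈-filter⁻; ∈-applyUpTo⁺; ∈-cartesianProductWith⁺; ∈-cartesianProductWith⁻)
open import Data.List.Properties using (≡-dec; ∷-injective; length-applyUpTo; map-upTo; length-++)
open import Data.List.Relation.Binary.Prefix.Heterogeneous using (Prefix; []; _∷_)
open import Data.List.Relation.Binary.Prefix.Heterogeneous.Properties using (prefix?)
open import Data.List.Relation.Unary.All as All using (All; []; _∷_; all?)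
open import Data.List.Relation.Unary.AllPairs using ([]; _∷_)
open import Data.List.Relation.Unary.Any using (here; there)
open import Data.List.Relation.Unary.Linked using (Linked; linked?)
open import Data.List.Relation.Unary.Unique.Propositional using (Unique)
import Data.List.Relation.Unary.Unique.Propositional.Properties as Unique
open import Data.Nat using (ℕ; zero; suc; _+_; _∸_; _≤_; _<_; _≥_; z≤n; s≤s; _≟_; _≤?_; _<?_; _≥?_)
open import Data.Nat.ListAction using (sum)
open import Data.Nat.Properties using (≤-trans; ≤-reflexive; m≤m+n; m≤n+m; +-mono-≤; +-assoc; +-comm; m+[n∸m]≡n; <⇒≢)
open import Data.Product using (_×_; _,_; proj₁; proj₂)
open import Data.Product.Properties using () renaming (≡-dec to ×-≡-dec)
open import Function using (_⇔_; mk⇔)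
open import Relation.Binary.PropositionalEquality using (_≡_; _≗_; refl; sym; trans; cong; cong₂; subst; module ≡-Reasoning)
open import Relation.Nullary using (Dec; does)
open import Relation.Nullary.Decidable using (_×-dec_; _→-dec_)

IsPartition : List ℕ → Set
IsPartition α = Linked _≥_ α × All (0 <_) α

isPartition? : (α : List ℕ) → Dec (IsPartition α)
isPartition? α = linked? _≥?_ α ×-dec all? (0 <?_) α

-- Since parts are positive, inclusion of Young diagrams β ⊆ α says that β is
-- no longer than α and is dominated by it entry by entry.
infix 4 _⊆_
_⊆_ : List ℕ → List ℕ → Set
β ⊆ α = Prefix _≤_ β α

SkewShape : List ℕ → List ℕ → Set
SkewShape α β = IsPartition α × IsPartition β × β ⊆ α

skewShape? : (α β : List ℕ) → Dec (SkewShape α β)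
skewShape? α β = isPartition? α ×-dec isPartition? β ×-dec prefix? _≤?_ β α

part : List ℕ → ℕ → ℕ
part []      _       = 0
part (a ∷ α) zero    = a
part (a ∷ α) (suc i) = part α i

-- (row , column), both counted from 0.
Cell : Set
Cell = ℕ × ℕ

row col : Cell → ℕ
row = proj₁
col = proj₂

cellsInRow : List ℕ → List ℕ → ℕ → List Cell
cellsInRow α β i = applyUpTo (λ d → i , part β i + d) (part α i ∸ part β i)

cells : List ℕ → List ℕ → List Cell
cells α β = concatMap (cellsInRow α β) (upTo (length α))

AtMostOneCellPer : (Cell → ℕ) → List Cell → Set
AtMostOneCellPer line cs = All (λ c → All (λ d → line c ≡ line d → c ≡ d) cs) cs

atMostOneCellPer? : ∀ line cs → Dec (AtMostOneCellPer line cs)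
atMostOneCellPer? line cs =
  all? (λ c → all? (λ d → (line c ≟ line d) →-dec ×-≡-dec _≟_ _≟_ c d) cs) cs

HorizontalStrip VerticalStrip : ℕ → List ℕ → List ℕ → Set
HorizontalStrip k α β = SkewShape α β × AtMostOneCellPer col (cells α β) × length (cells α β) ≡ k
VerticalStrip   k α β = SkewShape α β × AtMostOneCellPer row (cells α β) × length (cells α β) ≡ k

horizontalStrip? : ∀ k α β → Dec (HorizontalStrip k α β)
horizontalStrip? k α β = skewShape? α β ×-dec atMostOneCellPer? col (cells α β) ×-dec (length (cells α β) ≟ k)

verticalStrip? : ∀ k α β → Dec (VerticalStrip k α β)
verticalStrip? k α β = skewShape? α β ×-dec atMostOneCellPer? row (cells α β) ×-dec (length (cells α β) ≟ k)

[1⋯_] : ℕ → List ℕ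
[1⋯ N ] = applyUpTo suc N

-- Words of length exactly l, respectively at most l, over an alphabet.
words words≤ : {A : Set} → List A → ℕ → List (List A)
words  xs zero    = [] ∷ []
words  xs (suc l) = cartesianProductWith _∷_ xs (words xs l)
words≤ xs zero    = [] ∷ []
words≤ xs (suc l) = [] ∷ cartesianProductWith _∷_ xs (words≤ xs l)

-- The box bounds only make the search finite; that no strip is lost, and none
-- is listed twice, is shown at the end of this module.
horizontalStripsOver : ℕ → List ℕ → List (List ℕ)
horizontalStripsOver k β = filter (λ α → horizontalStrip? k α β) (words≤ [1⋯ m ] m)
  where m = sum β + k

verticalStripsUnder : ℕ → List ℕ → List (List ℕ)
verticalStripsUnder k α = filter (verticalStrip? k α) (words≤ [1⋯ m ] m)
  where m = sum α

-- f (a₁ ∷ … ∷ a_N ∷ []) is the coefficient of x₁^a₁ ⋯ x_N^a_N in f, so a list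
-- and its extensions by zeros name the same monomial.
Series : Set
Series = List ℕ → ℤ

infix 4 _≈_
_≈_ : Series → Series → Set
f ≈ g = f ≗ g

0ₛ : Series
0ₛ _ = 0ℤ

infixl 6 _+ₛ_
_+ₛ_ : Series → Series → Series
(f +ₛ g) α = f α ℤ.+ g α

infixr 7 _·ₛ_
_·ₛ_ : ℤ → Series → Series
(c ·ₛ f) α = c ℤ.* f α

divisors : List ℕ → List (List ℕ)
divisors []      = [] ∷ []
divisors (a ∷ α) = cartesianProductWith _∷_ (upTo (suc a)) (divisors α)

-- The Cauchy product: x^α = x^β · x^(α-β) for each divisor x^β of x^α.
infixl 7 _*ₛ_
_*ₛ_ : Series → Series → Series
(f *ₛ g) α = foldr ℤ._+_ 0ℤ (map (λ β → f β ℤ.* g (zipWith _∸_ α β)) (divisors α))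

∑ : {A : Set} → List A → (A → Series) → Series
∑ xs f = foldr _+ₛ_ 0ₛ (map f xs)

infixr 5 ∑
syntax ∑ xs (λ x → f) = ∑[ x ∈ xs ] f

-- A filling is the list of the cells of the shape, each with its entry.
Filling : Set
Filling = List (Cell × ℕ)

Semistandard : Filling → Set
Semistandard T = All (λ (c , a) → All (λ (d , b) →
    (row c ≡ row d → col c < col d → a ≤ b) ×
    (col c ≡ col d → row c < row d → a < b)) T) T

semistandard? : (T : Filling) → Dec (Semistandard T)
semistandard? T = all? (λ (c , a) → all? (λ (d , b) →
    ((row c ≟ row d) →-dec (col c <? col d) →-dec (a ≤? b)) ×-dec
    ((col c ≟ col d) →-dec (row c <? row d) →-dec (a <? b))) T) T

-- Semistandard Young tableaux of shape α/β with entries in {1, …, N}.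
tableaux : ℕ → List ℕ → List ℕ → List Filling
tableaux N α β = filter semistandard? (map (zip cs) (words [1⋯ N ] (length cs)))
  where cs = cells α β

-- Exponents of x₁, …, x_N in x^T.
weight : ℕ → Filling → List ℕ
weight N T = map (λ i → length (filter (λ (_ , a) → a ≟ i) T)) [1⋯ N ]

-- The coefficient of x^γ in Σ_T x^T is the number of T with x^T = x^γ; such T
-- have no entry larger than the length of γ.
skewSchur : List ℕ → List ℕ → Series
skewSchur α β γ = ℤ.+ length (filter (λ T → ≡-dec _≟_ (weight N T) γ) (tableaux N α β))
  where N = length γ

s : ℕ → Series
s n = skewSchur (n ∷ []) []

-- The sum of all monomials of degree n.
h : ℕ → Series
h n γ = if does (sum γ ≟ n) then 1ℤ else 0ℤ

length-cells : ∀ {α β} → β ⊆ α → sum β + length (cells α β) ≡ sum α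
length-cells {α} {β} β⊆α =
  trans (cong (sum β +_) (trans (length-concatMap (upTo (length α))) lengths)) (go β⊆α)
  where
  length-concatMap : ∀ is → length (concatMap (cellsInRow α β) is) ≡ sum (map (λ i → part α i ∸ part β i) is)
  length-concatMap []       = refl
  length-concatMap (i ∷ is) = trans (length-++ (cellsInRow α β i))
    (cong₂ _+_ (length-applyUpTo (λ d → i , part β i + d) (part α i ∸ part β i)) (length-concatMap is))

  lengths : sum (map (λ i → part α i ∸ part β i) (upTo (length α))) ≡ sum (applyUpTo (λ i → part α i ∸ part β i) (length α))
  lengths = cong sum (map-upTo (λ i → part α i ∸ part β i) (length α))

  go : ∀ {α β} → β ⊆ α → sum β + sum (applyUpTo (λ i → part α i ∸ part β i) (length α)) ≡ sum α
  go {[]}    []        = refl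
  go {a ∷ α} []        = cong (a +_) (go {α} [])
  go {a ∷ α} {b ∷ β} (b≤a ∷ p) = begin
    (b + sum β) + ((a ∸ b) + r)  ≡⟨ +-assoc b (sum β) _ ⟩
    b + (sum β + ((a ∸ b) + r))  ≡⟨ cong (b +_) (sym (+-assoc (sum β) (a ∸ b) r)) ⟩
    b + ((sum β + (a ∸ b)) + r)  ≡⟨ cong (λ t → b + (t + r)) (+-comm (sum β) (a ∸ b)) ⟩
    b + (((a ∸ b) + sum β) + r)  ≡⟨ cong (b +_) (+-assoc (a ∸ b) (sum β) r) ⟩
    b + ((a ∸ b) + (sum β + r))  ≡⟨ sym (+-assoc b (a ∸ b) _) ⟩
    (b + (a ∸ b)) + (sum β + r)  ≡⟨ cong₂ _+_ (m+[n∸m]≡n b≤a) (go p) ⟩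
    a + sum α                    ∎
    where
    open ≡-Reasoning
    r = sum (applyUpTo (λ i → part α i ∸ part β i) (length α))

∈-words≤ : {A : Set} {xs w : List A} {l : ℕ} → length w ≤ l → All (_∈ xs) w → w ∈ words≤ xs l
∈-words≤ {l = zero}  z≤n     []       = here refl
∈-words≤ {l = suc l} _       []       = here refl
∈-words≤ {l = suc l} (s≤s p) (q ∷ qs) = there (∈-cartesianProductWith⁺ _∷_ q (∈-words≤ p qs))

words≤-unique : {A : Set} {xs : List A} → Unique xs → ∀ l → Unique (words≤ xs l)
words≤-unique u zero    = [] ∷ []
words≤-unique {xs = xs} u (suc l) =
  All.tabulate (λ {v} v∈ []≡v → nonempty xs (subst (_∈ _) (sym []≡v) v∈))
    ∷ Unique.cartesianProductWith⁺ _∷_ ∷-injective u (words≤-unique u l)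
  where
  nonempty : ∀ xs {ws} → [] ∈ cartesianProductWith _∷_ xs ws → ⊥
  nonempty xs {ws} p with ∈-cartesianProductWith⁻ _∷_ xs ws p
  ... | _ , _ , _ , _ , ()

∈-box : ∀ {α m} → IsPartition α → sum α ≤ m → α ∈ words≤ [1⋯ m ] m
∈-box {α} (_ , pos) le = ∈-words≤ (≤-trans (len pos) le) (entries pos le)
  where
  len : ∀ {α} → All (0 <_) α → length α ≤ sum α
  len []       = z≤n
  len (p ∷ ps) = +-mono-≤ p (len ps)

  entries : ∀ {α m} → All (0 <_) α → sum α ≤ m → All (_∈ [1⋯ m ]) α
  entries []                         _  = []
  entries {suc a ∷ α} (p ∷ ps) le =
    ∈-applyUpTo⁺ suc (≤-trans (m≤m+n (suc a) (sum α)) le) ∷ entries ps (≤-trans (m≤n+m (sum α) (suc a)) le)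

box-unique : ∀ m → Unique (words≤ [1⋯ m ] m)
box-unique m = words≤-unique (Unique.applyUpTo⁺₁ suc m (λ i<j _ → <⇒≢ (s≤s i<j))) m

∈-horizontalStripsOver : ∀ {k α β} → α ∈ horizontalStripsOver k β ⇔ HorizontalStrip k α β
∈-horizontalStripsOver {k} {α} {β} = mk⇔
  (λ α∈ → proj₂ (∈-filter⁻ (λ α → horizontalStrip? k α β) {xs = words≤ [1⋯ sum β + k ] (sum β + k)} α∈))
  (λ { strip@((pα , _ , β⊆α) , _ , refl) →
    ∈-filter⁺ (λ α → horizontalStrip? k α β) (∈-box pα (≤-reflexive (sym (length-cells β⊆α)))) strip })

∈-verticalStripsUnder : ∀ {k α β} → β ∈ verticalStripsUnder k α ⇔ VerticalStrip k α β
∈-verticalStripsUnder {k} {α} {β} = mk⇔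
  (λ β∈ → proj₂ (∈-filter⁻ (verticalStrip? k α) {xs = words≤ [1⋯ sum α ] (sum α)} β∈))
  (λ { strip@((_ , pβ , β⊆α) , _) →
    ∈-filter⁺ (verticalStrip? k α) (∈-box pβ (≤-trans (m≤m+n _ _) (≤-reflexive (length-cells β⊆α)))) strip })

horizontalStripsOver-unique : ∀ k β → Unique (horizontalStripsOver k β)
horizontalStripsOver-unique k β = Unique.filter⁺ (λ α → horizontalStrip? k α β) (box-unique (sum β + k))

verticalStripsUnder-unique : ∀ k α → Unique (verticalStripsUnder k α)
verticalStripsUnder-unique k α = Unique.filter⁺ (verticalStrip? k α) (box-unique (sum α))

{-# OPTIONS --safe #-}
module Submission where

-- Let U(x) add a horizontal strip of size k with weight x^k, let D(t) remove
-- horizontal strips with weight t^k, and let E(t) remove vertical strips with weight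
-- (-t)^k.  Then s_{λ/μ}(x₁, …, x_N) = ⟨λ| U(x_N) ⋯ U(x₁) |μ⟩, and the right-hand side
-- of the theorem is the coefficient of t^n in ⟨λ| D(t) U(x_N) ⋯ U(x₁) E(t) |μ⟩.  Since
-- D(t) U(x) = (1 - xt)⁻¹ U(x) D(t) and D(t) E(t) = 1, this is the coefficient of t^n in
-- s_{λ/μ} ∏ (1 - xᵢt)⁻¹, which is s_{λ/μ} h_n.  In both relations the constraints on the
-- parts of the intermediate partition are independent intervals, one per row.
--
-- Partitions are represented by vectors of a fixed length L > ℓ(λ), padded with zeros,
-- and sums over them run over a box [0 , B)^L large enough to contain every partition that
-- contributes.  No formal t is needed: |γ|, |λ| and |μ| determine n.

open import Defs
open import Algebra.Properties.CommutativeSemigroup using (interchange; xy∙z≈xz∙y)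
open import Data.Bool using (if_then_else_; true; false)
open import Data.Empty using (⊥-elim)
open import Data.Integer as ℤ using (ℤ; 0ℤ; 1ℤ; -1ℤ; +_; _*_; _^_)
import Data.Integer.Properties as ℤₚ
open import Data.Integer.Tactic.RingSolver using (solve-∀)
open import Data.List using (List; []; _∷_; _++_; length; map; filter; foldr; zip; zipWith; concat; concatMap; applyUpTo; upTo; cartesianProduct; cartesianProductWith)
open import Data.List.Membership.Propositional using (_∈_; find; lose)
open import Data.List.Membership.Propositional.Properties
open import Data.List.Membership.Propositional.Properties.WithK using (unique∧set⇒bag)
open import Data.List.Properties using (filter-++; filter-accept; filter-reject; length-map; map-applyUpTo; map-upTo) renaming (≡-dec to list-≡-dec; ∷-injective to list-∷-injective)
open import Data.List.Relation.Binary.BagAndSetEquality using (∼bag⇒↭)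
open import Data.List.Relation.Binary.Permutation.Propositional as Perm using (_↭_)
open import Data.List.Relation.Binary.Prefix.Heterogeneous using ([]; _∷_)
open import Data.List.Relation.Unary.All as All using (All; []; _∷_; all?)
import Data.List.Relation.Unary.All.Properties as Allₚ
open import Data.List.Relation.Unary.AllPairs using ([]; _∷_)
import Data.List.Relation.Unary.AllPairs.Properties as AllPairsₚ
open import Data.List.Relation.Unary.Any using (here; there)
open import Data.List.Relation.Unary.Linked using (Linked; []; [-]; _∷_)
open import Data.List.Relation.Unary.Unique.Propositional using (Unique)
import Data.List.Relation.Unary.Unique.Propositional.Properties as Unique
open import Data.Nat using (ℕ; zero; suc; pred; _+_; _∸_; _⊔_; _⊓_; _≤_; _<_; _≥_; z≤n; s≤s; _≡ᵇ_; _≟_; _≤?_; _<?_)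
open import Data.Nat.ListAction using (sum)
import Data.Nat.Properties as ℕₚ
open import Data.Product using (_×_; _,_; proj₁; proj₂; ∃)
open import Data.Sum using (_⊎_; inj₁; inj₂)
open import Data.Unit using (⊤; tt)
open import Data.Vec as Vec using (Vec; []; _∷_)
open import Data.Vec.Properties using (∷-injective; length-toList) renaming (≡-dec to vec-≡-dec)
open import Data.Vec.Relation.Binary.Pointwise.Inductive as PW using (Pointwise; []; _∷_)
open import Data.Vec.Relation.Unary.All as VAll using ([]; _∷_) renaming (All to VAll)
open import Function using (_∘_; _⇔_; mk⇔; id; Equivalence)
open import Relation.Binary.Definitions using (tri<; tri≈; tri>)
open import Relation.Binary.PropositionalEquality using (_≡_; _≢_; refl; sym; trans; cong; cong₂; subst; subst₂; module ≡-Reasoning)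
open import Relation.Nullary using (Dec; does; yes; no; ¬_)
open import Relation.Nullary.Decidable using (_×-dec_; _→-dec_; ¬?; dec-true; dec-false)
open import Relation.Unary using (Decidable)

-- Finite sums and indicators

-- In `D(t) U(x)` let `ν` be the partition above `κ` and `ρ`, in `U(x) D(t)` let `σ` be the one
-- below both. The rows of `ν` from the second on, and the rows of `σ` from the first on, run over
-- the same intervals `[κᵢ₊₁ ⊔ ρᵢ₊₁ , κᵢ ⊓ ρᵢ]`. The weights match when each row goes to its mirror
-- image in its interval: all maxima and minima together sum to |κ| + |ρ|, so |ν| - |κ| becomes (ν₁
-- - κ₁ ⊔ ρ₁) + |ρ| - |σ|. The first row of `ν` is bounded from below only, and it yields the
-- geometric series. With vectors of one length, `σ` has a last row without a partner in `ν`. It has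
-- to be 0, which holds because `ρ` lies inside λ and L exceeds ℓ(λ); the same spare row makes room
-- for λ⁺. The sum behind `E(t)` runs over all vectors and not only over partitions, since only then
-- are the rows independent. A vector that is not decreasing contributes nothing in the end, because
-- no chain of horizontal strips from it reaches a partition.

sumOver : {A : Set} → List A → (A → ℤ) → ℤ
sumOver xs f = foldr ℤ._+_ 0ℤ (map f xs)

module _ {A : Set} where

  sum-cong : ∀ {f g : A → ℤ} (xs : List A) → (∀ {x} → x ∈ xs → f x ≡ g x) → sumOver xs f ≡ sumOver xs g
  sum-cong []       eq = refl
  sum-cong (x ∷ xs) eq = cong₂ ℤ._+_ (eq (here refl)) (sum-cong xs (λ x∈ → eq (there x∈)))

  sum-zero : ∀ {f : A → ℤ} (xs : List A) → (∀ {x} → x ∈ xs → f x ≡ 0ℤ) → sumOver xs f ≡ 0ℤ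
  sum-zero []       eq = refl
  sum-zero (x ∷ xs) eq = cong₂ ℤ._+_ (eq (here refl)) (sum-zero xs (λ x∈ → eq (there x∈)))

  sum-+ : ∀ (xs : List A) (f g : A → ℤ) → sumOver xs (λ x → f x ℤ.+ g x) ≡ sumOver xs f ℤ.+ sumOver xs g
  sum-+ []       f g = refl
  sum-+ (x ∷ xs) f g = trans (cong (ℤ._+_ (f x ℤ.+ g x)) (sum-+ xs f g)) (lemma (f x) (g x) _ _)
    where
    lemma : ∀ a b c d → (a ℤ.+ b) ℤ.+ (c ℤ.+ d) ≡ (a ℤ.+ c) ℤ.+ (b ℤ.+ d)
    lemma = solve-∀

  *-sum : ∀ c (xs : List A) (f : A → ℤ) → c * sumOver xs f ≡ sumOver xs (λ x → c * f x)
  *-sum c []       f = ℤₚ.*-zeroʳ c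
  *-sum c (x ∷ xs) f = trans (ℤₚ.*-distribˡ-+ c (f x) _) (cong (ℤ._+_ (c * f x)) (*-sum c xs f))

  sum-* : ∀ c (xs : List A) (f : A → ℤ) → sumOver xs f * c ≡ sumOver xs (λ x → f x * c)
  sum-* c xs f = begin
    sumOver xs f * c           ≡⟨ ℤₚ.*-comm (sumOver xs f) c ⟩
    c * sumOver xs f           ≡⟨ *-sum c xs f ⟩
    sumOver xs (λ x → c * f x) ≡⟨ sum-cong xs (λ {x} _ → ℤₚ.*-comm c (f x)) ⟩
    sumOver xs (λ x → f x * c) ∎
    where open ≡-Reasoning

  sum-++ : ∀ (xs ys : List A) (f : A → ℤ) → sumOver (xs ++ ys) f ≡ sumOver xs f ℤ.+ sumOver ys f
  sum-++ []       ys f = sym (ℤₚ.+-identityˡ _)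
  sum-++ (x ∷ xs) ys f = trans (cong (ℤ._+_ (f x)) (sum-++ xs ys f)) (sym (ℤₚ.+-assoc (f x) _ _))

  sum-map : ∀ {B : Set} (φ : A → B) xs (f : B → ℤ) → sumOver (map φ xs) f ≡ sumOver xs (f ∘ φ)
  sum-map φ []       f = refl
  sum-map φ (x ∷ xs) f = cong (ℤ._+_ (f (φ x))) (sum-map φ xs f)

  sum-↭ : ∀ {xs ys : List A} (f : A → ℤ) → xs ↭ ys → sumOver xs f ≡ sumOver ys f
  sum-↭ f Perm.refl         = refl
  sum-↭ f (Perm.prep x p)   = cong (ℤ._+_ (f x)) (sum-↭ f p)
  sum-↭ f (Perm.swap x y p) = trans (cong (λ t → f x ℤ.+ (f y ℤ.+ t)) (sum-↭ f p)) (lemma (f x) (f y) _)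
    where
    lemma : ∀ a b c → a ℤ.+ (b ℤ.+ c) ≡ b ℤ.+ (a ℤ.+ c)
    lemma = solve-∀
  sum-↭ f (Perm.trans p q)  = trans (sum-↭ f p) (sum-↭ f q)

  length-as-sum : ∀ (xs : List A) → + length xs ≡ sumOver xs (λ _ → 1ℤ)
  length-as-sum []       = refl
  length-as-sum (x ∷ xs) = trans (ℤₚ.pos-+ 1 (length xs)) (cong (ℤ._+_ 1ℤ) (length-as-sum xs))

sum-swap : ∀ {A B : Set} (xs : List A) (ys : List B) (f : A → B → ℤ) →
  sumOver xs (λ x → sumOver ys (f x)) ≡ sumOver ys (λ y → sumOver xs (λ x → f x y))
sum-swap []       ys f = sym (sum-zero ys (λ _ → refl))
sum-swap (x ∷ xs) ys f = trans (cong (ℤ._+_ (sumOver ys (f x))) (sum-swap xs ys f)) (sym (sum-+ ys (f x) _))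

sum-productWith : ∀ {A B C : Set} (_∙_ : A → B → C) xs ys (f : C → ℤ) →
  sumOver (cartesianProductWith _∙_ xs ys) f ≡ sumOver xs (λ x → sumOver ys (λ y → f (x ∙ y)))
sum-productWith _∙_ []       ys f = refl
sum-productWith _∙_ (x ∷ xs) ys f = begin
  sumOver (map (x ∙_) ys ++ cartesianProductWith _∙_ xs ys) f
    ≡⟨ sum-++ (map (x ∙_) ys) _ f ⟩
  sumOver (map (x ∙_) ys) f ℤ.+ sumOver (cartesianProductWith _∙_ xs ys) f
    ≡⟨ cong₂ ℤ._+_ (sum-map (x ∙_) ys f) (sum-productWith _∙_ xs ys f) ⟩
  sumOver ys (λ y → f (x ∙ y)) ℤ.+ sumOver xs (λ x → sumOver ys (λ y → f (x ∙ y))) ∎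
  where open ≡-Reasoning

-- With this encoding `h n γ` is `⟦ sum γ ≟ n ⟧` by definition.
⟦_⟧ : {P : Set} → Dec P → ℤ
⟦ P? ⟧ = if does P? then 1ℤ else 0ℤ

module _ {P : Set} (P? : Dec P) where

  ⟦⟧-yes : P → ⟦ P? ⟧ ≡ 1ℤ
  ⟦⟧-yes p = cong (if_then 1ℤ else 0ℤ) (dec-true P? p)

  ⟦⟧-no : ¬ P → ⟦ P? ⟧ ≡ 0ℤ
  ⟦⟧-no ¬p = cong (if_then 1ℤ else 0ℤ) (dec-false P? ¬p)

  ⟦⟧*-yes : ∀ {a} → P → ⟦ P? ⟧ * a ≡ a
  ⟦⟧*-yes {a} p = trans (cong (_* a) (⟦⟧-yes p)) (ℤₚ.*-identityˡ a)

  ⟦⟧*-no : ∀ {a} → ¬ P → ⟦ P? ⟧ * a ≡ 0ℤ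
  ⟦⟧*-no {a} ¬p = trans (cong (_* a) (⟦⟧-no ¬p)) (ℤₚ.*-zeroˡ a)

⟦⟧*-cong : ∀ {P : Set} (P? : Dec P) {a b} → (P → a ≡ b) → ⟦ P? ⟧ * a ≡ ⟦ P? ⟧ * b
⟦⟧*-cong (yes p) eq = cong (1ℤ *_) (eq p)
⟦⟧*-cong (no _)  eq = refl

⟦⟧*-zero : ∀ {P : Set} (P? : Dec P) {a} → (P → a ≡ 0ℤ) → ⟦ P? ⟧ * a ≡ 0ℤ
⟦⟧*-zero P? eq = trans (⟦⟧*-cong P? eq) (ℤₚ.*-zeroʳ ⟦ P? ⟧)

⟦⟧*-absorb : ∀ {P : Set} (P? : Dec P) {a} → (¬ P → a ≡ 0ℤ) → ⟦ P? ⟧ * a ≡ a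
⟦⟧*-absorb (yes _) {a} eq = ℤₚ.*-identityˡ a
⟦⟧*-absorb (no ¬p)     eq = sym (eq ¬p)

⟦⟧-cong : ∀ {P Q : Set} (P? : Dec P) (Q? : Dec Q) → (P → Q) → (Q → P) → ⟦ P? ⟧ ≡ ⟦ Q? ⟧
⟦⟧-cong P? (yes q) f g = ⟦⟧-yes P? (g q)
⟦⟧-cong P? (no ¬q) f g = ⟦⟧-no P? (¬q ∘ f)

⟦⟧-× : ∀ {P Q : Set} (P? : Dec P) (Q? : Dec Q) → ⟦ P? ×-dec Q? ⟧ ≡ ⟦ P? ⟧ * ⟦ Q? ⟧
⟦⟧-× (yes _) (yes _) = refl
⟦⟧-× (yes _) (no _)  = refl
⟦⟧-× (no _)  _       = refl

module _ {A : Set} where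

  sum-filter : ∀ {P : A → Set} (P? : Decidable P) xs (f : A → ℤ) →
    sumOver (filter P? xs) f ≡ sumOver xs (λ x → ⟦ P? x ⟧ * f x)
  sum-filter P? []       f = refl
  sum-filter P? (x ∷ xs) f with P? x
  ... | yes _ = cong₂ ℤ._+_ (sym (ℤₚ.*-identityˡ (f x))) (sum-filter P? xs f)
  ... | no  _ = trans (sum-filter P? xs f) (sym (ℤₚ.+-identityˡ _))

  sum-single : ∀ {xs : List A} {x₀} (f : A → ℤ) → Unique xs → x₀ ∈ xs →
    (∀ {x} → x ∈ xs → x ≢ x₀ → f x ≡ 0ℤ) → sumOver xs f ≡ f x₀
  sum-single {x ∷ xs} f (x∉ ∷ _) (here refl) eq =
    trans (cong (ℤ._+_ (f x)) (sum-zero xs (λ y∈ → eq (there y∈) (λ y≡x → All.lookup x∉ y∈ (sym y≡x)))))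
          (ℤₚ.+-identityʳ (f x))
  sum-single {x ∷ xs} f (x∉ ∷ u) (there x₀∈) eq =
    trans (cong₂ ℤ._+_ (eq (here refl) (All.lookup x∉ x₀∈)) (sum-single f u x₀∈ (λ y∈ → eq (there y∈))))
          (ℤₚ.+-identityˡ _)

  unique-map : ∀ {B : Set} {xs : List A} (φ : A → B) → Unique xs →
    (∀ {x y} → x ∈ xs → y ∈ xs → φ x ≡ φ y → x ≡ y) → Unique (map φ xs)
  unique-map {xs = []}     φ []       inj = []
  unique-map {xs = x ∷ xs} φ (x∉ ∷ u) inj =
    All.tabulate (λ z∈ φx≡z → let y , y∈ , z≡φy = ∈-map⁻ φ z∈ in
      All.lookup x∉ y∈ (inj (here refl) (there y∈) (trans φx≡z z≡φy)))
    ∷ unique-map φ u (λ x∈ y∈ → inj (there x∈) (there y∈))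

  -- Duplicate-free lists with the same elements are permutations of each other, so a bijection on
  -- membership is enough; the order of enumeration is irrelevant.
  sum-reindex : ∀ {B : Set} {xs : List A} {ys : List B} (φ : A → B) (f : B → ℤ) → Unique xs → Unique ys →
    (∀ {x} → x ∈ xs → φ x ∈ ys) →
    (∀ {x y} → x ∈ xs → y ∈ xs → φ x ≡ φ y → x ≡ y) →
    (∀ {y} → y ∈ ys → ∃ λ x → x ∈ xs × y ≡ φ x) →
    sumOver ys f ≡ sumOver xs (f ∘ φ)
  sum-reindex {xs = xs} {ys} φ f u v into inj onto =
    trans (sum-↭ f (∼bag⇒↭ (unique∧set⇒bag v (unique-map φ u inj) (mk⇔ to from)))) (sum-map φ xs f)
    where
    to : ∀ {y} → y ∈ ys → y ∈ map φ xs
    to y∈ = let x , x∈ , y≡ = onto y∈ in subst (_∈ map φ xs) (sym y≡) (∈-map⁺ φ x∈)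
    from : ∀ {y} → y ∈ map φ xs → y ∈ ys
    from y∈ = let x , x∈ , y≡ = ∈-map⁻ φ y∈ in subst (_∈ ys) (sym y≡) (into x∈)

-- Interlacing vectors

size : ∀ {L} → Vec ℕ L → ℕ
size = Vec.sum

_≟ᵥ_ : ∀ {L} (x y : Vec ℕ L) → Dec (x ≡ y)
_≟ᵥ_ = vec-≡-dec _≟_

_≼_ : ∀ {L} → Vec ℕ L → Vec ℕ L → Set
_≼_ = Pointwise _≤_

_≼?_ : ∀ {L} (x y : Vec ℕ L) → Dec (x ≼ y)
_≼?_ = PW.decidable _≤?_

≼-trans : ∀ {L} {x y z : Vec ℕ L} → x ≼ y → y ≼ z → x ≼ z
≼-trans = PW.trans ℕₚ.≤-trans

size-mono : ∀ {L} {x y : Vec ℕ L} → x ≼ y → size x ≤ size y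
size-mono []       = z≤n
size-mono (p ∷ ps) = ℕₚ.+-mono-≤ p (size-mono ps)

≼∧size⇒≡ : ∀ {L} {x y : Vec ℕ L} → x ≼ y → size x ≡ size y → x ≡ y
≼∧size⇒≡ [] _ = refl
≼∧size⇒≡ {x = a ∷ x} {b ∷ y} (p ∷ ps) eq with a ≟ b
... | yes refl = cong (a ∷_) (≼∧size⇒≡ ps (ℕₚ.+-cancelˡ-≡ a _ _ eq))
... | no a≢b   = ⊥-elim (ℕₚ.<⇒≢ (ℕₚ.+-mono-<-≤ (ℕₚ.≤∧≢⇒< p a≢b) (size-mono ps)) eq)

-- u ≥ ν₁ ≥ κ₁ ≥ ν₂ ≥ κ₂ ≥ …
Inter : ∀ {L} → ℕ → Vec ℕ L → Vec ℕ L → Set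
Inter u []      []      = ⊤
Inter u (v ∷ ν) (k ∷ κ) = (k ≤ v × v ≤ u) × Inter k ν κ

inter? : ∀ {L} u (ν κ : Vec ℕ L) → Dec (Inter u ν κ)
inter? u []      []      = yes tt
inter? u (v ∷ ν) (k ∷ κ) = (k ≤? v ×-dec v ≤? u) ×-dec inter? k ν κ

Inter⇒≼ : ∀ {L u} (ν κ : Vec ℕ L) → Inter u ν κ → κ ≼ ν
Inter⇒≼ []      []      _                = []
Inter⇒≼ (v ∷ ν) (k ∷ κ) ((k≤v , _) , i) = k≤v ∷ Inter⇒≼ ν κ i

-- A spare row at the bottom. It passes down to every smaller vector and pins the unpartnered last
-- row of `σ` in `reflect-rows`.
EndsInZero : ∀ {L} → Vec ℕ (suc L) → Set
EndsInZero (k ∷ [])         = k ≡ 0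
EndsInZero (_ ∷ κ@(_ ∷ _)) = EndsInZero κ

≼-endsInZero : ∀ {L} {x y : Vec ℕ (suc L)} → x ≼ y → EndsInZero y → EndsInZero x
≼-endsInZero (p ∷ [])         refl = ℕₚ.n≤0⇒n≡0 p
≼-endsInZero (_ ∷ ps@(_ ∷ _)) z    = ≼-endsInZero ps z

sum-pull : ∀ {A : Set} (xs : List A) a b (p q g : A → ℤ) →
  sumOver xs (λ x → (a * p x) * ((b * q x) * g x)) ≡ a * (b * sumOver xs (λ x → p x * (q x * g x)))
sum-pull xs a b p q g = begin
  sumOver xs (λ x → (a * p x) * ((b * q x) * g x)) ≡⟨ sum-cong xs (λ {x} _ → rearrange a b (p x) (q x) (g x)) ⟩
  sumOver xs (λ x → a * (b * (p x * (q x * g x)))) ≡⟨ *-sum a xs _ ⟨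
  a * sumOver xs (λ x → b * (p x * (q x * g x)))   ≡⟨ cong (a *_) (*-sum b xs _) ⟨
  a * (b * sumOver xs (λ x → p x * (q x * g x)))   ∎
  where
  open ≡-Reasoning
  rearrange : ∀ a b p q g → (a * p) * ((b * q) * g) ≡ a * (b * (p * (q * g)))
  rearrange = solve-∀

⊔+⊓ : ∀ a b → (a ⊔ b) + (a ⊓ b) ≡ a + b
⊔+⊓ zero    b       = ℕₚ.+-identityʳ b
⊔+⊓ (suc a) zero    = refl
⊔+⊓ (suc a) (suc b) = cong suc (trans (ℕₚ.+-suc (a ⊔ b) (a ⊓ b)) (trans (cong suc (⊔+⊓ a b)) (sym (ℕₚ.+-suc a b))))

-- Sums over a box and the reflection of intervals

module _ (B : ℕ) where

  box : ∀ L → List (Vec ℕ L)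
  box zero    = [] ∷ []
  box (suc L) = cartesianProductWith _∷_ (upTo B) (box L)

  vbox-unique : ∀ L → Unique (box L)
  vbox-unique zero    = [] ∷ []
  vbox-unique (suc L) = Unique.cartesianProductWith⁺ _∷_ ∷-injective (Unique.upTo⁺ B) (vbox-unique L)

  ∈-box⁺ : ∀ {L} {x : Vec ℕ L} → VAll (_< B) x → x ∈ box L
  ∈-box⁺ []       = here refl
  ∈-box⁺ (p ∷ ps) = ∈-cartesianProductWith⁺ _∷_ (∈-upTo⁺ p) (∈-box⁺ ps)

  ∈-box⁻ : ∀ {L} {x : Vec ℕ L} → x ∈ box L → VAll (_< B) x
  ∈-box⁻ {zero}  {[]} _  = []
  ∈-box⁻ {suc L} x∈ with ∈-cartesianProductWith⁻ _∷_ (upTo B) (box L) x∈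
  ... | v , ν , v∈ , ν∈ , refl = ∈-upTo⁻ v∈ ∷ ∈-box⁻ ν∈

  size<⇒below : ∀ {L} (x : Vec ℕ L) → size x < B → VAll (_< B) x
  size<⇒below []      _ = []
  size<⇒below (v ∷ ν) p = ℕₚ.≤-<-trans (ℕₚ.m≤m+n v (size ν)) p ∷ size<⇒below ν (ℕₚ.≤-<-trans (ℕₚ.m≤n+m (size ν) v) p)

  sum-box : ∀ {L} (f : Vec ℕ (suc L) → ℤ) →
    sumOver (box (suc L)) f ≡ sumOver (upTo B) (λ v → sumOver (box L) (λ ν → f (v ∷ ν)))
  sum-box {L} f = sum-productWith _∷_ (upTo B) (box L) f

  -- The involution `v ↦ b + a ∸ v` permutes the interval, and `b < B` keeps the whole interval
  -- inside the range of summation. `G` takes integers so that reflected sizes can be shifted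
  -- without truncated subtraction.
  reflect-interval : ∀ a b (G : ℤ → ℤ) → b < B →
    sumOver (upTo B) (λ v → ⟦ a ≤? v ×-dec v ≤? b ⟧ * G (+ v)) ≡
    sumOver (upTo B) (λ v → ⟦ a ≤? v ×-dec v ≤? b ⟧ * G (+ b ℤ.+ + a ℤ.- + v))
  reflect-interval a b G b<B = begin
    sumOver (upTo B) (λ v → ⟦ P? v ⟧ * G (+ v))            ≡⟨ sum-filter P? (upTo B) _ ⟨
    sumOver interval (λ v → G (+ v))                       ≡⟨ sum-reindex φ (λ v → G (+ v)) u u into inj onto ⟩
    sumOver interval (λ v → G (+ (b + a ∸ v)))             ≡⟨ sum-cong interval (λ v∈ → cong G (toℤ (v≤b+a (bounds v∈)))) ⟩
    sumOver interval (λ v → G (+ b ℤ.+ + a ℤ.- + v))       ≡⟨ sum-filter P? (upTo B) _ ⟩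
    sumOver (upTo B) (λ v → ⟦ P? v ⟧ * G (+ b ℤ.+ + a ℤ.- + v)) ∎
    where
    open ≡-Reasoning
    P? = λ v → a ≤? v ×-dec v ≤? b
    interval = filter P? (upTo B)
    u = Unique.filter⁺ P? (Unique.upTo⁺ B)
    φ = λ v → b + a ∸ v

    bounds : ∀ {v} → v ∈ interval → a ≤ v × v ≤ b
    bounds v∈ = proj₂ (∈-filter⁻ P? {xs = upTo B} v∈)
    v≤b+a : ∀ {v} → a ≤ v × v ≤ b → v ≤ b + a
    v≤b+a (_ , v≤b) = ℕₚ.≤-trans v≤b (ℕₚ.m≤m+n b a)
    toℤ : ∀ {v} → v ≤ b + a → + (b + a ∸ v) ≡ + b ℤ.+ + a ℤ.- + v
    toℤ {v} v≤ = trans (sym (ℤₚ.⊖-≥ v≤)) (trans (sym (ℤₚ.m-n≡m⊖n (b + a) v)) (cong (ℤ._- + v) (ℤₚ.pos-+ b a)))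
    φ-bounds : ∀ {v} → a ≤ v × v ≤ b → a ≤ φ v × φ v ≤ b
    φ-bounds {v} (a≤v , v≤b) =
      subst (_≤ φ v) (ℕₚ.m+n∸m≡n b a) (ℕₚ.∸-monoʳ-≤ (b + a) v≤b) ,
      subst (φ v ≤_) (ℕₚ.m+n∸n≡m b a) (ℕₚ.∸-monoʳ-≤ (b + a) a≤v)
    into : ∀ {v} → v ∈ interval → φ v ∈ interval
    into v∈ = let p = φ-bounds (bounds v∈) in ∈-filter⁺ P? (∈-upTo⁺ (ℕₚ.≤-<-trans (proj₂ p) b<B)) p
    invol : ∀ {v} → v ∈ interval → φ (φ v) ≡ v
    invol v∈ = ℕₚ.m∸[m∸n]≡n (v≤b+a (bounds v∈))
    inj : ∀ {v w} → v ∈ interval → w ∈ interval → φ v ≡ φ w → v ≡ w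
    inj v∈ w∈ eq = trans (sym (invol v∈)) (trans (cong φ eq) (invol w∈))
    onto : ∀ {v} → v ∈ interval → ∃ λ w → w ∈ interval × v ≡ φ w
    onto {v} v∈ = φ v , into v∈ , sym (invol v∈)

  intervals-∩ : ∀ l′ l k′ k v x →
    ⟦ l′ ≤? v ×-dec v ≤? l ⟧ * (⟦ k′ ≤? v ×-dec v ≤? k ⟧ * x) ≡ ⟦ (l′ ⊔ k′) ≤? v ×-dec v ≤? (l ⊓ k) ⟧ * x
  intervals-∩ l′ l k′ k v x = begin
    ⟦ p? ⟧ * (⟦ q? ⟧ * x)   ≡⟨ ℤₚ.*-assoc ⟦ p? ⟧ ⟦ q? ⟧ x ⟨
    (⟦ p? ⟧ * ⟦ q? ⟧) * x   ≡⟨ cong (_* x) (⟦⟧-× p? q?) ⟨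
    ⟦ p? ×-dec q? ⟧ * x     ≡⟨ cong (_* x) (⟦⟧-cong (p? ×-dec q?) ((l′ ⊔ k′) ≤? v ×-dec v ≤? (l ⊓ k))
        (λ { ((a , b) , (c , d)) → ℕₚ.⊔-lub a c , ℕₚ.⊓-glb b d })
        (λ (a , b) → (ℕₚ.≤-trans (ℕₚ.m≤m⊔n l′ k′) a , ℕₚ.≤-trans b (ℕₚ.m⊓n≤m l k))
                   , (ℕₚ.≤-trans (ℕₚ.m≤n⊔m l′ k′) a , ℕₚ.≤-trans b (ℕₚ.m⊓n≤n l k)))) ⟩
    ⟦ (l′ ⊔ k′) ≤? v ×-dec v ≤? (l ⊓ k) ⟧ * x ∎
    where
    open ≡-Reasoning
    p? = l′ ≤? v ×-dec v ≤? l
    q? = k′ ≤? v ×-dec v ≤? k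

  -- Both sums run over products of the intervals [lᵢ₊₁ ⊔ kᵢ₊₁ , lᵢ ⊓ kᵢ]; reflecting
  -- each of them exchanges the two.
  reflect-rows : ∀ {L} l k (x y : Vec ℕ L) (g : ℤ → ℤ) → VAll (_< B) (k ∷ y) → EndsInZero (k ∷ y) →
    sumOver (box L) (λ ν → ⟦ inter? l ν x ⟧ * (⟦ inter? k ν y ⟧ * g (+ size ν))) ≡
    sumOver (box (suc L)) (λ σ → ⟦ inter? l (l ∷ x) σ ⟧ * (⟦ inter? k (k ∷ y) σ ⟧ *
      g (+ (l ⊓ k) ℤ.+ (+ size x ℤ.+ + size y) ℤ.- + size σ)))
  reflect-rows l k [] [] g (k<B ∷ []) refl = begin
    -- `ν` has no rows left, but `σ` still has one; `EndsInZero` gives `k = 0`, so this row can only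
    -- be `0`.
    1ℤ * (1ℤ * g 0ℤ) ℤ.+ 0ℤ     ≡⟨ solve₁ (g 0ℤ) ⟩
    g 0ℤ                        ≡⟨ cong g m≡0 ⟨
    g (f (0 ∷ []))              ≡⟨ ⟦⟧*-yes (inter? 0 (0 ∷ []) (0 ∷ [])) ((z≤n , z≤n) , tt) ⟨
    ⟦ inter? 0 (0 ∷ []) (0 ∷ []) ⟧ * g (f (0 ∷ []))
      ≡⟨ ⟦⟧*-yes (inter? l (l ∷ []) (0 ∷ [])) ((z≤n , ℕₚ.≤-refl) , tt) ⟨
    F (0 ∷ [])                  ≡⟨ sum-single F (vbox-unique 1) (∈-box⁺ (k<B ∷ [])) vanish ⟨
    sumOver (box 1) F           ∎
    where
    open ≡-Reasoning
    f : Vec ℕ 1 → ℤ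
    f σ = + (l ⊓ 0) ℤ.+ (+ 0 ℤ.+ + 0) ℤ.- + size σ
    F : Vec ℕ 1 → ℤ
    F σ = ⟦ inter? l (l ∷ []) σ ⟧ * (⟦ inter? 0 (0 ∷ []) σ ⟧ * g (f σ))
    solve₁ : ∀ a → 1ℤ * (1ℤ * a) ℤ.+ 0ℤ ≡ a
    solve₁ = solve-∀
    m≡0 : f (0 ∷ []) ≡ 0ℤ
    m≡0 = cong (λ m → + m ℤ.+ (+ 0 ℤ.+ + 0) ℤ.- + 0) (ℕₚ.⊓-zeroʳ l)
    vanish : ∀ {σ} → σ ∈ box 1 → σ ≢ 0 ∷ [] → F σ ≡ 0ℤ
    vanish {s ∷ []} _ σ≢ = trans (cong (⟦ inter? l (l ∷ []) (s ∷ []) ⟧ *_)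
      (⟦⟧*-no (inter? 0 (0 ∷ []) (s ∷ [])) (λ ((s≤0 , _) , _) → σ≢ (cong (_∷ []) (ℕₚ.n≤0⇒n≡0 s≤0)))))
      (ℤₚ.*-zeroʳ ⟦ inter? l (l ∷ []) (s ∷ []) ⟧)
  reflect-rows {suc L} l k (l′ ∷ x) (k′ ∷ y) g (k<B ∷ below) ends = begin
    sumOver (box (suc L)) (λ ν → ⟦ inter? l ν (l′ ∷ x) ⟧ * (⟦ inter? k ν (k′ ∷ y) ⟧ * g (+ size ν)))
      ≡⟨ sum-box _ ⟩
    sumOver (upTo B) (λ v → sumOver (box L) (λ ν →
      ⟦ inter? l (v ∷ ν) (l′ ∷ x) ⟧ * (⟦ inter? k (v ∷ ν) (k′ ∷ y) ⟧ * g (+ size (v ∷ ν)))))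
      ≡⟨ sum-cong (upTo B) (λ {v} _ → rows v) ⟩
    sumOver (upTo B) (λ v → I v * (J v * G (+ v)))
      ≡⟨ sum-cong (upTo B) (λ {v} _ → intervals-∩ l′ l k′ k v _) ⟩
    sumOver (upTo B) (λ v → ⟦ (l′ ⊔ k′) ≤? v ×-dec v ≤? (l ⊓ k) ⟧ * G (+ v))
      ≡⟨ reflect-interval (l′ ⊔ k′) (l ⊓ k) G (ℕₚ.≤-<-trans (ℕₚ.m⊓n≤n l k) k<B) ⟩
    sumOver (upTo B) (λ v → ⟦ (l′ ⊔ k′) ≤? v ×-dec v ≤? (l ⊓ k) ⟧ * G (+ (l ⊓ k) ℤ.+ + (l′ ⊔ k′) ℤ.- + v))
      ≡⟨ sum-cong (upTo B) (λ {v} _ → intervals-∩ l′ l k′ k v _) ⟨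
    sumOver (upTo B) (λ v → I v * (J v * G (+ (l ⊓ k) ℤ.+ + (l′ ⊔ k′) ℤ.- + v)))
      ≡⟨ sum-cong (upTo B) (λ {v} _ → rows′ v) ⟨
    sumOver (upTo B) (λ s → sumOver (box (suc L)) (λ σ → H (s ∷ σ)))
      ≡⟨ sum-box H ⟨
    sumOver (box (suc (suc L))) H ∎
    where
    open ≡-Reasoning
    I J : ℕ → ℤ
    I v = ⟦ l′ ≤? v ×-dec v ≤? l ⟧
    J v = ⟦ k′ ≤? v ×-dec v ≤? k ⟧
    c : Vec ℕ (suc L) → ℤ
    c σ = + (l′ ⊓ k′) ℤ.+ (+ size x ℤ.+ + size y) ℤ.- + size σ
    G : ℤ → ℤ
    G z = sumOver (box (suc L)) (λ σ → ⟦ inter? l′ (l′ ∷ x) σ ⟧ * (⟦ inter? k′ (k′ ∷ y) σ ⟧ * g (z ℤ.+ c σ)))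
    H : Vec ℕ (suc (suc L)) → ℤ
    H σ = ⟦ inter? l (l ∷ l′ ∷ x) σ ⟧ * (⟦ inter? k (k ∷ k′ ∷ y) σ ⟧ *
      g (+ (l ⊓ k) ℤ.+ (+ size (l′ ∷ x) ℤ.+ + size (k′ ∷ y)) ℤ.- + size σ))

    rows : ∀ v → sumOver (box L) (λ ν →
      ⟦ inter? l (v ∷ ν) (l′ ∷ x) ⟧ * (⟦ inter? k (v ∷ ν) (k′ ∷ y) ⟧ * g (+ size (v ∷ ν)))) ≡ I v * (J v * G (+ v))
    rows v = begin
      sumOver (box L) (λ ν → ⟦ inter? l (v ∷ ν) (l′ ∷ x) ⟧ * (⟦ inter? k (v ∷ ν) (k′ ∷ y) ⟧ * g (+ size (v ∷ ν))))
        ≡⟨ sum-cong (box L) (λ {ν} _ → cong₂ _*_ (⟦⟧-× (l′ ≤? v ×-dec v ≤? l) (inter? l′ ν x))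
             (cong₂ _*_ (⟦⟧-× (k′ ≤? v ×-dec v ≤? k) (inter? k′ ν y)) (cong g (ℤₚ.pos-+ v (size ν))))) ⟩
      sumOver (box L) (λ ν → (I v * ⟦ inter? l′ ν x ⟧) * ((J v * ⟦ inter? k′ ν y ⟧) * g (+ v ℤ.+ + size ν)))
        ≡⟨ sum-pull (box L) (I v) (J v) _ _ _ ⟩
      I v * (J v * sumOver (box L) (λ ν → ⟦ inter? l′ ν x ⟧ * (⟦ inter? k′ ν y ⟧ * g (+ v ℤ.+ + size ν))))
        ≡⟨ cong (λ t → I v * (J v * t)) (reflect-rows l′ k′ x y (λ z → g (+ v ℤ.+ z)) below ends) ⟩
      I v * (J v * G (+ v)) ∎

    -- In `Inter` with `ν` above, both bounds on a row of `ν` sit in one pair. For `σ` below, the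
    -- lower bound `a′ ≤ v` belongs to the next pair and is brought forward here; the bound `a ≤ a`
    -- left behind is trivial.
    split : ∀ {n} a a′ (z : Vec ℕ n) v σ →
      ⟦ inter? a (a ∷ a′ ∷ z) (v ∷ σ) ⟧ ≡ ⟦ a′ ≤? v ×-dec v ≤? a ⟧ * ⟦ inter? a′ (a′ ∷ z) σ ⟧
    split a a′ z v σ@(_ ∷ _) = trans
      (⟦⟧-cong (inter? a (a ∷ a′ ∷ z) (v ∷ σ)) ((a′ ≤? v ×-dec v ≤? a) ×-dec inter? a′ (a′ ∷ z) σ)
        (λ { ((v≤a , _) , (s≤a′ , a′≤v) , i) → (a′≤v , v≤a) , (s≤a′ , ℕₚ.≤-refl) , i })
        (λ { ((a′≤v , v≤a) , (s≤a′ , _) , i) → (v≤a , ℕₚ.≤-refl) , (s≤a′ , a′≤v) , i }))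
      (⟦⟧-× (a′ ≤? v ×-dec v ≤? a) (inter? a′ (a′ ∷ z) σ))

    -- By `⊔+⊓`, the parts `l′` and `k′` supply the lower end `l′ ⊔ k′` of the interval of this row
    -- and the upper end `l′ ⊓ k′` of the next one. The constant thus splits into one reflection
    -- constant per row.
    sizes : ∀ v σ → + (l ⊓ k) ℤ.+ (+ size (l′ ∷ x) ℤ.+ + size (k′ ∷ y)) ℤ.- + size (v ∷ σ)
      ≡ (+ (l ⊓ k) ℤ.+ + (l′ ⊔ k′) ℤ.- + v) ℤ.+ c σ
    sizes v σ = begin
      + (l ⊓ k) ℤ.+ (+ (l′ + size x) ℤ.+ + (k′ + size y)) ℤ.- + (v + size σ)
        ≡⟨ cong₂ (λ s t → + (l ⊓ k) ℤ.+ s ℤ.- t) (cong₂ ℤ._+_ (ℤₚ.pos-+ l′ (size x)) (ℤₚ.pos-+ k′ (size y))) (ℤₚ.pos-+ v (size σ)) ⟩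
      + (l ⊓ k) ℤ.+ ((+ l′ ℤ.+ + size x) ℤ.+ (+ k′ ℤ.+ + size y)) ℤ.- (+ v ℤ.+ + size σ)
        ≡⟨ regroup (+ (l ⊓ k)) (+ l′) (+ k′) (+ size x) (+ size y) (+ v) (+ size σ) ⟩
      (+ (l ⊓ k) ℤ.- + v) ℤ.+ (+ l′ ℤ.+ + k′) ℤ.+ (+ size x ℤ.+ + size y) ℤ.- + size σ
        ≡⟨ cong (λ t → (+ (l ⊓ k) ℤ.- + v) ℤ.+ t ℤ.+ (+ size x ℤ.+ + size y) ℤ.- + size σ)
             (trans (sym (ℤₚ.pos-+ l′ k′)) (trans (cong +_ (sym (⊔+⊓ l′ k′))) (ℤₚ.pos-+ (l′ ⊔ k′) (l′ ⊓ k′)))) ⟩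
      (+ (l ⊓ k) ℤ.- + v) ℤ.+ (+ (l′ ⊔ k′) ℤ.+ + (l′ ⊓ k′)) ℤ.+ (+ size x ℤ.+ + size y) ℤ.- + size σ
        ≡⟨ regroup′ (+ (l ⊓ k)) (+ v) (+ (l′ ⊔ k′)) (+ (l′ ⊓ k′)) (+ size x ℤ.+ + size y) (+ size σ) ⟩
      (+ (l ⊓ k) ℤ.+ + (l′ ⊔ k′) ℤ.- + v) ℤ.+ c σ ∎
      where
      regroup : ∀ m a b p q v s → m ℤ.+ ((a ℤ.+ p) ℤ.+ (b ℤ.+ q)) ℤ.- (v ℤ.+ s) ≡ (m ℤ.- v) ℤ.+ (a ℤ.+ b) ℤ.+ (p ℤ.+ q) ℤ.- s
      regroup = solve-∀
      regroup′ : ∀ m v a b p s → (m ℤ.- v) ℤ.+ (a ℤ.+ b) ℤ.+ p ℤ.- s ≡ (m ℤ.+ a ℤ.- v) ℤ.+ (b ℤ.+ p ℤ.- s)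
      regroup′ = solve-∀

    rows′ : ∀ v → sumOver (box (suc L)) (λ σ → H (v ∷ σ)) ≡ I v * (J v * G (+ (l ⊓ k) ℤ.+ + (l′ ⊔ k′) ℤ.- + v))
    rows′ v = begin
      sumOver (box (suc L)) (λ σ → H (v ∷ σ))
        ≡⟨ sum-cong (box (suc L)) (λ {σ} _ → cong₂ _*_ (split l l′ x v σ) (cong₂ _*_ (split k k′ y v σ) (cong g (sizes v σ)))) ⟩
      sumOver (box (suc L)) (λ σ → (I v * ⟦ inter? l′ (l′ ∷ x) σ ⟧) * ((J v * ⟦ inter? k′ (k′ ∷ y) σ ⟧) *
        g ((+ (l ⊓ k) ℤ.+ + (l′ ⊔ k′) ℤ.- + v) ℤ.+ c σ)))
        ≡⟨ sum-pull (box (suc L)) (I v) (J v) _ _ _ ⟩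
      I v * (J v * G (+ (l ⊓ k) ℤ.+ + (l′ ⊔ k′) ℤ.- + v)) ∎

-- Moving the removal of a strip past the addition of a strip

module _ (B : ℕ) where

  -- The geometric series: the equation determines `v` as `m + (a ∸ d)`, and `m ≤ v` says exactly
  -- that `d ≤ a`. The hypothesis ensures that the box does not cut this solution off.
  sum-top : ∀ m a d → (d ≤ a → m + (a ∸ d) < B) →
    sumOver (upTo B) (λ v → ⟦ m ≤? v ×-dec (v + d ≟ m + a) ⟧) ≡ sumOver (upTo (suc a)) (λ j → ⟦ d ≟ j ⟧)
  sum-top m a d top<B with d ≤? a
  ... | yes d≤a = trans
    (trans (sum-single _ (Unique.upTo⁺ B) (∈-upTo⁺ (top<B d≤a))
             (λ {v} _ v≢ → ⟦⟧-no (m ≤? v ×-dec (v + d ≟ m + a)) (λ (_ , eq) → v≢ (ℕₚ.+-cancelʳ-≡ d _ _ (trans eq (sym v₀+d))))))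
           (⟦⟧-yes (m ≤? m + (a ∸ d) ×-dec (m + (a ∸ d) + d ≟ m + a)) (ℕₚ.m≤m+n m _ , v₀+d)))
    (sym (trans (sum-single _ (Unique.upTo⁺ (suc a)) (∈-upTo⁺ (s≤s d≤a)) (λ {j} _ j≢ → ⟦⟧-no (d ≟ j) (j≢ ∘ sym)))
                (⟦⟧-yes (d ≟ d) refl)))
    where
    v₀+d : m + (a ∸ d) + d ≡ m + a
    v₀+d = trans (ℕₚ.+-assoc m (a ∸ d) d) (cong (λ t → m + t) (ℕₚ.m∸n+n≡m d≤a))
  ... | no d≰a = trans
    (sum-zero (upTo B) (λ {v} _ → ⟦⟧-no (m ≤? v ×-dec (v + d ≟ m + a)) (λ (m≤v , eq) →
      d≰a (ℕₚ.+-cancelˡ-≤ m d a (ℕₚ.≤-trans (ℕₚ.+-monoˡ-≤ d m≤v) (ℕₚ.≤-reflexive eq))))))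
    (sym (sum-zero (upTo (suc a)) (λ {j} j∈ → ⟦⟧-no (d ≟ j) (λ { refl → d≰a (ℕₚ.≤-pred (∈-upTo⁻ j∈)) }))))

  -- The outer bound of `Inter` restricts only the first entry of the upper vector, here `k` itself.
  -- It converts the bounds produced by `reflect-rows` into the uniform `B`, which stands for no
  -- bound.
  inter-top : ∀ {L k} (x : Vec ℕ L) σ → k ≤ B → ⟦ inter? k (k ∷ x) σ ⟧ ≡ ⟦ inter? B (k ∷ x) σ ⟧
  inter-top {k = k} x (s ∷ σ) k≤B = ⟦⟧-cong (inter? k (k ∷ x) (s ∷ σ)) (inter? B (k ∷ x) (s ∷ σ))
    (λ { ((s≤k , _) , i) → (s≤k , k≤B) , i }) (λ { ((s≤k , _) , i) → (s≤k , ℕₚ.≤-refl) , i })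

  -- D(t) U(x) = (1 - xt)⁻¹ U(x) D(t); j ≤ a comes from the expansion of (1 - xt)⁻¹.
  local-rule : ∀ {L} (κ ρ : Vec ℕ (suc L)) a → VAll (_< B) ρ → EndsInZero ρ → size κ + a < B →
    sumOver (box B (suc L)) (λ ν → ⟦ inter? B ν κ ⟧ * (⟦ inter? B ν ρ ⟧ * ⟦ size ν ≟ size κ + a ⟧)) ≡
    sumOver (box B (suc L)) (λ σ → ⟦ inter? B κ σ ⟧ * (⟦ inter? B ρ σ ⟧ *
      sumOver (upTo (suc a)) (λ j → ⟦ size ρ ≟ size σ + j ⟧)))
  local-rule {L} (k ∷ κ) (r ∷ ρ) a below@(r<B ∷ _) ends κ+a<B = begin
    sumOver (box B (suc L)) (λ ν → ⟦ inter? B ν (k ∷ κ) ⟧ * (⟦ inter? B ν (r ∷ ρ) ⟧ * ⟦ size ν ≟ N ⟧))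
      ≡⟨ sum-box B _ ⟩
    sumOver (upTo B) (λ v → sumOver (box B L) (λ ν →
      ⟦ inter? B (v ∷ ν) (k ∷ κ) ⟧ * (⟦ inter? B (v ∷ ν) (r ∷ ρ) ⟧ * ⟦ v + size ν ≟ N ⟧)))
      -- The rows of `ν` below the first are reflected into `σ`; the first row `v` stays as it is,
      -- being bounded from below only.
      ≡⟨ sum-cong (upTo B) (λ {v} _ → rows v) ⟩
    sumOver (upTo B) (λ v → sumOver (box B (suc L)) (λ σ → I v * (J v * (E σ * (F σ * g v (c σ))))))
      ≡⟨ sum-swap (upTo B) (box B (suc L)) _ ⟩
    sumOver (box B (suc L)) (λ σ → sumOver (upTo B) (λ v → I v * (J v * (E σ * (F σ * g v (c σ))))))
      ≡⟨ sum-cong (box B (suc L)) (λ {σ} _ → columns σ) ⟩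
    sumOver (box B (suc L)) (λ σ → E σ * (F σ * sumOver (upTo B) (λ v → I v * (J v * g v (c σ)))))
      -- For fixed `σ` the size condition determines `v`, and `k ⊔ r ≤ v` becomes
      -- `size (r ∷ ρ) ∸ size σ ≤ a`; this difference is the index `j`.
      ≡⟨ sum-cong (box B (suc L)) (λ {σ} _ → ⟦⟧*-cong (inter? k (k ∷ κ) σ) (λ p → ⟦⟧*-cong (inter? r (r ∷ ρ) σ) (λ q →
           top σ (Inter⇒≼ _ σ p) (Inter⇒≼ _ σ q)))) ⟩
    sumOver (box B (suc L)) (λ σ → E σ * (F σ * R σ))
      ≡⟨ sum-cong (box B (suc L)) (λ {σ} _ → cong₂ (λ s t → s * (t * R σ)) (inter-top κ σ (ℕₚ.<⇒≤ k<B)) (inter-top ρ σ (ℕₚ.<⇒≤ r<B))) ⟩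
    sumOver (box B (suc L)) (λ σ → ⟦ inter? B (k ∷ κ) σ ⟧ * (⟦ inter? B (r ∷ ρ) σ ⟧ * R σ)) ∎
    where
    open ≡-Reasoning
    N = size (k ∷ κ) + a
    k<B : k < B
    k<B = ℕₚ.≤-<-trans (ℕₚ.≤-trans (ℕₚ.m≤m+n k (size κ)) (ℕₚ.m≤m+n _ a)) κ+a<B
    I J : ℕ → ℤ
    I v = ⟦ k ≤? v ×-dec v ≤? B ⟧
    J v = ⟦ r ≤? v ×-dec v ≤? B ⟧
    g : ℕ → ℤ → ℤ
    g v z = ⟦ + v ℤ.+ z ℤ.≟ + N ⟧
    c E F R : Vec ℕ (suc L) → ℤ
    c σ = + (k ⊓ r) ℤ.+ (+ size κ ℤ.+ + size ρ) ℤ.- + size σ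
    E σ = ⟦ inter? k (k ∷ κ) σ ⟧
    F σ = ⟦ inter? r (r ∷ ρ) σ ⟧
    R σ = sumOver (upTo (suc a)) (λ j → ⟦ size (r ∷ ρ) ≟ size σ + j ⟧)

    rows : ∀ v → sumOver (box B L) (λ ν →
      ⟦ inter? B (v ∷ ν) (k ∷ κ) ⟧ * (⟦ inter? B (v ∷ ν) (r ∷ ρ) ⟧ * ⟦ v + size ν ≟ N ⟧)) ≡
      sumOver (box B (suc L)) (λ σ → I v * (J v * (E σ * (F σ * g v (c σ)))))
    rows v = begin
      sumOver (box B L) (λ ν → ⟦ inter? B (v ∷ ν) (k ∷ κ) ⟧ * (⟦ inter? B (v ∷ ν) (r ∷ ρ) ⟧ * ⟦ v + size ν ≟ N ⟧))
        ≡⟨ sum-cong (box B L) (λ {ν} _ → cong₂ _*_ (⟦⟧-× (k ≤? v ×-dec v ≤? B) (inter? k ν κ))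
             (cong₂ _*_ (⟦⟧-× (r ≤? v ×-dec v ≤? B) (inter? r ν ρ))
                (⟦⟧-cong (v + size ν ≟ N) (+ v ℤ.+ + size ν ℤ.≟ + N)
                  (λ eq → trans (sym (ℤₚ.pos-+ v (size ν))) (cong +_ eq))
                  (λ eq → ℤₚ.+-injective (trans (ℤₚ.pos-+ v (size ν)) eq))))) ⟩
      sumOver (box B L) (λ ν → (I v * ⟦ inter? k ν κ ⟧) * ((J v * ⟦ inter? r ν ρ ⟧) * g v (+ size ν)))
        ≡⟨ sum-pull (box B L) (I v) (J v) _ _ _ ⟩
      I v * (J v * sumOver (box B L) (λ ν → ⟦ inter? k ν κ ⟧ * (⟦ inter? r ν ρ ⟧ * g v (+ size ν))))
        ≡⟨ cong (λ t → I v * (J v * t)) (reflect-rows B k r κ ρ (g v) below ends) ⟩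
      I v * (J v * sumOver (box B (suc L)) (λ σ → E σ * (F σ * g v (c σ))))
        ≡⟨ cong (I v *_) (*-sum (J v) (box B (suc L)) _) ⟩
      I v * sumOver (box B (suc L)) (λ σ → J v * (E σ * (F σ * g v (c σ))))
        ≡⟨ *-sum (I v) (box B (suc L)) _ ⟩
      sumOver (box B (suc L)) (λ σ → I v * (J v * (E σ * (F σ * g v (c σ))))) ∎

    columns : ∀ σ → sumOver (upTo B) (λ v → I v * (J v * (E σ * (F σ * g v (c σ))))) ≡
      E σ * (F σ * sumOver (upTo B) (λ v → I v * (J v * g v (c σ))))
    columns σ = begin
      sumOver (upTo B) (λ v → I v * (J v * (E σ * (F σ * g v (c σ)))))
        ≡⟨ sum-cong (upTo B) (λ {v} _ → rearrange (I v) (J v) (E σ) (F σ) (g v (c σ))) ⟩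
      sumOver (upTo B) (λ v → E σ * (F σ * (I v * (J v * g v (c σ)))))
        ≡⟨ *-sum (E σ) (upTo B) _ ⟨
      E σ * sumOver (upTo B) (λ v → F σ * (I v * (J v * g v (c σ))))
        ≡⟨ cong (E σ *_) (*-sum (F σ) (upTo B) _) ⟨
      E σ * (F σ * sumOver (upTo B) (λ v → I v * (J v * g v (c σ)))) ∎
      where
      rearrange : ∀ i j e f g → i * (j * (e * (f * g))) ≡ e * (f * (i * (j * g)))
      rearrange = solve-∀

    top : ∀ σ → σ ≼ (k ∷ κ) → σ ≼ (r ∷ ρ) → sumOver (upTo B) (λ v → I v * (J v * g v (c σ))) ≡ R σ
    top σ σ≼κ σ≼ρ = begin
      sumOver (upTo B) (λ v → I v * (J v * g v (c σ)))
        ≡⟨ sum-cong (upTo B) (λ {v} v∈ → trans (intervals-∩ B k B r B v _)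
             (trans (sym (⟦⟧-× ((k ⊔ r) ≤? v ×-dec v ≤? (B ⊓ B)) (+ v ℤ.+ c σ ℤ.≟ + N)))
                    (⟦⟧-cong (((k ⊔ r) ≤? v ×-dec v ≤? (B ⊓ B)) ×-dec (+ v ℤ.+ c σ ℤ.≟ + N)) ((k ⊔ r) ≤? v ×-dec (v + d ≟ (k ⊔ r) + a))
                      (λ ((p , _) , e) → p , to v e)
                      (λ (p , e) → (p , ℕₚ.⊓-glb (ℕₚ.<⇒≤ (∈-upTo⁻ v∈)) (ℕₚ.<⇒≤ (∈-upTo⁻ v∈))) , from v e)))) ⟩
      sumOver (upTo B) (λ v → ⟦ (k ⊔ r) ≤? v ×-dec (v + d ≟ (k ⊔ r) + a) ⟧)
        ≡⟨ sum-top (k ⊔ r) a d bound ⟩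
      sumOver (upTo (suc a)) (λ j → ⟦ d ≟ j ⟧)
        ≡⟨ sum-cong (upTo (suc a)) (λ {j} _ → ⟦⟧-cong (d ≟ j) (size (r ∷ ρ) ≟ size σ + j)
             (λ { refl → sym σ+d }) (λ eq → ℕₚ.+-cancelˡ-≡ (size σ) d j (trans σ+d eq))) ⟩
      R σ ∎
      where
      d = size (r ∷ ρ) ∸ size σ
      σ+d : size σ + d ≡ size (r ∷ ρ)
      σ+d = ℕₚ.m+[n∸m]≡n (size-mono σ≼ρ)

      difference : ∀ v → (+ v ℤ.+ c σ) ℤ.- + N ≡ + (v + d) ℤ.- + ((k ⊔ r) + a)
      difference v = begin
        (+ v ℤ.+ (+ (k ⊓ r) ℤ.+ (+ size κ ℤ.+ + size ρ) ℤ.- + size σ)) ℤ.- + (k + size κ + a)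
          ≡⟨ cong (λ t → (+ v ℤ.+ c σ) ℤ.- t) (trans (ℤₚ.pos-+ (k + size κ) a) (cong (ℤ._+ + a) (ℤₚ.pos-+ k (size κ)))) ⟩
        (+ v ℤ.+ (+ (k ⊓ r) ℤ.+ (+ size κ ℤ.+ + size ρ) ℤ.- + size σ)) ℤ.- (+ k ℤ.+ + size κ ℤ.+ + a)
          ≡⟨ regroup (+ v) (+ (k ⊓ r)) (+ size κ) (+ size ρ) (+ size σ) (+ k) (+ r) (+ a) ⟩
        (+ v ℤ.+ (+ r ℤ.+ + size ρ) ℤ.+ + (k ⊓ r)) ℤ.- (+ size σ ℤ.+ (+ k ℤ.+ + r) ℤ.+ + a)
          ≡⟨ cong₂ (λ s t → (+ v ℤ.+ s ℤ.+ + (k ⊓ r)) ℤ.- (+ size σ ℤ.+ t ℤ.+ + a))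
               (trans (sym (ℤₚ.pos-+ r (size ρ))) (trans (cong +_ (sym σ+d)) (ℤₚ.pos-+ (size σ) d)))
               (trans (sym (ℤₚ.pos-+ k r)) (trans (cong +_ (sym (⊔+⊓ k r))) (ℤₚ.pos-+ (k ⊔ r) (k ⊓ r)))) ⟩
        (+ v ℤ.+ (+ size σ ℤ.+ + d) ℤ.+ + (k ⊓ r)) ℤ.- (+ size σ ℤ.+ (+ (k ⊔ r) ℤ.+ + (k ⊓ r)) ℤ.+ + a)
          ≡⟨ regroup′ (+ v) (+ size σ) (+ d) (+ (k ⊓ r)) (+ (k ⊔ r)) (+ a) ⟩
        (+ v ℤ.+ + d) ℤ.- (+ (k ⊔ r) ℤ.+ + a)
          ≡⟨ cong₂ ℤ._-_ (ℤₚ.pos-+ v d) (ℤₚ.pos-+ (k ⊔ r) a) ⟨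
        + (v + d) ℤ.- + ((k ⊔ r) + a) ∎
        where
        regroup : ∀ v m κ ρ σ k r a → (v ℤ.+ (m ℤ.+ (κ ℤ.+ ρ) ℤ.- σ)) ℤ.- (k ℤ.+ κ ℤ.+ a) ≡ (v ℤ.+ (r ℤ.+ ρ) ℤ.+ m) ℤ.- (σ ℤ.+ (k ℤ.+ r) ℤ.+ a)
        regroup = solve-∀
        regroup′ : ∀ v σ d m n a → (v ℤ.+ (σ ℤ.+ d) ℤ.+ m) ℤ.- (σ ℤ.+ (n ℤ.+ m) ℤ.+ a) ≡ (v ℤ.+ d) ℤ.- (n ℤ.+ a)
        regroup′ = solve-∀

      to : ∀ v → + v ℤ.+ c σ ≡ + N → v + d ≡ (k ⊔ r) + a
      to v eq = ℤₚ.+-injective (ℤₚ.i-j≡0⇒i≡j _ _ (trans (sym (difference v)) (ℤₚ.i≡j⇒i-j≡0 eq)))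
      from : ∀ v → v + d ≡ (k ⊔ r) + a → + v ℤ.+ c σ ≡ + N
      from v eq = ℤₚ.i-j≡0⇒i≡j _ _ (trans (difference v) (ℤₚ.i≡j⇒i-j≡0 (cong +_ eq)))

      -- Keeps the only candidate for `v` inside the box. For `r` the estimate uses that
      -- `size (r ∷ ρ)` is `size σ + d` and that `σ` also lies below `k ∷ κ`.
      max : (k ⊔ r) ≤ size (k ∷ κ) + d
      max = ℕₚ.⊔-lub (ℕₚ.≤-trans (ℕₚ.m≤m+n k (size κ)) (ℕₚ.m≤m+n _ d))
        (ℕₚ.≤-trans (ℕₚ.m≤m+n r (size ρ)) (ℕₚ.≤-trans (ℕₚ.≤-reflexive (sym σ+d)) (ℕₚ.+-monoˡ-≤ d (size-mono σ≼κ))))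
      bound : d ≤ a → (k ⊔ r) + (a ∸ d) < B
      bound d≤a = ℕₚ.≤-<-trans (ℕₚ.≤-trans (ℕₚ.+-monoˡ-≤ (a ∸ d) max)
        (ℕₚ.≤-reflexive (trans (ℕₚ.+-assoc (size (k ∷ κ)) d (a ∸ d)) (cong (λ t → size (k ∷ κ) + t) (ℕₚ.m+[n∸m]≡n d≤a))))) κ+a<B

-- Chains of horizontal strips

Descending : ∀ {L} → ℕ → Vec ℕ L → Set
Descending u []      = ⊤
Descending u (v ∷ x) = v ≤ u × Descending v x

-- The sign (-1)^|μ/y| if μ/y has at most one cell in each row, and 0 otherwise.
signedStrip : ∀ {L} → Vec ℕ L → Vec ℕ L → ℤ
signedStrip []      []      = 1ℤ
signedStrip (m ∷ μ) (v ∷ y) = (⟦ v ≟ m ⟧ ℤ.- ⟦ suc v ≟ m ⟧) * signedStrip μ y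

signedStrip-vanish : ∀ {L} (μ y : Vec ℕ L) → ¬ y ≼ μ → signedStrip μ y ≡ 0ℤ
signedStrip-vanish []      []      ¬p = ⊥-elim (¬p [])
signedStrip-vanish (m ∷ μ) (v ∷ y) ¬p with v ≤? m
... | yes v≤m = trans (cong ((⟦ v ≟ m ⟧ ℤ.- ⟦ suc v ≟ m ⟧) *_) (signedStrip-vanish μ y (λ p → ¬p (v≤m ∷ p))))
                      (ℤₚ.*-zeroʳ (⟦ v ≟ m ⟧ ℤ.- ⟦ suc v ≟ m ⟧))
... | no v≰m  = trans (cong (_* signedStrip μ y) (cong₂ ℤ._-_
                  (⟦⟧-no (v ≟ m) (λ { refl → v≰m ℕₚ.≤-refl })) (⟦⟧-no (suc v ≟ m) (λ { refl → v≰m (ℕₚ.n≤1+n v) }))))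
                (ℤₚ.*-zeroˡ (signedStrip μ y))

module _ (B : ℕ) where

  -- The coefficient of x^γ in s_{α/κ}, computed along chains of horizontal strips.
  K : ∀ {L} → Vec ℕ L → Vec ℕ L → List ℕ → ℤ
  K     α κ []      = ⟦ α ≟ᵥ κ ⟧
  K {L} α κ (a ∷ γ) = sumOver (box B L) (λ ν → ⟦ inter? B ν κ ⟧ * (⟦ size ν ≟ size κ + a ⟧ * K α ν γ))

  K-size : ∀ {L} (α κ : Vec ℕ L) γ → size α ≢ size κ + sum γ → K α κ γ ≡ 0ℤ
  K-size α κ []      ≢ = ⟦⟧-no (α ≟ᵥ κ) (λ { refl → ≢ (sym (ℕₚ.+-identityʳ (size α))) })
  K-size {L} α κ (a ∷ γ) ≢ = sum-zero (box B L) (λ {ν} _ → ⟦⟧*-zero (inter? B ν κ) (λ _ →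
    ⟦⟧*-zero (size ν ≟ size κ + a) (λ eq → K-size α ν γ (λ e →
      ≢ (trans e (trans (cong (λ t → t + sum γ) eq) (ℕₚ.+-assoc (size κ) a (sum γ))))))))

  -- Chains only grow. Hence sums over `ν` need not record whether `ν` still fits below `α`.
  K-outside : ∀ {L} (α κ : Vec ℕ L) γ → ¬ κ ≼ α → K α κ γ ≡ 0ℤ
  K-outside α κ []      ⋠ = ⟦⟧-no (α ≟ᵥ κ) (λ { refl → ⋠ (PW.refl ℕₚ.≤-refl) })
  K-outside {L} α κ (a ∷ γ) ⋠ = sum-zero (box B L) (λ {ν} _ → ⟦⟧*-zero (inter? B ν κ) (λ i →
    trans (cong (⟦ size ν ≟ size κ + a ⟧ *_) (K-outside α ν γ (λ ν≼α → ⋠ (≼-trans (Inter⇒≼ ν κ i) ν≼α))))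
          (ℤₚ.*-zeroʳ ⟦ size ν ≟ size κ + a ⟧)))

  -- The coefficient of x^γ in s_{α/κ} · (h₀ + h₁ + h₂ + ⋯).
  KH : ∀ {L} → Vec ℕ L → Vec ℕ L → List ℕ → ℤ
  KH α κ γ = sumOver (divisors γ) (K α κ)

  KH-outside : ∀ {L} (α κ : Vec ℕ L) γ → ¬ κ ≼ α → KH α κ γ ≡ 0ℤ
  KH-outside α κ γ ⋠ = sum-zero (divisors γ) (λ {β} _ → K-outside α κ β ⋠)

  -- The first exponent of a divisor of `x^(a ∷ γ)` ranges over `j ≤ a`, which is the range that
  -- `local-rule` produces.
  KH-step : ∀ {L} (α σ : Vec ℕ L) a γ → KH α σ (a ∷ γ) ≡
    sumOver (box B L) (λ ρ → ⟦ inter? B ρ σ ⟧ * (sumOver (upTo (suc a)) (λ j → ⟦ size ρ ≟ size σ + j ⟧) * KH α ρ γ))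
  KH-step {L} α σ a γ = begin
    KH α σ (a ∷ γ)
      ≡⟨ sum-productWith _∷_ (upTo (suc a)) (divisors γ) (K α σ) ⟩
    sumOver (upTo (suc a)) (λ j → sumOver (divisors γ) (λ β →
      sumOver (box B L) (λ ρ → ⟦ inter? B ρ σ ⟧ * (S ρ j * K α ρ β))))
      ≡⟨ sum-cong (upTo (suc a)) (λ _ → sum-swap (divisors γ) (box B L) _) ⟩
    sumOver (upTo (suc a)) (λ j → sumOver (box B L) (λ ρ →
      sumOver (divisors γ) (λ β → ⟦ inter? B ρ σ ⟧ * (S ρ j * K α ρ β))))
      ≡⟨ sum-swap (upTo (suc a)) (box B L) _ ⟩
    sumOver (box B L) (λ ρ → sumOver (upTo (suc a)) (λ j →
      sumOver (divisors γ) (λ β → ⟦ inter? B ρ σ ⟧ * (S ρ j * K α ρ β))))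
      ≡⟨ sum-cong (box B L) (λ {ρ} _ → factor ρ) ⟩
    sumOver (box B L) (λ ρ → ⟦ inter? B ρ σ ⟧ * (sumOver (upTo (suc a)) (S ρ) * KH α ρ γ)) ∎
    where
    open ≡-Reasoning
    S : Vec ℕ L → ℕ → ℤ
    S ρ j = ⟦ size ρ ≟ size σ + j ⟧
    factor : ∀ ρ → sumOver (upTo (suc a)) (λ j → sumOver (divisors γ) (λ β → ⟦ inter? B ρ σ ⟧ * (S ρ j * K α ρ β)))
      ≡ ⟦ inter? B ρ σ ⟧ * (sumOver (upTo (suc a)) (S ρ) * KH α ρ γ)
    factor ρ = begin
      sumOver (upTo (suc a)) (λ j → sumOver (divisors γ) (λ β → ⟦ inter? B ρ σ ⟧ * (S ρ j * K α ρ β)))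
        ≡⟨ sum-cong (upTo (suc a)) (λ {j} _ → trans (sym (*-sum ⟦ inter? B ρ σ ⟧ (divisors γ) _))
             (cong (⟦ inter? B ρ σ ⟧ *_) (sym (*-sum (S ρ j) (divisors γ) _)))) ⟩
      sumOver (upTo (suc a)) (λ j → ⟦ inter? B ρ σ ⟧ * (S ρ j * KH α ρ γ))
        ≡⟨ *-sum ⟦ inter? B ρ σ ⟧ (upTo (suc a)) _ ⟨
      ⟦ inter? B ρ σ ⟧ * sumOver (upTo (suc a)) (λ j → S ρ j * KH α ρ γ)
        ≡⟨ cong (⟦ inter? B ρ σ ⟧ *_) (sum-* (KH α ρ γ) (upTo (suc a)) (S ρ)) ⟨
      ⟦ inter? B ρ σ ⟧ * (sumOver (upTo (suc a)) (S ρ) * KH α ρ γ) ∎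

  sum-δ : ∀ {L} {α : Vec ℕ L} (f : Vec ℕ L → ℤ) (d? : ∀ x → Dec (x ≡ α)) → VAll (_< B) α →
    sumOver (box B L) (λ x → f x * ⟦ d? x ⟧) ≡ f α
  sum-δ {L} {α} f d? below = trans
    (sum-single _ (vbox-unique B L) (∈-box⁺ B below) (λ {x} _ x≢ → trans (cong (f x *_) (⟦⟧-no (d? x) x≢)) (ℤₚ.*-zeroʳ (f x))))
    (trans (cong (f α *_) (⟦⟧-yes (d? α) refl)) (ℤₚ.*-identityʳ (f α)))

  -- Induction over the variables: the hypothesis carries the removal past all variables but the
  -- first, `local-rule` past the first. The size bound is invariant, since `size ν + sum γ` equals
  -- `size κ + (a + sum γ)` along a chain.
  commute : ∀ {L} (α : Vec ℕ (suc L)) → VAll (_< B) α → EndsInZero α → ∀ γ κ → size κ + sum γ < B →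
    sumOver (box B (suc L)) (λ x → ⟦ inter? B x α ⟧ * K x κ γ) ≡
    sumOver (box B (suc L)) (λ ρ → ⟦ inter? B κ ρ ⟧ * KH α ρ γ)
  commute {L} α below ends [] κ κ<B = begin
    sumOver (box B (suc L)) (λ x → ⟦ inter? B x α ⟧ * ⟦ x ≟ᵥ κ ⟧)
      ≡⟨ sum-δ (λ x → ⟦ inter? B x α ⟧) (_≟ᵥ κ) (size<⇒below B κ (subst (_< B) (ℕₚ.+-identityʳ (size κ)) κ<B)) ⟩
    ⟦ inter? B κ α ⟧
      ≡⟨ sum-δ (λ ρ → ⟦ inter? B κ ρ ⟧) (_≟ᵥ α) below ⟨
    sumOver (box B (suc L)) (λ ρ → ⟦ inter? B κ ρ ⟧ * ⟦ ρ ≟ᵥ α ⟧)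
      ≡⟨ sum-cong (box B (suc L)) (λ {ρ} _ → cong (⟦ inter? B κ ρ ⟧ *_)
           (trans (⟦⟧-cong (ρ ≟ᵥ α) (α ≟ᵥ ρ) sym sym) (sym (ℤₚ.+-identityʳ ⟦ α ≟ᵥ ρ ⟧)))) ⟩
    sumOver (box B (suc L)) (λ ρ → ⟦ inter? B κ ρ ⟧ * KH α ρ []) ∎
    where open ≡-Reasoning
  commute {L} α below ends (a ∷ γ) κ κ<B = begin
    sumOver V (λ x → ⟦ inter? B x α ⟧ * sumOver V (λ ν → ⟦ inter? B ν κ ⟧ * (S ν * K x ν γ)))
      ≡⟨ sum-cong V (λ {x} _ → *-sum ⟦ inter? B x α ⟧ V _) ⟩
    sumOver V (λ x → sumOver V (λ ν → ⟦ inter? B x α ⟧ * (⟦ inter? B ν κ ⟧ * (S ν * K x ν γ))))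
      ≡⟨ sum-swap V V _ ⟩
    sumOver V (λ ν → sumOver V (λ x → ⟦ inter? B x α ⟧ * (⟦ inter? B ν κ ⟧ * (S ν * K x ν γ))))
      ≡⟨ sum-cong V (λ {ν} _ → pull₁ ν) ⟩
    sumOver V (λ ν → ⟦ inter? B ν κ ⟧ * (S ν * sumOver V (λ x → ⟦ inter? B x α ⟧ * K x ν γ)))
      ≡⟨ sum-cong V (λ {ν} _ → cong (⟦ inter? B ν κ ⟧ *_) (⟦⟧*-cong (size ν ≟ size κ + a) (λ eq →
           commute α below ends γ ν (subst (_< B) (sym (trans (cong (λ t → t + sum γ) eq) (ℕₚ.+-assoc (size κ) a (sum γ)))) κ<B)))) ⟩
    sumOver V (λ ν → ⟦ inter? B ν κ ⟧ * (S ν * sumOver V (λ ρ → ⟦ inter? B ν ρ ⟧ * KH α ρ γ)))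
      ≡⟨ sum-cong V (λ {ν} _ → pull₂ ν) ⟩
    sumOver V (λ ν → sumOver V (λ ρ → ⟦ inter? B ν κ ⟧ * (⟦ inter? B ν ρ ⟧ * S ν) * KH α ρ γ))
      ≡⟨ sum-swap V V _ ⟩
    sumOver V (λ ρ → sumOver V (λ ν → ⟦ inter? B ν κ ⟧ * (⟦ inter? B ν ρ ⟧ * S ν) * KH α ρ γ))
      ≡⟨ sum-cong V (λ {ρ} ρ∈ → local ρ (∈-box⁻ B ρ∈)) ⟩
    sumOver V (λ ρ → sumOver V (λ σ → ⟦ inter? B κ σ ⟧ * (⟦ inter? B ρ σ ⟧ * (T ρ σ * KH α ρ γ))))
      ≡⟨ sum-swap V V _ ⟩
    sumOver V (λ σ → sumOver V (λ ρ → ⟦ inter? B κ σ ⟧ * (⟦ inter? B ρ σ ⟧ * (T ρ σ * KH α ρ γ))))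
      ≡⟨ sum-cong V (λ {σ} _ → trans (sym (*-sum ⟦ inter? B κ σ ⟧ V _)) (cong (⟦ inter? B κ σ ⟧ *_) (sym (KH-step α σ a γ)))) ⟩
    sumOver V (λ σ → ⟦ inter? B κ σ ⟧ * KH α σ (a ∷ γ)) ∎
    where
    open ≡-Reasoning
    V = box B (suc L)
    S : Vec ℕ (suc L) → ℤ
    S ν = ⟦ size ν ≟ size κ + a ⟧
    T : Vec ℕ (suc L) → Vec ℕ (suc L) → ℤ
    T ρ σ = sumOver (upTo (suc a)) (λ j → ⟦ size ρ ≟ size σ + j ⟧)

    pull₁ : ∀ ν → sumOver V (λ x → ⟦ inter? B x α ⟧ * (⟦ inter? B ν κ ⟧ * (S ν * K x ν γ))) ≡
      ⟦ inter? B ν κ ⟧ * (S ν * sumOver V (λ x → ⟦ inter? B x α ⟧ * K x ν γ))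
    pull₁ ν = begin
      sumOver V (λ x → ⟦ inter? B x α ⟧ * (⟦ inter? B ν κ ⟧ * (S ν * K x ν γ)))
        ≡⟨ sum-cong V (λ {x} _ → rearrange ⟦ inter? B x α ⟧ ⟦ inter? B ν κ ⟧ (S ν) (K x ν γ)) ⟩
      sumOver V (λ x → ⟦ inter? B ν κ ⟧ * S ν * (⟦ inter? B x α ⟧ * K x ν γ))
        ≡⟨ *-sum (⟦ inter? B ν κ ⟧ * S ν) V _ ⟨
      ⟦ inter? B ν κ ⟧ * S ν * sumOver V (λ x → ⟦ inter? B x α ⟧ * K x ν γ)
        ≡⟨ ℤₚ.*-assoc ⟦ inter? B ν κ ⟧ (S ν) _ ⟩
      ⟦ inter? B ν κ ⟧ * (S ν * sumOver V (λ x → ⟦ inter? B x α ⟧ * K x ν γ)) ∎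
      where
      rearrange : ∀ a b c d → a * (b * (c * d)) ≡ b * c * (a * d)
      rearrange = solve-∀

    pull₂ : ∀ ν → ⟦ inter? B ν κ ⟧ * (S ν * sumOver V (λ ρ → ⟦ inter? B ν ρ ⟧ * KH α ρ γ)) ≡
      sumOver V (λ ρ → ⟦ inter? B ν κ ⟧ * (⟦ inter? B ν ρ ⟧ * S ν) * KH α ρ γ)
    pull₂ ν = begin
      ⟦ inter? B ν κ ⟧ * (S ν * sumOver V (λ ρ → ⟦ inter? B ν ρ ⟧ * KH α ρ γ))
        ≡⟨ ℤₚ.*-assoc ⟦ inter? B ν κ ⟧ (S ν) _ ⟨
      ⟦ inter? B ν κ ⟧ * S ν * sumOver V (λ ρ → ⟦ inter? B ν ρ ⟧ * KH α ρ γ)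
        ≡⟨ *-sum (⟦ inter? B ν κ ⟧ * S ν) V _ ⟩
      sumOver V (λ ρ → ⟦ inter? B ν κ ⟧ * S ν * (⟦ inter? B ν ρ ⟧ * KH α ρ γ))
        ≡⟨ sum-cong V (λ {ρ} _ → rearrange ⟦ inter? B ν κ ⟧ (S ν) ⟦ inter? B ν ρ ⟧ (KH α ρ γ)) ⟩
      sumOver V (λ ρ → ⟦ inter? B ν κ ⟧ * (⟦ inter? B ν ρ ⟧ * S ν) * KH α ρ γ) ∎
      where
      rearrange : ∀ a b c d → a * b * (c * d) ≡ a * (c * b) * d
      rearrange = solve-∀

    κ+a<B : size κ + a < B
    κ+a<B = ℕₚ.≤-<-trans (ℕₚ.+-monoʳ-≤ (size κ) (ℕₚ.m≤m+n a (sum γ))) κ<B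

    local : ∀ ρ → VAll (_< B) ρ →
      sumOver V (λ ν → ⟦ inter? B ν κ ⟧ * (⟦ inter? B ν ρ ⟧ * S ν) * KH α ρ γ) ≡
      sumOver V (λ σ → ⟦ inter? B κ σ ⟧ * (⟦ inter? B ρ σ ⟧ * (T ρ σ * KH α ρ γ)))
    -- `local-rule` needs `ρ` to end in zero, which is inherited from `α` if `ρ ≼ α`; for every
    -- other `ρ` the factor `KH α ρ γ` vanishes.
    local ρ ρ<B with ρ ≼? α
    ... | yes ρ≼α = begin
      sumOver V (λ ν → ⟦ inter? B ν κ ⟧ * (⟦ inter? B ν ρ ⟧ * S ν) * KH α ρ γ)
        ≡⟨ sum-* (KH α ρ γ) V _ ⟨
      sumOver V (λ ν → ⟦ inter? B ν κ ⟧ * (⟦ inter? B ν ρ ⟧ * S ν)) * KH α ρ γ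
        ≡⟨ cong (_* KH α ρ γ) (local-rule B κ ρ a ρ<B (≼-endsInZero ρ≼α ends) κ+a<B) ⟩
      sumOver V (λ σ → ⟦ inter? B κ σ ⟧ * (⟦ inter? B ρ σ ⟧ * T ρ σ)) * KH α ρ γ
        ≡⟨ sum-* (KH α ρ γ) V _ ⟩
      sumOver V (λ σ → ⟦ inter? B κ σ ⟧ * (⟦ inter? B ρ σ ⟧ * T ρ σ) * KH α ρ γ)
        ≡⟨ sum-cong V (λ {σ} _ → rearrange ⟦ inter? B κ σ ⟧ ⟦ inter? B ρ σ ⟧ (T ρ σ) (KH α ρ γ)) ⟩
      sumOver V (λ σ → ⟦ inter? B κ σ ⟧ * (⟦ inter? B ρ σ ⟧ * (T ρ σ * KH α ρ γ))) ∎
      where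
      rearrange : ∀ a b c d → a * (b * c) * d ≡ a * (b * (c * d))
      rearrange = solve-∀
    ... | no ρ⋠α = trans
      (sum-zero V (λ {ν} _ → trans (cong (⟦ inter? B ν κ ⟧ * (⟦ inter? B ν ρ ⟧ * S ν) *_) KH≡0)
                                   (ℤₚ.*-zeroʳ (⟦ inter? B ν κ ⟧ * (⟦ inter? B ν ρ ⟧ * S ν)))))
      (sym (sum-zero V (λ {σ} _ → trans (cong (λ q → ⟦ inter? B κ σ ⟧ * (⟦ inter? B ρ σ ⟧ * (T ρ σ * q))) KH≡0)
                                        (annihilate ⟦ inter? B κ σ ⟧ ⟦ inter? B ρ σ ⟧ (T ρ σ)))))
      where
      KH≡0 = KH-outside α ρ γ ρ⋠α
      annihilate : ∀ a b c → a * (b * (c * 0ℤ)) ≡ 0ℤ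
      annihilate = solve-∀

  -- Only `v = m` and `v = m - 1` contribute, and what remains is `[r ≤ m] - [r < m]`. The bound `u`
  -- never interferes because `m ≤ u`.
  signedStrip-row : ∀ u m r → m ≤ u → m < B →
    sumOver (upTo B) (λ v → (⟦ v ≟ m ⟧ ℤ.- ⟦ suc v ≟ m ⟧) * ⟦ r ≤? v ×-dec v ≤? u ⟧) ≡ ⟦ m ≟ r ⟧
  signedStrip-row u m r m≤u m<B = begin
    sumOver (upTo B) (λ v → (⟦ v ≟ m ⟧ ℤ.- ⟦ suc v ≟ m ⟧) * C v)
      ≡⟨ sum-cong (upTo B) (λ {v} _ → distrib ⟦ v ≟ m ⟧ ⟦ suc v ≟ m ⟧ (C v)) ⟩
    sumOver (upTo B) (λ v → ⟦ v ≟ m ⟧ * C v ℤ.+ -1ℤ * (⟦ suc v ≟ m ⟧ * C v))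
      ≡⟨ sum-+ (upTo B) _ _ ⟩
    sumOver (upTo B) (λ v → ⟦ v ≟ m ⟧ * C v) ℤ.+ sumOver (upTo B) (λ v → -1ℤ * (⟦ suc v ≟ m ⟧ * C v))
      ≡⟨ cong₂ ℤ._+_ top (trans (sym (*-sum -1ℤ (upTo B) _)) (cong (-1ℤ *_) (below m m≤u m<B))) ⟩
    ⟦ r ≤? m ⟧ ℤ.+ -1ℤ * ⟦ suc r ≤? m ⟧
      ≡⟨ compare ⟩
    ⟦ m ≟ r ⟧ ∎
    where
    open ≡-Reasoning
    C : ℕ → ℤ
    C v = ⟦ r ≤? v ×-dec v ≤? u ⟧
    distrib : ∀ a b c → (a ℤ.- b) * c ≡ a * c ℤ.+ -1ℤ * (b * c)
    distrib = solve-∀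
    top : sumOver (upTo B) (λ v → ⟦ v ≟ m ⟧ * C v) ≡ ⟦ r ≤? m ⟧
    top = begin
      sumOver (upTo B) (λ v → ⟦ v ≟ m ⟧ * C v)
        ≡⟨ sum-single _ (Unique.upTo⁺ B) (∈-upTo⁺ m<B) (λ {v} _ v≢m → ⟦⟧*-no (v ≟ m) v≢m) ⟩
      ⟦ m ≟ m ⟧ * C m  ≡⟨ ⟦⟧*-yes (m ≟ m) refl ⟩
      C m              ≡⟨ ⟦⟧-cong (r ≤? m ×-dec m ≤? u) (r ≤? m) proj₁ (_, m≤u) ⟩
      ⟦ r ≤? m ⟧       ∎
    below : ∀ m → m ≤ u → m < B → sumOver (upTo B) (λ v → ⟦ suc v ≟ m ⟧ * C v) ≡ ⟦ suc r ≤? m ⟧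
    below zero    m≤u m<B = sum-zero (upTo B) (λ {v} _ → ⟦⟧*-no (suc v ≟ 0) {C v} (λ ()))
    below (suc m) m≤u m<B = begin
      sumOver (upTo B) (λ v → ⟦ suc v ≟ suc m ⟧ * C v)
        ≡⟨ sum-single _ (Unique.upTo⁺ B) (∈-upTo⁺ (ℕₚ.<-trans (ℕₚ.n<1+n m) m<B)) (λ {v} _ v≢m → ⟦⟧*-no (suc v ≟ suc m) (v≢m ∘ ℕₚ.suc-injective)) ⟩
      ⟦ suc m ≟ suc m ⟧ * C m  ≡⟨ ⟦⟧*-yes (suc m ≟ suc m) refl ⟩
      C m                      ≡⟨ ⟦⟧-cong (r ≤? m ×-dec m ≤? u) (suc r ≤? suc m) (s≤s ∘ proj₁) (λ { (s≤s r≤m) → r≤m , ℕₚ.<⇒≤ m≤u }) ⟩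
      ⟦ suc r ≤? suc m ⟧       ∎
    compare : ⟦ r ≤? m ⟧ ℤ.+ -1ℤ * ⟦ suc r ≤? m ⟧ ≡ ⟦ m ≟ r ⟧
    compare with ℕₚ.<-cmp r m
    ... | tri< r<m r≢m _ = trans (cong₂ (λ s t → s ℤ.+ -1ℤ * t) (⟦⟧-yes (r ≤? m) (ℕₚ.<⇒≤ r<m)) (⟦⟧-yes (suc r ≤? m) r<m))
                                 (sym (⟦⟧-no (m ≟ r) (r≢m ∘ sym)))
    ... | tri≈ r≮m r≡m _ = trans (cong₂ (λ s t → s ℤ.+ -1ℤ * t) (⟦⟧-yes (r ≤? m) (ℕₚ.≤-reflexive r≡m)) (⟦⟧-no (suc r ≤? m) r≮m))
                                 (sym (⟦⟧-yes (m ≟ r) (sym r≡m)))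
    ... | tri> r≮m r≢m m<r = trans (cong₂ (λ s t → s ℤ.+ -1ℤ * t) (⟦⟧-no (r ≤? m) (ℕₚ.<⇒≱ m<r)) (⟦⟧-no (suc r ≤? m) r≮m))
                                 (sym (⟦⟧-no (m ≟ r) (r≢m ∘ sym)))

  -- D(t) E(t) = 1.  The rows decouple: row i of y only meets the bound ρᵢ₋₁, which is μᵢ₋₁ once the earlier rows agree.
  signedStrip-cancel : ∀ {L} u (μ ρ : Vec ℕ L) → Descending u μ → VAll (_< B) μ →
    sumOver (box B L) (λ y → signedStrip μ y * ⟦ inter? u y ρ ⟧) ≡ ⟦ μ ≟ᵥ ρ ⟧
  signedStrip-cancel u [] [] _ _ = refl
  signedStrip-cancel {suc L} u (m ∷ μ) (r ∷ ρ) (m≤u , desc) (m<B ∷ below) = begin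
    sumOver (box B (suc L)) (λ y → signedStrip (m ∷ μ) y * ⟦ inter? u y (r ∷ ρ) ⟧)
      ≡⟨ sum-box B _ ⟩
    sumOver (upTo B) (λ v → sumOver (box B L) (λ y → (w v * signedStrip μ y) * ⟦ inter? u (v ∷ y) (r ∷ ρ) ⟧))
      ≡⟨ sum-cong (upTo B) (λ {v} _ → trans (sum-cong (box B L) (λ {y} _ →
           trans (cong ((w v * signedStrip μ y) *_) (⟦⟧-× (r ≤? v ×-dec v ≤? u) (inter? r y ρ)))
                 (rearrange (w v) (signedStrip μ y) (C v) ⟦ inter? r y ρ ⟧))) (sym (*-sum (w v * C v) (box B L) _))) ⟩
    sumOver (upTo B) (λ v → (w v * C v) * rest)
      ≡⟨ sum-* rest (upTo B) _ ⟨
    sumOver (upTo B) (λ v → w v * C v) * rest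
      ≡⟨ cong (_* rest) (signedStrip-row u m r m≤u m<B) ⟩
    ⟦ m ≟ r ⟧ * rest
      ≡⟨ ⟦⟧*-cong (m ≟ r) (λ { refl → signedStrip-cancel m μ ρ desc below }) ⟩
    ⟦ m ≟ r ⟧ * ⟦ μ ≟ᵥ ρ ⟧
      ≡⟨ ⟦⟧-× (m ≟ r) (μ ≟ᵥ ρ) ⟨
    ⟦ (m ≟ r) ×-dec (μ ≟ᵥ ρ) ⟧
      ≡⟨ ⟦⟧-cong ((m ≟ r) ×-dec (μ ≟ᵥ ρ)) ((m ∷ μ) ≟ᵥ (r ∷ ρ)) (λ (p , q) → cong₂ _∷_ p q) (λ eq → ∷-injective eq) ⟩
    ⟦ (m ∷ μ) ≟ᵥ (r ∷ ρ) ⟧ ∎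
    where
    open ≡-Reasoning
    w C : ℕ → ℤ
    w v = ⟦ v ≟ m ⟧ ℤ.- ⟦ suc v ≟ m ⟧
    C v = ⟦ r ≤? v ×-dec v ≤? u ⟧
    rest = sumOver (box B L) (λ y → signedStrip μ y * ⟦ inter? r y ρ ⟧)
    rearrange : ∀ a b c d → (a * b) * (c * d) ≡ (a * c) * (b * d)
    rearrange = solve-∀

  -- After `commute` the sum over `y` involves only the sign and the strip from `y` down to `ρ`, so
  -- `signedStrip-cancel` leaves `ρ = μ` alone. Here `y` runs over the whole box, as that
  -- cancellation requires.
  skewPieri-vec : ∀ {L} (α μ : Vec ℕ (suc L)) γ → VAll (_< B) α → EndsInZero α →
    VAll (_< B) μ → Descending B μ → size μ + sum γ < B →
    sumOver (box B (suc L)) (λ y → signedStrip μ y * sumOver (box B (suc L)) (λ x → ⟦ inter? B x α ⟧ * K x y γ)) ≡ KH α μ γ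
  skewPieri-vec {L} α μ γ α<B ends μ<B desc small = begin
    sumOver V (λ y → signedStrip μ y * sumOver V (λ x → ⟦ inter? B x α ⟧ * K x y γ))
      ≡⟨ sum-cong V (λ {y} _ → exchange y) ⟩
    sumOver V (λ y → sumOver V (λ ρ → signedStrip μ y * ⟦ inter? B y ρ ⟧ * KH α ρ γ))
      ≡⟨ sum-swap V V _ ⟩
    sumOver V (λ ρ → sumOver V (λ y → signedStrip μ y * ⟦ inter? B y ρ ⟧ * KH α ρ γ))
      ≡⟨ sum-cong V (λ {ρ} _ → trans (sym (sum-* (KH α ρ γ) V _)) (trans (cong (_* KH α ρ γ) (signedStrip-cancel B μ ρ desc μ<B))
           (trans (ℤₚ.*-comm ⟦ μ ≟ᵥ ρ ⟧ (KH α ρ γ)) (cong (KH α ρ γ *_) (⟦⟧-cong (μ ≟ᵥ ρ) (ρ ≟ᵥ μ) sym sym))))) ⟩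
    sumOver V (λ ρ → KH α ρ γ * ⟦ ρ ≟ᵥ μ ⟧)
      ≡⟨ sum-δ (λ ρ → KH α ρ γ) (_≟ᵥ μ) μ<B ⟩
    KH α μ γ ∎
    where
    open ≡-Reasoning
    V = box B (suc L)
    exchange : ∀ y → signedStrip μ y * sumOver V (λ x → ⟦ inter? B x α ⟧ * K x y γ) ≡
      sumOver V (λ ρ → signedStrip μ y * ⟦ inter? B y ρ ⟧ * KH α ρ γ)
    -- The size bound demanded by `commute` comes from `y ≼ μ`; without it the sign is zero.
    exchange y with y ≼? μ
    ... | yes y≼μ = begin
      signedStrip μ y * sumOver V (λ x → ⟦ inter? B x α ⟧ * K x y γ)
        ≡⟨ cong (signedStrip μ y *_) (commute α α<B ends γ y (ℕₚ.≤-<-trans (ℕₚ.+-monoˡ-≤ (sum γ) (size-mono y≼μ)) small)) ⟩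
      signedStrip μ y * sumOver V (λ ρ → ⟦ inter? B y ρ ⟧ * KH α ρ γ)
        ≡⟨ *-sum (signedStrip μ y) V _ ⟩
      sumOver V (λ ρ → signedStrip μ y * (⟦ inter? B y ρ ⟧ * KH α ρ γ))
        ≡⟨ sum-cong V (λ {ρ} _ → ℤₚ.*-assoc (signedStrip μ y) ⟦ inter? B y ρ ⟧ (KH α ρ γ)) ⟨
      sumOver V (λ ρ → signedStrip μ y * ⟦ inter? B y ρ ⟧ * KH α ρ γ) ∎
    ... | no y⋠μ = trans (cong (_* sumOver V (λ x → ⟦ inter? B x α ⟧ * K x y γ)) (signedStrip-vanish μ y y⋠μ))
      (sym (sum-zero V (λ {ρ} _ → cong (λ s → s * ⟦ inter? B y ρ ⟧ * KH α ρ γ) (signedStrip-vanish μ y y⋠μ))))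

-- Vectors as padded partitions

infix 8 _!_
_!_ : ∀ {L} → Vec ℕ L → ℕ → ℕ
x ! i = part (Vec.toList x) i

Decreasing : ∀ {L} → Vec ℕ L → Set
Decreasing x = ∀ i → x ! suc i ≤ x ! i

antitone : ∀ (f : ℕ → ℕ) → (∀ i → f (suc i) ≤ f i) → ∀ {i j} → i ≤ j → f j ≤ f i
antitone f dec {j = zero}  z≤n = ℕₚ.≤-refl
antitone f dec {i} {suc j} i≤j with ℕₚ.m≤n⇒m<n∨m≡n i≤j
... | inj₁ (s≤s i≤j′) = ℕₚ.≤-trans (dec j) (antitone f dec i≤j′)
... | inj₂ refl        = ℕₚ.≤-refl

!-beyond : ∀ {L} (x : Vec ℕ L) {i} → L ≤ i → x ! i ≡ 0
!-beyond []      _         = refl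
!-beyond (v ∷ x) (s≤s L≤i) = !-beyond x L≤i

!-ext : ∀ {L} (x y : Vec ℕ L) → (∀ i → x ! i ≡ y ! i) → x ≡ y
!-ext []      []      _  = refl
!-ext (v ∷ x) (w ∷ y) eq = cong₂ _∷_ (eq 0) (!-ext x y (eq ∘ suc))

≼⇒! : ∀ {L} {x y : Vec ℕ L} → x ≼ y → ∀ i → x ! i ≤ y ! i
≼⇒! []       i       = z≤n
≼⇒! (p ∷ ps) zero    = p
≼⇒! (p ∷ ps) (suc i) = ≼⇒! ps i

!⇒≼ : ∀ {L} (x y : Vec ℕ L) → (∀ i → x ! i ≤ y ! i) → x ≼ y
!⇒≼ []      []      _ = []
!⇒≼ (v ∷ x) (w ∷ y) p = p 0 ∷ !⇒≼ x y (p ∘ suc)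

Inter⇒! : ∀ {L u} (ν κ : Vec ℕ L) → Inter u ν κ → ∀ i → ν ! suc i ≤ κ ! i
Inter⇒! []           []           _                    i       = z≤n
Inter⇒! (v ∷ [])     (k ∷ [])     _                    zero    = z≤n
Inter⇒! (v ∷ w ∷ ν)  (k ∷ κ@(_ ∷ _)) (_ , (_ , w≤k) , _) zero = w≤k
Inter⇒! (v ∷ ν)      (k ∷ κ)      (_ , i′)             (suc i) = Inter⇒! ν κ i′ i

!⇒Inter : ∀ {L u} (ν κ : Vec ℕ L) → κ ≼ ν → (∀ i → ν ! suc i ≤ κ ! i) → ν ! 0 ≤ u → Inter u ν κ
!⇒Inter []      []      _        _ _   = tt
!⇒Inter (v ∷ ν) (k ∷ κ) (p ∷ ps) q v≤u = (p , v≤u) , !⇒Inter ν κ ps (q ∘ suc) (q 0)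

Inter⇒decreasing : ∀ {L u} (ν κ : Vec ℕ L) → Inter u ν κ → Decreasing ν
Inter⇒decreasing ν κ i j = ℕₚ.≤-trans (Inter⇒! ν κ i j) (≼⇒! (Inter⇒≼ ν κ i) j)

below-top : ∀ {L B} {x : Vec ℕ L} → VAll (_< B) x → x ! 0 ≤ B
below-top []      = z≤n
below-top (p ∷ _) = ℕₚ.<⇒≤ p

≼-below : ∀ {L B} {x y : Vec ℕ L} → x ≼ y → VAll (_< B) y → VAll (_< B) x
≼-below []       []       = []
≼-below (p ∷ ps) (q ∷ qs) = ℕₚ.≤-<-trans p q ∷ ≼-below ps qs

sum-toList : ∀ {L} (x : Vec ℕ L) → sum (Vec.toList x) ≡ size x
sum-toList []      = refl
sum-toList (v ∷ x) = cong (λ t → v + t) (sum-toList x)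

fromParts : ∀ L → (ℕ → ℕ) → Vec ℕ L
fromParts zero    f = []
fromParts (suc L) f = f 0 ∷ fromParts L (f ∘ suc)

fromParts-! : ∀ L f → (∀ i → L ≤ i → f i ≡ 0) → ∀ i → fromParts L f ! i ≡ f i
fromParts-! zero    f z i       = sym (z i z≤n)
fromParts-! (suc L) f z zero    = refl
fromParts-! (suc L) f z (suc i) = fromParts-! L (f ∘ suc) (λ i L≤i → z (suc i) (s≤s L≤i)) i

-- Cells

part-beyond : ∀ α {i} → length α ≤ i → part α i ≡ 0
part-beyond []      _       = refl
part-beyond (a ∷ α) (s≤s p) = part-beyond α p

∈-cells⁺ : ∀ α β {i j} → part β i ≤ j → j < part α i → (i , j) ∈ cells α β
∈-cells⁺ α β {i} {j} β≤j j<α with i <? length α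
... | no i≮ = ⊥-elim (ℕₚ.n≮0 (subst (j <_) (part-beyond α (ℕₚ.≮⇒≥ i≮)) j<α))
... | yes i< = ∈-concatMap⁺ (cellsInRow α β) (lose (∈-upTo⁺ i<)
  (subst (λ t → (i , t) ∈ cellsInRow α β i) (ℕₚ.m+[n∸m]≡n β≤j)
    (∈-applyUpTo⁺ (λ d → i , part β i + d) (ℕₚ.∸-monoˡ-< j<α β≤j))))

∈-cellsInRow⁻ : ∀ α β i {c} → c ∈ cellsInRow α β i → row c ≡ i × part β i ≤ col c × col c < part α i
∈-cellsInRow⁻ α β i c∈ with ∈-applyUpTo⁻ (λ d → i , part β i + d) c∈
... | d , d< , refl = refl , ℕₚ.m≤m+n (part β i) d , ℕₚ.<-≤-trans (ℕₚ.+-monoʳ-< (part β i) d<) (ℕₚ.≤-reflexive (ℕₚ.m+[n∸m]≡n β≤α))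
  where
  β≤α : part β i ≤ part α i
  β≤α = ℕₚ.<⇒≤ (ℕₚ.m∸n≢0⇒n<m {part α i} {part β i} (λ eq → ℕₚ.n≮0 (subst (d <_) eq d<)))

∈-cells⁻ : ∀ α β {c} → c ∈ cells α β → part β (row c) ≤ col c × col c < part α (row c)
∈-cells⁻ α β c∈ with find (∈-concatMap⁻ (cellsInRow α β) {xs = upTo (length α)} c∈)
... | i , _ , c∈row with ∈-cellsInRow⁻ α β i c∈row
... | refl , p = p

cells-unique : ∀ α β → Unique (cells α β)
cells-unique α β = Unique.concat⁺
  (Allₚ.map⁺ (All.tabulate (λ {i} _ → Unique.applyUpTo⁺₁ _ _ (λ d<e _ eq → ℕₚ.<⇒≢ d<e (ℕₚ.+-cancelˡ-≡ (part β i) _ _ (cong proj₂ eq))))))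
  (AllPairsₚ.map⁺ (AllPairsₚ.applyUpTo⁺₁ id (length α) (λ {i} {j} i<j _ (c∈ , c∈′) →
    ℕₚ.<⇒≢ i<j (trans (sym (proj₁ (∈-cellsInRow⁻ α β i c∈))) (proj₁ (∈-cellsInRow⁻ α β j c∈′))))))

applyUpTo-cong : ∀ {A : Set} {f g : ℕ → A} n → (∀ i → f i ≡ g i) → applyUpTo f n ≡ applyUpTo g n
applyUpTo-cong zero    eq = refl
applyUpTo-cong (suc n) eq = cong₂ _∷_ (eq 0) (applyUpTo-cong n (eq ∘ suc))

filter-applyUpTo : ∀ {A : Set} {P : A → Set} (P? : Decidable P) (f : ℕ → A) n p →
  (∀ d → P (f d) ⇔ p ≤ d) → filter P? (applyUpTo f n) ≡ applyUpTo (λ d → f (p + d)) (n ∸ p)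
filter-applyUpTo P? f zero    p       eq = cong (applyUpTo _) (sym (ℕₚ.0∸n≡0 p))
filter-applyUpTo P? f (suc n) p       eq with P? (f 0)
filter-applyUpTo P? f (suc n) zero    eq | yes _ = cong (f 0 ∷_) (filter-applyUpTo P? (f ∘ suc) n zero
  (λ d → mk⇔ (λ _ → z≤n) (λ _ → Equivalence.from (eq (suc d)) z≤n)))
filter-applyUpTo P? f (suc n) zero    eq | no ¬p = ⊥-elim (¬p (Equivalence.from (eq 0) z≤n))
filter-applyUpTo P? f (suc n) (suc p) eq | yes q = ⊥-elim (ℕₚ.n≮0 (Equivalence.to (eq 0) q))
filter-applyUpTo P? f (suc n) (suc p) eq | no _ = filter-applyUpTo P? (f ∘ suc) n p
  (λ d → mk⇔ (ℕₚ.≤-pred ∘ Equivalence.to (eq (suc d))) (Equivalence.from (eq (suc d)) ∘ s≤s))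

Outside : List ℕ → Cell → Set
Outside ν c = part ν (row c) ≤ col c

outside? : ∀ ν → Decidable (Outside ν)
outside? ν c = part ν (row c) ≤? col c

-- An equality of lists, order included, so that a peeled filling is literally a filling of the
-- shape `α/ν`.
cells-outside : ∀ α β ν → (∀ i → part β i ≤ part ν i) → filter (outside? ν) (cells α β) ≡ cells α ν
cells-outside α β ν β≤ν = go (upTo (length α))
  where
  rowwise : ∀ i → filter (outside? ν) (cellsInRow α β i) ≡ cellsInRow α ν i
  rowwise i = trans
    (filter-applyUpTo (outside? ν) (λ d → i , part β i + d) (part α i ∸ part β i) (part ν i ∸ part β i)
      (λ d → mk⇔ (ℕₚ.m≤n+o⇒m∸n≤o (part ν i) (part β i))
                 (λ p → ℕₚ.≤-trans (ℕₚ.≤-reflexive (sym (ℕₚ.m+[n∸m]≡n (β≤ν i)))) (ℕₚ.+-monoʳ-≤ (part β i) p))))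
    (trans (cong (applyUpTo _) (trans (ℕₚ.∸-+-assoc (part α i) (part β i) _) (cong (part α i ∸_) (ℕₚ.m+[n∸m]≡n (β≤ν i)))))
           (applyUpTo-cong _ (λ d → cong (i ,_) (trans (sym (ℕₚ.+-assoc (part β i) _ d)) (cong (_+ d) (ℕₚ.m+[n∸m]≡n (β≤ν i)))))))
  go : ∀ is → filter (outside? ν) (concatMap (cellsInRow α β) is) ≡ concatMap (cellsInRow α ν) is
  go []       = refl
  go (i ∷ is) = trans (filter-++ (outside? ν) (cellsInRow α β i) _) (cong₂ _++_ (rowwise i) (go is))

≼⇒⊆ : ∀ {L} {x y : Vec ℕ L} → x ≼ y → Vec.toList x ⊆ Vec.toList y
≼⇒⊆ []       = []
≼⇒⊆ (p ∷ ps) = p ∷ ≼⇒⊆ ps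

vcells : ∀ {L} → Vec ℕ L → Vec ℕ L → List Cell
vcells x y = cells (Vec.toList x) (Vec.toList y)

length-vcells : ∀ {L} {x y : Vec ℕ L} → y ≼ x → size y + length (vcells x y) ≡ size x
length-vcells {x = x} {y} y≼x = subst₂ (λ s t → s + length (vcells x y) ≡ t) (sum-toList y) (sum-toList x) (length-cells (≼⇒⊆ y≼x))

-- Peeling the entries 1 off a tableau

words-unique : ∀ {A : Set} {xs : List A} → Unique xs → ∀ l → Unique (words xs l)
words-unique u zero    = [] ∷ []
words-unique u (suc l) = Unique.cartesianProductWith⁺ _∷_ list-∷-injective u (words-unique u l)

∈-words⁺ : ∀ {A : Set} {xs w : List A} → All (_∈ xs) w → w ∈ words xs (length w)
∈-words⁺ []       = here refl
∈-words⁺ (p ∷ ps) = ∈-cartesianProductWith⁺ _∷_ p (∈-words⁺ ps)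

∈-words⁻ : ∀ {A : Set} {xs w : List A} l → w ∈ words xs l → length w ≡ l × All (_∈ xs) w
∈-words⁻ zero (here refl) = refl , []
∈-words⁻ {xs = xs} (suc l) w∈ with ∈-cartesianProductWith⁻ _∷_ xs (words xs l) w∈
... | _ , _ , v∈ , w∈′ , refl = let eq , all = ∈-words⁻ l w∈′ in cong suc eq , v∈ ∷ all

IsTableau : ℕ → List Cell → Filling → Set
IsTableau N cs T = map proj₁ T ≡ cs × All (λ t → 1 ≤ proj₂ t × proj₂ t ≤ N) T × Semistandard T

-- skewSchur α β γ is + length (tabs (cells α β) γ) by definition.
tabs : List Cell → List ℕ → List Filling
tabs cs γ = filter (λ T → list-≡-dec _≟_ (weight (length γ) T) γ)
  (filter semistandard? (map (zip cs) (words [1⋯ length γ ] (length cs))))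

∈-tabs⁺ : ∀ {cs γ T} → IsTableau (length γ) cs T → weight (length γ) T ≡ γ → T ∈ tabs cs γ
∈-tabs⁺ {γ = γ} {T} (refl , entries , ss) wt =
  ∈-filter⁺ (λ T → list-≡-dec _≟_ (weight (length γ) T) γ)
    (∈-filter⁺ semistandard? (subst (_∈ map (zip (map proj₁ T)) (words [1⋯ length γ ] (length (map proj₁ T)))) (zip-proj T)
      (∈-map⁺ (zip (map proj₁ T)) (subst (λ l → map proj₂ T ∈ words [1⋯ length γ ] l)
        (trans (length-map proj₂ T) (sym (length-map proj₁ T))) (∈-words⁺ (Allₚ.map⁺ (All.map (λ {t} → range {t}) entries)))))) ss) wt
  where
  zip-proj : ∀ (T : Filling) → zip (map proj₁ T) (map proj₂ T) ≡ T
  zip-proj []      = refl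
  zip-proj (t ∷ T) = cong (t ∷_) (zip-proj T)
  range : ∀ {t : Cell × ℕ} → 1 ≤ proj₂ t × proj₂ t ≤ length γ → proj₂ t ∈ [1⋯ length γ ]
  range {_ , suc e} (_ , e<N) = ∈-applyUpTo⁺ suc e<N

∈-tabs⁻ : ∀ cs γ {T} → T ∈ tabs cs γ → IsTableau (length γ) cs T × weight (length γ) T ≡ γ
∈-tabs⁻ cs γ {T} T∈ with ∈-filter⁻ (λ T → list-≡-dec _≟_ (weight (length γ) T) γ) {xs = filter semistandard? (map (zip cs) (words [1⋯ length γ ] (length cs)))} T∈
... | T∈′ , wt with ∈-filter⁻ semistandard? {xs = map (zip cs) (words [1⋯ length γ ] (length cs))} T∈′
... | T∈″ , ss with ∈-map⁻ (zip cs) T∈″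
... | w , w∈ , refl with ∈-words⁻ (length cs) w∈
... | len , all = (proj-zip cs w len , entries cs w all , ss) , wt
  where
  proj-zip : ∀ (cs : List Cell) (w : List ℕ) → length w ≡ length cs → map proj₁ (zip cs w) ≡ cs
  proj-zip []       []      _  = refl
  proj-zip (c ∷ cs) (e ∷ w) eq = cong (c ∷_) (proj-zip cs w (ℕₚ.suc-injective eq))
  entries : ∀ (cs : List Cell) (w : List ℕ) → All (_∈ [1⋯ length γ ]) w → All (λ t → 1 ≤ proj₂ t × proj₂ t ≤ length γ) (zip cs w)
  entries []       w       _        = []
  entries (c ∷ cs) []      _        = []
  entries (c ∷ cs) (e ∷ w) (p ∷ ps) with ∈-applyUpTo⁻ suc p
  ... | i , i<N , refl = (s≤s z≤n , i<N) ∷ entries cs w ps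

tabs-unique : ∀ cs γ → Unique (tabs cs γ)
tabs-unique cs γ = Unique.filter⁺ _ (Unique.filter⁺ semistandard? (unique-map (zip cs)
  (words-unique (Unique.applyUpTo⁺₁ suc (length γ) (λ i<j _ → ℕₚ.<⇒≢ (s≤s i<j))) (length cs))
  (λ {w} {w′} w∈ w′∈ → inj cs w w′ (proj₁ (∈-words⁻ (length cs) w∈)) (proj₁ (∈-words⁻ (length cs) w′∈)))))
  where
  inj : ∀ (cs : List Cell) (w w′ : List ℕ) → length w ≡ length cs → length w′ ≡ length cs → zip cs w ≡ zip cs w′ → w ≡ w′
  inj []       []      []        _ _ _  = refl
  inj (c ∷ cs) (e ∷ w) (e′ ∷ w′) p q eq = let eq₁ , eq₂ = list-∷-injective eq in
    cong₂ _∷_ (cong proj₂ eq₁) (inj cs w w′ (ℕₚ.suc-injective p) (ℕₚ.suc-injective q) eq₂)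

count : ℕ → Filling → ℕ
count i T = length (filter (λ (_ , a) → a ≟ i) T)

module Peeling (ν : List ℕ) where

  private
    Q  = Outside ν
    Q? = outside? ν

  -- The graph of `peel`: cells inside `ν` carry 1 and are deleted, all other entries drop by one.
  -- As a relation it can be inverted, and cells, entries, weight and semistandardness pass along it
  -- by induction in the direction needed.
  data Peel : Filling → Filling → Set where
    []   : Peel [] []
    one  : ∀ {c T T′} → ¬ Q c → Peel T T′ → Peel ((c , 1) ∷ T) T′
    more : ∀ {c e T T′} → Q c → Peel T T′ → Peel ((c , suc (suc e)) ∷ T) ((c , suc e) ∷ T′)

  peel : Filling → Filling
  peel []            = []
  peel ((c , e) ∷ T) with Q? c
  ... | yes _ = (c , pred e) ∷ peel T
  ... | no  _ = peel T

  OnesInside : Filling → Set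
  OnesInside = All (λ (c , e) → (e ≡ 1 → ¬ Q c) × (¬ Q c → e ≡ 1))

  onesInside? : Decidable OnesInside
  onesInside? = all? (λ (c , e) → ((e ≟ 1) →-dec ¬? (Q? c)) ×-dec (¬? (Q? c) →-dec (e ≟ 1)))

  peel-Peel : ∀ {T} → All (λ t → 1 ≤ proj₂ t) T → OnesInside T → Peel T (peel T)
  peel-Peel {[]} _ _ = []
  peel-Peel {(c , e) ∷ T} (1≤e ∷ pos) ((f , g) ∷ ones) with Q? c
  peel-Peel {(c , suc zero) ∷ T}    (1≤e ∷ pos) ((f , g) ∷ ones) | yes q = ⊥-elim (f refl q)
  peel-Peel {(c , suc (suc e)) ∷ T} (1≤e ∷ pos) ((f , g) ∷ ones) | yes q = more q (peel-Peel pos ones)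
  peel-Peel {(c , e) ∷ T}           (1≤e ∷ pos) ((f , g) ∷ ones) | no ¬q with g ¬q
  ... | refl = one ¬q (peel-Peel pos ones)

  Peel⇒peel : ∀ {T T′} → Peel T T′ → peel T ≡ T′
  Peel⇒peel [] = refl
  Peel⇒peel (one {c} ¬q p) with Q? c
  ... | yes q = ⊥-elim (¬q q)
  ... | no  _ = Peel⇒peel p
  Peel⇒peel (more {c} q p) with Q? c
  ... | yes _ = cong (_ ∷_) (Peel⇒peel p)
  ... | no ¬q = ⊥-elim (¬q q)

  -- `T′` has forgotten the deleted cells, hence the hypothesis on the cell lists; at each cell they
  -- decide which constructor applies.
  Peel-injective : ∀ {S T T′} → Peel S T′ → Peel T T′ → map proj₁ S ≡ map proj₁ T → S ≡ T
  Peel-injective []         []          _  = refl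
  Peel-injective (one _ p)  (one _ q)   eq = let e₁ , e₂ = list-∷-injective eq in cong₂ (λ c T → (c , 1) ∷ T) e₁ (Peel-injective p q e₂)
  Peel-injective (more _ p) (more _ q)  eq = cong (_ ∷_) (Peel-injective p q (proj₂ (list-∷-injective eq)))
  Peel-injective (one ¬q p) (more q p′) eq with list-∷-injective eq
  ... | refl , _ = ⊥-elim (¬q q)
  Peel-injective (more q p) (one ¬q p′) eq with list-∷-injective eq
  ... | refl , _ = ⊥-elim (¬q q)

  unpeel : ∀ cs {T′} → map proj₁ T′ ≡ filter Q? cs → All (λ t → 1 ≤ proj₂ t) T′ → ∃ λ T → Peel T T′ × map proj₁ T ≡ cs
  unpeel []       {[]} _ _ = [] , [] , refl
  unpeel (c ∷ cs) {T′} eq pos with Q? c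
  ... | no ¬q = let T , p , eqT = unpeel cs (trans eq (filter-reject Q? ¬q)) pos in (c , 1) ∷ T , one ¬q p , cong (c ∷_) eqT
  ... | yes q = accept T′ (trans eq (filter-accept Q? q)) pos
    where
    accept : ∀ T′ → map proj₁ T′ ≡ c ∷ filter Q? cs → All (λ t → 1 ≤ proj₂ t) T′ → ∃ λ T → Peel T T′ × map proj₁ T ≡ c ∷ cs
    accept ((d , suc e) ∷ T′) eq (_ ∷ pos) with list-∷-injective eq
    ... | refl , eq′ = let T , p , eqT = unpeel cs eq′ pos in (c , suc (suc e)) ∷ T , more q p , cong (c ∷_) eqT

  Peel-cells : ∀ {T T′} → Peel T T′ → map proj₁ T′ ≡ filter Q? (map proj₁ T)
  Peel-cells []             = refl
  Peel-cells (one ¬q p)     = trans (Peel-cells p) (sym (filter-reject Q? ¬q))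
  Peel-cells (more {c} q p) = trans (cong (c ∷_) (Peel-cells p)) (sym (filter-accept Q? q))

  Peel-onesInside : ∀ {T T′} → Peel T T′ → OnesInside T
  Peel-onesInside []         = []
  Peel-onesInside (one ¬q p) = ((λ _ → ¬q) , (λ _ → refl)) ∷ Peel-onesInside p
  Peel-onesInside (more q p) = ((λ ()) , (λ ¬q → ⊥-elim (¬q q))) ∷ Peel-onesInside p

  Peel-entries : ∀ {N T T′} → Peel T T′ → All (λ t → 1 ≤ proj₂ t × proj₂ t ≤ suc N) T → All (λ t → 1 ≤ proj₂ t × proj₂ t ≤ N) T′
  Peel-entries []         []                   = []
  Peel-entries (one _ p)  (_ ∷ ps)             = Peel-entries p ps
  Peel-entries (more _ p) ((_ , s≤s e≤N) ∷ ps) = (s≤s z≤n , e≤N) ∷ Peel-entries p ps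

  unPeel-entries : ∀ {N T T′} → Peel T T′ → All (λ t → 1 ≤ proj₂ t × proj₂ t ≤ N) T′ → All (λ t → 1 ≤ proj₂ t × proj₂ t ≤ suc N) T
  unPeel-entries []         []               = []
  unPeel-entries (one _ p)  ps               = (s≤s z≤n , s≤s z≤n) ∷ unPeel-entries p ps
  unPeel-entries (more _ p) ((_ , e≤N) ∷ ps) = (s≤s z≤n , s≤s e≤N) ∷ unPeel-entries p ps

  Peel-count : ∀ {T T′} i → Peel T T′ → count (suc (suc i)) T ≡ count (suc i) T′
  Peel-count i []        = refl
  Peel-count i (one _ p) = Peel-count i p
  -- On successors `_≟_` computes through `_≡ᵇ_`, so both filters branch on this one boolean.
  Peel-count i (more {e = e} _ p) with e ≡ᵇ i
  ... | true  = cong suc (Peel-count i p)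
  ... | false = Peel-count i p

  Peel-ones : ∀ {T T′} → Peel T T′ → count 1 T + length T′ ≡ length T
  Peel-ones []                 = refl
  Peel-ones (one _ p)          = cong suc (Peel-ones p)
  Peel-ones {_ ∷ T} {_ ∷ T′} (more _ p) = trans (ℕₚ.+-suc (count 1 T) (length T′)) (cong suc (Peel-ones p))

  Peel-weight : ∀ {T T′} N → Peel T T′ → weight (suc N) T ≡ count 1 T ∷ weight N T′
  Peel-weight {T} {T′} N p = cong (count 1 T ∷_) (begin
    map (λ i → count i T) (applyUpTo (suc ∘ suc) N) ≡⟨ map-applyUpTo (suc ∘ suc) _ N ⟩
    applyUpTo (λ i → count (suc (suc i)) T) N       ≡⟨ applyUpTo-cong N (λ i → Peel-count i p) ⟩
    applyUpTo (λ i → count (suc i) T′) N            ≡⟨ map-applyUpTo suc _ N ⟨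
    map (λ i → count i T′) (applyUpTo suc N)        ∎)
    where open ≡-Reasoning

  Peel-∈⁻ : ∀ {T T′ c e} → Peel T T′ → (c , e) ∈ T → (e ≡ 1 × ¬ Q c) ⊎ (∃ λ e′ → e ≡ suc e′ × 1 ≤ e′ × Q c × (c , e′) ∈ T′)
  Peel-∈⁻ (one ¬q p) (here refl) = inj₁ (refl , ¬q)
  Peel-∈⁻ (one ¬q p) (there t∈)  = Peel-∈⁻ p t∈
  Peel-∈⁻ (more q p) (here refl) = inj₂ (_ , refl , s≤s z≤n , q , here refl)
  Peel-∈⁻ (more q p) (there t∈) with Peel-∈⁻ p t∈
  ... | inj₁ r                       = inj₁ r
  ... | inj₂ (e′ , eq , 1≤ , q′ , t) = inj₂ (e′ , eq , 1≤ , q′ , there t)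

  Peel-∈⁺ : ∀ {T T′ c e} → Peel T T′ → (c , e) ∈ T′ → (c , suc e) ∈ T
  Peel-∈⁺ (one _ p)  t∈          = there (Peel-∈⁺ p t∈)
  Peel-∈⁺ (more _ p) (here refl) = here refl
  Peel-∈⁺ (more _ p) (there t∈)  = there (Peel-∈⁺ p t∈)

  Peel-semistandard : ∀ {T T′} → Peel T T′ → Semistandard T → Semistandard T′
  Peel-semistandard p ss = All.tabulate (λ t∈ → All.tabulate (λ u∈ →
    let r , c = All.lookup (All.lookup ss (Peel-∈⁺ p t∈)) (Peel-∈⁺ p u∈) in
    (λ eq lt → ℕₚ.≤-pred (r eq lt)) , (λ eq lt → ℕₚ.≤-pred (c eq lt))))

  -- In a column only the topmost cell can carry a 1, by the hypothesis on ν.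
  unPeel-semistandard : ∀ {T T′} → Peel T T′ →
    (∀ {c d a b} → (c , a) ∈ T → (d , b) ∈ T → row c < row d → col c ≡ col d → Q d) →
    Semistandard T′ → Semistandard T
  unPeel-semistandard {T} {T′} p below ss = All.tabulate (λ t∈ → All.tabulate (λ u∈ → rows t∈ u∈ , columns t∈ u∈))
    where
    rows : ∀ {c d a b} → (c , a) ∈ T → (d , b) ∈ T → row c ≡ row d → col c < col d → a ≤ b
    rows t∈ u∈ eq lt with Peel-∈⁻ p t∈ | Peel-∈⁻ p u∈
    ... | inj₁ (refl , _) | inj₁ (refl , _) = ℕₚ.≤-refl
    ... | inj₁ (refl , _) | inj₂ (_ , refl , _) = s≤s z≤n
    -- To the right of a cell outside `ν` every cell of the row is outside, so none of them carries
    -- a 1.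
    ... | inj₂ (_ , refl , _ , q , _) | inj₁ (_ , ¬q) = ⊥-elim (¬q (ℕₚ.≤-trans (subst (λ r → part ν r ≤ _) eq q) (ℕₚ.<⇒≤ lt)))
    ... | inj₂ (_ , refl , _ , _ , t∈′) | inj₂ (_ , refl , _ , _ , u∈′) = s≤s (proj₁ (All.lookup (All.lookup ss t∈′) u∈′) eq lt)
    columns : ∀ {c d a b} → (c , a) ∈ T → (d , b) ∈ T → col c ≡ col d → row c < row d → a < b
    columns t∈ u∈ eq lt with Peel-∈⁻ p t∈ | Peel-∈⁻ p u∈
    ... | _ | inj₁ (_ , ¬q) = ⊥-elim (¬q (below t∈ u∈ lt eq))
    ... | inj₁ (refl , _) | inj₂ (_ , refl , 1≤ , _) = s≤s 1≤
    ... | inj₂ (_ , refl , _ , _ , t∈′) | inj₂ (_ , refl , _ , _ , u∈′) = s≤s (proj₂ (All.lookup (All.lookup ss t∈′) u∈′) eq lt)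

entry-at : ∀ {cs c} {T : Filling} → map proj₁ T ≡ cs → c ∈ cs → ∃ λ e → (c , e) ∈ T
entry-at refl c∈ with ∈-map⁻ proj₁ c∈
... | (_ , e) , t∈ , refl = e , t∈

entry-unique : ∀ {c a b} {T : Filling} → Unique (map proj₁ T) → (c , a) ∈ T → (c , b) ∈ T → a ≡ b
entry-unique _        (here refl) (here refl) = refl
entry-unique (c∉ ∷ _) (here refl) (there u∈)  = ⊥-elim (All.lookup c∉ (∈-map⁺ proj₁ u∈) refl)
entry-unique (c∉ ∷ _) (there t∈)  (here refl) = ⊥-elim (All.lookup c∉ (∈-map⁺ proj₁ t∈) refl)
entry-unique (_ ∷ u)  (there t∈)  (there u∈)  = entry-unique u t∈ u∈

-- The ones of a semistandard tableau as a horizontal strip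

module _ {L} (x y : Vec ℕ L) (x-dec : Decreasing x) (y-dec : Decreasing y) (y≼x : y ≼ x) where

  private
    cell⁺ : ∀ {i j} → y ! i ≤ j → j < x ! i → (i , j) ∈ vcells x y
    cell⁺ = ∈-cells⁺ (Vec.toList x) (Vec.toList y)

  module _ {N T} (tab : IsTableau N (vcells x y) T) where

    private
      cells≡  = proj₁ tab
      entries = proj₁ (proj₂ tab)
      ss      = proj₂ (proj₂ tab)

      at : ∀ {c} → c ∈ vcells x y → ∃ λ e → (c , e) ∈ T
      at = entry-at cells≡
      cell⁻ : ∀ {c e} → (c , e) ∈ T → y ! row c ≤ col c × col c < x ! row c
      cell⁻ t∈ = ∈-cells⁻ (Vec.toList x) (Vec.toList y) (subst (_ ∈_) cells≡ (∈-map⁺ proj₁ t∈))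
      functional : ∀ {c a b} → (c , a) ∈ T → (c , b) ∈ T → a ≡ b
      functional = entry-unique (subst Unique (sym cells≡) (cells-unique (Vec.toList x) (Vec.toList y)))
      positive : ∀ {c e} → (c , e) ∈ T → 1 ≤ e
      positive t∈ = proj₁ (All.lookup entries t∈)

    OnesBefore : ℕ → ℕ → Set
    OnesBefore r m = ∀ {c e} → ((r , c) , e) ∈ T → (e ≡ 1 → c < m) × (c < m → e ≡ 1)

    -- Rows increase weakly, so the ones of a row form an initial segment. `search` moves left from
    -- the end of the row until it meets a 1; its invariant is that no 1 occurs from column
    -- `y ! r + d` on.
    threshold : ∀ r → ∃ λ m → (y ! r ≤ m × m ≤ x ! r) × OnesBefore r m
    threshold r = search (x ! r ∸ y ! r) (ℕₚ.≤-reflexive (ℕₚ.m+[n∸m]≡n y≤x))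
      (λ t∈ ≤c _ → ℕₚ.<⇒≱ (proj₂ (cell⁻ t∈)) (subst (_≤ _) (ℕₚ.m+[n∸m]≡n y≤x) ≤c))
      where
      y≤x = ≼⇒! y≼x r
      search : ∀ d → y ! r + d ≤ x ! r → (∀ {c e} → ((r , c) , e) ∈ T → y ! r + d ≤ c → e ≢ 1) →
        ∃ λ m → (y ! r ≤ m × m ≤ x ! r) × OnesBefore r m
      search zero ≤x right = y ! r , (ℕₚ.≤-refl , y≤x) , λ t∈ →
        (λ e≡1 → ⊥-elim (right t∈ (subst (_≤ _) (sym (ℕₚ.+-identityʳ (y ! r))) (proj₁ (cell⁻ t∈))) e≡1)) ,
        (λ c<y → ⊥-elim (ℕₚ.<⇒≱ c<y (proj₁ (cell⁻ t∈))))
      search (suc d) ≤x right with at (cell⁺ (ℕₚ.m≤m+n (y ! r) d) last<x)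
        where
        last<x : y ! r + d < x ! r
        last<x = subst (_≤ x ! r) (ℕₚ.+-suc (y ! r) d) ≤x
      ... | e₀ , t₀∈ with e₀ ≟ 1
      ... | yes refl = y ! r + suc d , (ℕₚ.m≤m+n (y ! r) (suc d) , ≤x) , λ t∈ →
        (λ e≡1 → ℕₚ.≰⇒> (λ ≤c → right t∈ ≤c e≡1)) , left t∈
        where
        left : ∀ {c e} → ((r , c) , e) ∈ T → c < y ! r + suc d → e ≡ 1
        left {c} t∈ c< with ℕₚ.m≤n⇒m<n∨m≡n (ℕₚ.≤-pred (subst (c <_) (ℕₚ.+-suc (y ! r) d) c<))
        ... | inj₁ c<last = ℕₚ.≤-antisym (proj₁ (All.lookup (All.lookup ss t∈) t₀∈) refl c<last) (positive t∈)
        ... | inj₂ refl   = functional t∈ t₀∈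
      ... | no e₀≢1 = search d (ℕₚ.≤-trans (ℕₚ.+-monoʳ-≤ (y ! r) (ℕₚ.n≤1+n d)) ≤x) right′
        where
        right′ : ∀ {c e} → ((r , c) , e) ∈ T → y ! r + d ≤ c → e ≢ 1
        right′ {c} t∈ ≤c with ℕₚ.m≤n⇒m<n∨m≡n ≤c
        ... | inj₁ <c   = right t∈ (subst (_≤ c) (sym (ℕₚ.+-suc (y ! r) d)) <c)
        ... | inj₂ refl = λ e≡1 → e₀≢1 (trans (functional t₀∈ t∈) e≡1)

    ones : Vec ℕ L
    ones = fromParts L (proj₁ ∘ threshold)

    private
      ones-! : ∀ i → ones ! i ≡ proj₁ (threshold i)
      ones-! = fromParts-! L (proj₁ ∘ threshold)
        (λ i L≤i → ℕₚ.n≤0⇒n≡0 (subst (proj₁ (threshold i) ≤_) (!-beyond x L≤i) (proj₂ (proj₁ (proj₂ (threshold i))))))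

    ones≼ : ones ≼ x
    ones≼ = !⇒≼ ones x (λ i → subst (_≤ x ! i) (sym (ones-! i)) (proj₂ (proj₁ (proj₂ (threshold i)))))

    ≼ones : y ≼ ones
    ≼ones = !⇒≼ y ones (λ i → subst (y ! i ≤_) (sym (ones-! i)) (proj₁ (proj₁ (proj₂ (threshold i)))))

    ones-inside : Peeling.OnesInside (Vec.toList ones) T
    ones-inside = All.tabulate (λ { {(r , c) , e} t∈ → let f , g = proj₂ (proj₂ (threshold r)) t∈ in
      (λ e≡1 → ℕₚ.<⇒≱ (subst (c <_) (sym (ones-! r)) (f e≡1))) ,
      (λ ¬q → g (subst (c <_) (ones-! r) (ℕₚ.≰⇒> ¬q))) })

    ones-inter : ∀ {B} → VAll (_< B) x → Inter B ones y
    ones-inter below = !⇒Inter ones y ≼ones next (ℕₚ.≤-trans (≼⇒! ones≼ 0) (below-top below))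
      where
      -- Otherwise column `y ! i` has a 1 in row `suc i` below a cell of row `i`, whose entry would
      -- have to be less than 1.
      next : ∀ i → ones ! suc i ≤ y ! i
      next i = ℕₚ.≮⇒≥ λ y<ones →
        let y<x     = ℕₚ.<-≤-trans y<ones (≼⇒! ones≼ (suc i))
            e , t∈  = at (cell⁺ (y-dec i) y<x)
            e′ , u∈ = at (cell⁺ ℕₚ.≤-refl (ℕₚ.<-≤-trans y<x (x-dec i)))
            e≡1     = proj₂ (All.lookup ones-inside t∈) (ℕₚ.<⇒≱ y<ones)
            e′<e    = proj₂ (All.lookup (All.lookup ss u∈) t∈) refl (ℕₚ.n<1+n i)
        in ℕₚ.<⇒≱ (subst (e′ <_) e≡1 e′<e) (positive u∈)

    -- Otherwise the cell of row `i` in column `ν′ ! i` lies inside `ν` and outside `ν′`, and would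
    -- both carry a 1 and not carry one.
    inside-unique : ∀ ν ν′ → y ≼ ν′ → ν ≼ x → Peeling.OnesInside (Vec.toList ν) T → Peeling.OnesInside (Vec.toList ν′) T →
      ∀ i → ν ! i ≤ ν′ ! i
    inside-unique ν ν′ y≼ν′ ν≼x in-ν in-ν′ i = ℕₚ.≮⇒≥ λ ν′<ν →
      let e , t∈ = at (cell⁺ (≼⇒! y≼ν′ i) (ℕₚ.<-≤-trans ν′<ν (≼⇒! ν≼x i)))
      in proj₁ (All.lookup in-ν′ t∈) (proj₂ (All.lookup in-ν t∈) (ℕₚ.<⇒≱ ν′<ν)) ℕₚ.≤-refl

  module _ (a : ℕ) (γ : List ℕ) where

    private
      A = tabs (vcells x y) (a ∷ γ)
      inside? = λ (ν : Vec ℕ L) → Peeling.onesInside? (Vec.toList ν)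

    -- Classifies tableaux by the region of their ones: `ones` is the only `ν` that fits `T`. The
    -- condition `ν ≼ x` is imposed separately because `OnesInside` sees only cells of the shape.
    one-fibre : ∀ {B} → VAll (_< B) x → ∀ {T} → T ∈ A →
      1ℤ ≡ sumOver (box B L) (λ ν → ⟦ inter? B ν y ⟧ * (⟦ ν ≼? x ⟧ * ⟦ inside? ν T ⟧))
    one-fibre {B} below {T} T∈ = sym (trans
      (sum-single F (vbox-unique B L) (∈-box⁺ B (≼-below (ones≼ tab) below)) (λ {ν} _ ν≢ → ⟦⟧*-zero (inter? B ν y) (λ i →
        ⟦⟧*-zero (ν ≼? x) (λ ν≼x → ⟦⟧-no (inside? ν T) (λ in-ν → ν≢ (!-ext ν (ones tab) (λ j → ℕₚ.≤-antisym
          (inside-unique tab ν (ones tab) (≼ones tab) ν≼x in-ν (ones-inside tab) j)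
          (inside-unique tab (ones tab) ν (Inter⇒≼ ν y i) (ones≼ tab) (ones-inside tab) in-ν j))))))))
      (trans (⟦⟧*-yes (inter? B (ones tab) y) (ones-inter tab below))
      (trans (⟦⟧*-yes (ones tab ≼? x) (ones≼ tab)) (⟦⟧-yes (inside? (ones tab) T) (ones-inside tab)))))
      where
      tab = proj₁ (∈-tabs⁻ (vcells x y) (a ∷ γ) T∈)
      F : Vec ℕ L → ℤ
      F ν = ⟦ inter? B ν y ⟧ * (⟦ ν ≼? x ⟧ * ⟦ inside? ν T ⟧)

    -- The number of ones is `size ν - size y`, so the fibre is empty unless this is `a`. If it is,
    -- `peel` maps the fibre bijectively onto the tableaux of shape `x/ν` and weight `γ`.
    fibre : ∀ {B} ν → Inter B ν y → ν ≼ x →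
      sumOver A (λ T → ⟦ inside? ν T ⟧) ≡ ⟦ size ν ≟ size y + a ⟧ * + length (tabs (vcells x ν) γ)
    fibre ν i ν≼x = by-size (size ν ≟ size y + a)
      where
      open Peeling (Vec.toList ν)
      open ≡-Reasoning
      y≼ν = Inter⇒≼ ν y i
      A′  = tabs (vcells x ν) γ
      cells≡ : filter (outside? (Vec.toList ν)) (vcells x y) ≡ vcells x ν
      cells≡ = cells-outside (Vec.toList x) (Vec.toList y) (Vec.toList ν) (≼⇒! y≼ν)

      size-ν : ∀ {T T′} → Peel T T′ → map proj₁ T ≡ vcells x y → size ν ≡ size y + count 1 T
      size-ν {T} {T′} p eq = ℕₚ.+-cancelʳ-≡ (length (vcells x ν)) _ _ (begin
        size ν + length (vcells x ν)                  ≡⟨ length-vcells ν≼x ⟩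
        size x                                        ≡⟨ length-vcells y≼x ⟨
        size y + length (vcells x y)                  ≡⟨ cong (λ t → size y + t) (trans (cong length (sym eq)) (trans (length-map proj₁ T) (sym (Peel-ones p)))) ⟩
        size y + (count 1 T + length T′)              ≡⟨ ℕₚ.+-assoc (size y) (count 1 T) (length T′) ⟨
        size y + count 1 T + length T′                ≡⟨ cong (λ t → size y + count 1 T + t) (trans (sym (length-map proj₁ T′)) (cong length (trans (Peel-cells p) (trans (cong (filter (outside? (Vec.toList ν))) eq) cells≡)))) ⟩
        size y + count 1 T + length (vcells x ν)      ∎)

      peels : ∀ {T} → T ∈ A → OnesInside T → Peel T (peel T)
      peels T∈ = peel-Peel (All.map proj₁ (proj₁ (proj₂ (proj₁ (∈-tabs⁻ (vcells x y) (a ∷ γ) T∈)))))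

      by-size : (size? : Dec (size ν ≡ size y + a)) → sumOver A (λ T → ⟦ inside? ν T ⟧) ≡ ⟦ size? ⟧ * + length A′
      by-size (no size≢) = sum-zero A (λ {T} T∈ → ⟦⟧-no (inside? ν T) (λ ins →
        let (eq , _) , wt = ∈-tabs⁻ (vcells x y) (a ∷ γ) T∈
            p = peels T∈ ins
        in size≢ (trans (size-ν p eq) (cong (λ t → size y + t) (proj₁ (list-∷-injective (trans (sym (Peel-weight (length γ) p)) wt)))))))
      by-size (yes size≡) = begin
        sumOver A (λ T → ⟦ inside? ν T ⟧)          ≡⟨ sum-cong A (λ {T} _ → ℤₚ.*-identityʳ ⟦ inside? ν T ⟧) ⟨
        sumOver A (λ T → ⟦ inside? ν T ⟧ * 1ℤ)     ≡⟨ sum-filter (inside? ν) A (λ _ → 1ℤ) ⟨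
        sumOver F (λ _ → 1ℤ)                       ≡⟨ sum-reindex peel (λ _ → 1ℤ) (Unique.filter⁺ (inside? ν) (tabs-unique (vcells x y) (a ∷ γ))) (tabs-unique (vcells x ν) γ) into inj onto ⟨
        sumOver A′ (λ _ → 1ℤ)                      ≡⟨ length-as-sum A′ ⟨
        + length A′                                ≡⟨ ℤₚ.*-identityˡ (+ length A′) ⟨
        1ℤ * + length A′                           ∎
        where
        F = filter (inside? ν) A
        F⁻ : ∀ {T} → T ∈ F → T ∈ A × OnesInside T
        F⁻ = ∈-filter⁻ (inside? ν) {xs = A}
        peel′ : ∀ {T} → T ∈ F → Peel T (peel T)
        peel′ T∈ = let T∈A , ins = F⁻ T∈ in peels T∈A ins
        into : ∀ {T} → T ∈ F → peel T ∈ A′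
        into T∈ =
          let p = peel′ T∈
              (eq , entries , ss) , wt = ∈-tabs⁻ (vcells x y) (a ∷ γ) (proj₁ (F⁻ T∈))
          in ∈-tabs⁺ (trans (Peel-cells p) (trans (cong (filter (outside? (Vec.toList ν))) eq) cells≡) ,
                      Peel-entries p entries , Peel-semistandard p ss)
                     (proj₂ (list-∷-injective (trans (sym (Peel-weight (length γ) p)) wt)))
        inj : ∀ {S T} → S ∈ F → T ∈ F → peel S ≡ peel T → S ≡ T
        inj S∈ T∈ eq = Peel-injective (subst (Peel _) eq (peel′ S∈)) (peel′ T∈)
          (trans (proj₁ (proj₁ (∈-tabs⁻ (vcells x y) (a ∷ γ) (proj₁ (F⁻ S∈))))) (sym (proj₁ (proj₁ (∈-tabs⁻ (vcells x y) (a ∷ γ) (proj₁ (F⁻ T∈)))))))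
        onto : ∀ {T′} → T′ ∈ A′ → ∃ λ T → T ∈ F × T′ ≡ peel T
        onto {T′} T′∈ with ∈-tabs⁻ (vcells x ν) γ T′∈
        ... | (eq , entries , ss) , wt with unpeel (vcells x y) (trans eq (sym cells≡)) (All.map proj₁ entries)
        ... | T , p , eqT = T , ∈-filter⁺ (inside? ν) T∈A (Peel-onesInside p) , sym (Peel⇒peel p)
          where
          cell⁻ : ∀ {c e} → (c , e) ∈ T → y ! row c ≤ col c
          cell⁻ t∈ = proj₁ (∈-cells⁻ (Vec.toList x) (Vec.toList y) (subst (_ ∈_) eqT (∈-map⁺ proj₁ t∈)))
          -- The horizontal strip condition enters through the chain `ν ! row d ≤ ν ! suc (row c) ≤
          -- y ! row c ≤ col c`, where `col c` equals `col d`.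
          lower : ∀ {c d a b} → (c , a) ∈ T → (d , b) ∈ T → row c < row d → col c ≡ col d → Outside (Vec.toList ν) d
          lower {c} {d} t∈ _ lt ceq = ℕₚ.≤-trans (antitone (ν !_) (Inter⇒decreasing ν y i) lt)
            (ℕₚ.≤-trans (Inter⇒! ν y i (row c)) (subst (_ ≤_) ceq (cell⁻ t∈)))
          T∈A : T ∈ A
          T∈A = ∈-tabs⁺ {γ = a ∷ γ} (eqT , unPeel-entries p entries , unPeel-semistandard p lower ss)
            (trans (Peel-weight (length γ) p) (cong₂ _∷_ (ℕₚ.+-cancelˡ-≡ (size y) _ _ (trans (sym (size-ν p eqT)) size≡)) wt))

    tabs-step : ∀ {B} → VAll (_< B) x → + length A ≡ sumOver (box B L) (λ ν →
      ⟦ inter? B ν y ⟧ * (⟦ size ν ≟ size y + a ⟧ * (⟦ ν ≼? x ⟧ * + length (tabs (vcells x ν) γ))))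
    tabs-step {B} below = begin
      + length A
        ≡⟨ length-as-sum A ⟩
      sumOver A (λ _ → 1ℤ)
        ≡⟨ sum-cong A (one-fibre below) ⟩
      sumOver A (λ T → sumOver (box B L) (λ ν → ⟦ inter? B ν y ⟧ * (⟦ ν ≼? x ⟧ * ⟦ inside? ν T ⟧)))
        ≡⟨ sum-swap A (box B L) _ ⟩
      sumOver (box B L) (λ ν → sumOver A (λ T → ⟦ inter? B ν y ⟧ * (⟦ ν ≼? x ⟧ * ⟦ inside? ν T ⟧)))
        ≡⟨ sum-cong (box B L) (λ {ν} _ → trans (sym (*-sum ⟦ inter? B ν y ⟧ A _)) (cong (⟦ inter? B ν y ⟧ *_) (sym (*-sum ⟦ ν ≼? x ⟧ A _)))) ⟩
      sumOver (box B L) (λ ν → ⟦ inter? B ν y ⟧ * (⟦ ν ≼? x ⟧ * sumOver A (λ T → ⟦ inside? ν T ⟧)))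
        ≡⟨ sum-cong (box B L) (λ {ν} _ → ⟦⟧*-cong (inter? B ν y) (λ i → trans (⟦⟧*-cong (ν ≼? x) (fibre ν i))
             (rearrange ⟦ ν ≼? x ⟧ ⟦ size ν ≟ size y + a ⟧ (+ length (tabs (vcells x ν) γ))))) ⟩
      sumOver (box B L) (λ ν → ⟦ inter? B ν y ⟧ * (⟦ size ν ≟ size y + a ⟧ * (⟦ ν ≼? x ⟧ * + length (tabs (vcells x ν) γ)))) ∎
      where
      open ≡-Reasoning
      rearrange : ∀ a b c → a * (b * c) ≡ b * (a * c)
      rearrange = solve-∀

-- Induction over the variables: the ones of a tableau fill the first strip `ν/y` of a chain, and
-- the peeled tableau accounts for the rest of it. With no variables left, only the empty shape has
-- a tableau, and equal sizes then force `x = y`.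
tabs-K : ∀ {L B} (x y : Vec ℕ L) γ → Decreasing x → Decreasing y → y ≼ x → VAll (_< B) x →
  + length (tabs (vcells x y) γ) ≡ K B x y γ
tabs-K x y [] x-dec y-dec y≼x below = by-cells (vcells x y) (length-vcells y≼x) (x ≟ᵥ y)
  where
  by-cells : ∀ cs → size y + length cs ≡ size x → (d : Dec (x ≡ y)) → + length (tabs cs []) ≡ ⟦ d ⟧
  by-cells []       eq (yes _)    = refl
  by-cells []       eq (no x≢y)   = ⊥-elim (x≢y (sym (≼∧size⇒≡ y≼x (trans (sym (ℕₚ.+-identityʳ (size y))) eq))))
  by-cells (c ∷ cs) eq (yes refl) = ⊥-elim (ℕₚ.m+1+n≢m (size y) eq)
  by-cells (c ∷ cs) eq (no _)     = refl
tabs-K {L} {B} x y (a ∷ γ) x-dec y-dec y≼x below = trans (tabs-step x y x-dec y-dec y≼x a γ below)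
  (sum-cong (box B L) (λ {ν} _ → ⟦⟧*-cong (inter? B ν y) (λ i → cong (⟦ size ν ≟ size y + a ⟧ *_)
    (trans (⟦⟧*-cong (ν ≼? x) (λ ν≼x → tabs-K x ν γ x-dec (Inter⇒decreasing ν y i) ν≼x below))
           -- `K` does not ask for `ν ≼ x`, but vanishes when it fails.
           (⟦⟧*-absorb (ν ≼? x) (K-outside B x ν γ))))))

-- Partitions and strips as padded vectors

pad : ∀ L → List ℕ → Vec ℕ L
pad zero    _       = []
pad (suc L) []      = 0 ∷ pad L []
pad (suc L) (a ∷ α) = a ∷ pad L α

pad-! : ∀ L α → length α ≤ L → ∀ i → pad L α ! i ≡ part α i
pad-! zero    []      _       i       = refl
pad-! (suc L) []      _       zero    = refl
pad-! (suc L) []      _       (suc i) = pad-! L [] z≤n i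
pad-! (suc L) (a ∷ α) (s≤s p) zero    = refl
pad-! (suc L) (a ∷ α) (s≤s p) (suc i) = pad-! L α p i

size-pad : ∀ L α → length α ≤ L → size (pad L α) ≡ sum α
size-pad zero    []      _       = refl
size-pad (suc L) []      _       = size-pad L [] z≤n
size-pad (suc L) (a ∷ α) (s≤s p) = cong (λ t → a + t) (size-pad L α p)

endsInZero-pad : ∀ α → EndsInZero (pad (suc (length α)) α)
endsInZero-pad []          = refl
endsInZero-pad (a ∷ [])    = refl
endsInZero-pad (a ∷ b ∷ α) = endsInZero-pad (b ∷ α)

-- Rows beyond the length of `α` are empty, so trailing zeros leave even the list of cells
-- unchanged.
cells-by-parts : ∀ α β α′ β′ → length α ≤ length α′ →
  (∀ i → part α i ≡ part α′ i) → (∀ i → part β i ≡ part β′ i) → cells α β ≡ cells α′ β′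
cells-by-parts α β α′ β′ len α≡ β≡ = begin
  concat (map (cellsInRow α β) (upTo (length α)))    ≡⟨ cong concat (map-upTo (cellsInRow α β) (length α)) ⟩
  concat (applyUpTo (cellsInRow α β) (length α))     ≡⟨ extend (cellsInRow α β) len
    (λ i len≤i → cong (applyUpTo _) (trans (cong (_∸ part β i) (part-beyond α len≤i)) (ℕₚ.0∸n≡0 (part β i)))) ⟩
  concat (applyUpTo (cellsInRow α β) (length α′))    ≡⟨ cong concat (applyUpTo-cong (length α′) same-row) ⟩
  concat (applyUpTo (cellsInRow α′ β′) (length α′))  ≡⟨ cong concat (map-upTo (cellsInRow α′ β′) (length α′)) ⟨
  concat (map (cellsInRow α′ β′) (upTo (length α′))) ∎
  where
  open ≡-Reasoning
  same-row : ∀ i → cellsInRow α β i ≡ cellsInRow α′ β′ i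
  same-row i = cong₂ (λ a b → applyUpTo (λ d → i , b + d) (a ∸ b)) (α≡ i) (β≡ i)
  extend : ∀ (f : ℕ → List Cell) {m n} → m ≤ n → (∀ i → m ≤ i → f i ≡ []) → concat (applyUpTo f m) ≡ concat (applyUpTo f n)
  extend f {n = zero}  z≤n     z = refl
  extend f {n = suc n} z≤n     z = trans (extend (f ∘ suc) {n = n} z≤n (λ i _ → z (suc i) z≤n)) (cong (_++ concat (applyUpTo (f ∘ suc) n)) (sym (z 0 z≤n)))
  extend f             (s≤s p) z = cong (f 0 ++_) (extend (f ∘ suc) p (λ i m≤i → z (suc i) (s≤s m≤i)))

vcells-pad : ∀ L α β → length α ≤ L → length β ≤ L → vcells (pad L α) (pad L β) ≡ cells α β
vcells-pad L α β α≤L β≤L = sym (cells-by-parts α β (Vec.toList (pad L α)) (Vec.toList (pad L β)) (subst (length α ≤_) (sym (length-toList (pad L α))) α≤L)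
  (sym ∘ pad-! L α α≤L) (sym ∘ pad-! L β β≤L))

partition-decreasing : ∀ {α} → Linked _≥_ α → ∀ i → part α (suc i) ≤ part α i
partition-decreasing []       i       = z≤n
partition-decreasing [-]      zero    = z≤n
partition-decreasing [-]      (suc i) = z≤n
partition-decreasing (p ∷ ps) zero    = p
partition-decreasing (p ∷ ps) (suc i) = partition-decreasing ps i

decreasing⇒linked : ∀ α → (∀ i → part α (suc i) ≤ part α i) → Linked _≥_ α
decreasing⇒linked []          dec = []
decreasing⇒linked (a ∷ [])    dec = [-]
decreasing⇒linked (a ∷ b ∷ α) dec = dec 0 ∷ decreasing⇒linked (b ∷ α) (dec ∘ suc)

⊆⇒part : ∀ {α β} → β ⊆ α → ∀ i → part β i ≤ part α i
⊆⇒part []       i       = z≤n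
⊆⇒part (p ∷ ps) zero    = p
⊆⇒part (p ∷ ps) (suc i) = ⊆⇒part ps i

part⇒⊆ : ∀ α β → All (0 <_) β → (∀ i → part β i ≤ part α i) → β ⊆ α
part⇒⊆ α       []      _          _ = []
part⇒⊆ []      (b ∷ β) (0<b ∷ _)  p = ⊥-elim (ℕₚ.<⇒≱ 0<b (p 0))
part⇒⊆ (a ∷ α) (b ∷ β) (_ ∷ pos) p = p 0 ∷ part⇒⊆ α β pos (p ∘ suc)

⊆⇒length : ∀ {α β} → β ⊆ α → length β ≤ length α
⊆⇒length []       = z≤n
⊆⇒length (_ ∷ ps) = s≤s (⊆⇒length ps)

part≡0⇒length : ∀ {α} → All (0 <_) α → ∀ i → part α i ≡ 0 → length α ≤ i
part≡0⇒length []        i       _  = z≤n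
part≡0⇒length (p ∷ _)   zero    eq = ⊥-elim (ℕₚ.<⇒≢ p (sym eq))
part≡0⇒length (_ ∷ pos) (suc i) eq = s≤s (part≡0⇒length pos i eq)

part-ext : ∀ {α β} → All (0 <_) α → All (0 <_) β → (∀ i → part α i ≡ part β i) → α ≡ β
part-ext []        []        eq = refl
part-ext []        (p ∷ _)   eq = ⊥-elim (ℕₚ.<⇒≢ p (eq 0))
part-ext (p ∷ _)   []        eq = ⊥-elim (ℕₚ.<⇒≢ p (sym (eq 0)))
part-ext (_ ∷ ps)  (_ ∷ qs)  eq = cong₂ _∷_ (eq 0) (part-ext ps qs (eq ∘ suc))

-- Cuts at the first zero, which loses nothing when the vector is decreasing; on such vectors it
-- inverts `pad`.
unpad : ∀ {L} → Vec ℕ L → List ℕ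
unpad []          = []
unpad (zero ∷ x)  = []
unpad (suc v ∷ x) = suc v ∷ unpad x

unpad-positive : ∀ {L} (x : Vec ℕ L) → All (0 <_) (unpad x)
unpad-positive []          = []
unpad-positive (zero ∷ x)  = []
unpad-positive (suc v ∷ x) = s≤s z≤n ∷ unpad-positive x

unpad-length : ∀ {L} (x : Vec ℕ L) → length (unpad x) ≤ L
unpad-length []          = z≤n
unpad-length (zero ∷ x)  = z≤n
unpad-length (suc v ∷ x) = s≤s (unpad-length x)

unpad-part : ∀ {L} (x : Vec ℕ L) → Decreasing x → ∀ i → part (unpad x) i ≡ x ! i
unpad-part []          dec i       = refl
unpad-part (zero ∷ x)  dec i       = sym (ℕₚ.n≤0⇒n≡0 (antitone ((zero ∷ x) !_) dec {0} {i} z≤n))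
unpad-part (suc v ∷ x) dec zero    = refl
unpad-part (suc v ∷ x) dec (suc i) = unpad-part x (dec ∘ suc) i

unpad-partition : ∀ {L} (x : Vec ℕ L) → Decreasing x → IsPartition (unpad x)
unpad-partition x dec = decreasing⇒linked (unpad x) (λ i → subst₂ _≤_ (sym (unpad-part x dec (suc i))) (sym (unpad-part x dec i)) (dec i)) , unpad-positive x

pad-unpad : ∀ {L} (x : Vec ℕ L) → Decreasing x → x ≡ pad L (unpad x)
pad-unpad {L} x dec = !-ext _ _ (λ i → sym (trans (pad-! L (unpad x) (unpad-length x) i) (unpad-part x dec i)))

pad-injective : ∀ {L α β} → IsPartition α → IsPartition β → length α ≤ L → length β ≤ L → pad L α ≡ pad L β → α ≡ β
pad-injective {L} {α} {β} pα pβ α≤L β≤L eq = part-ext (proj₂ pα) (proj₂ pβ)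
  (λ i → trans (sym (pad-! L α α≤L i)) (trans (cong (_! i) eq) (pad-! L β β≤L i)))

pad-decreasing : ∀ {L α} → IsPartition α → length α ≤ L → Decreasing (pad L α)
pad-decreasing {L} {α} (linked , _) α≤L i =
  subst₂ _≤_ (sym (pad-! L α α≤L (suc i))) (sym (pad-! L α α≤L i)) (partition-decreasing linked i)

skewSchur-K : ∀ {L B α β} γ → SkewShape α β → length α ≤ L → sum α < B → skewSchur α β γ ≡ K B (pad L α) (pad L β) γ
skewSchur-K {L} {B} {α} {β} γ (pα , pβ , β⊆α) α≤L α<B = trans
  (cong (λ cs → + length (tabs cs γ)) (sym (vcells-pad L α β α≤L β≤L)))
  (tabs-K (pad L α) (pad L β) γ (pad-decreasing pα α≤L) (pad-decreasing pβ β≤L)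
    (!⇒≼ _ _ (λ i → subst₂ _≤_ (sym (pad-! L β β≤L i)) (sym (pad-! L α α≤L i)) (⊆⇒part β⊆α i)))
    (size<⇒below B _ (subst (_< B) (sym (size-pad L α α≤L)) α<B)))
  where
  β≤L = ℕₚ.≤-trans (⊆⇒length β⊆α) α≤L

-- Otherwise rows `i` and `suc i` both have a cell in column `part β i`.
horizontal-parts : ∀ {k α β} → HorizontalStrip k α β → ∀ i → part α (suc i) ≤ part β i
horizontal-parts {k} {α} {β} ((pα , pβ , _) , one , _) i = ℕₚ.≮⇒≥ λ β<α →
  let c∈ = ∈-cells⁺ α β {i} {part β i} ℕₚ.≤-refl (ℕₚ.<-≤-trans β<α (partition-decreasing (proj₁ pα) i))
      d∈ = ∈-cells⁺ α β {suc i} {part β i} (partition-decreasing (proj₁ pβ) i) β<α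
  in ℕₚ.1+n≢n (sym (cong proj₁ (All.lookup (All.lookup one c∈) d∈ refl)))

-- A horizontal strip starts at most one new row, so `suc (length lam)` rows hold every `lam⁺`.
horizontal-length : ∀ {k α β} → HorizontalStrip k α β → length α ≤ suc (length β)
horizontal-length {α = α} {β} strip@((pα , _) , _) = part≡0⇒length (proj₂ pα) (suc (length β))
  (ℕₚ.n≤0⇒n≡0 (subst (part α (suc (length β)) ≤_) (part-beyond β ℕₚ.≤-refl) (horizontal-parts strip (length β))))

horizontal-intro : ∀ {k α β} → SkewShape α β → (∀ i → part α (suc i) ≤ part β i) → sum α ≡ sum β + k → HorizontalStrip k α β
horizontal-intro {k} {α} {β} skew@((linked , _) , _ , β⊆α) next sizes =
  skew , All.tabulate (λ c∈ → All.tabulate (λ d∈ eq → cong₂ _,_ (same c∈ d∈ eq) eq)) ,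
  ℕₚ.+-cancelˡ-≡ (sum β) _ _ (trans (length-cells β⊆α) sizes)
  where
  apart : ∀ {c d} → c ∈ cells α β → d ∈ cells α β → col c ≡ col d → ¬ row c < row d
  apart {c} {d} c∈ d∈ eq lt = ℕₚ.<⇒≱ (proj₂ (∈-cells⁻ α β d∈))
    (ℕₚ.≤-trans (antitone (part α) (partition-decreasing linked) lt) (ℕₚ.≤-trans (next (row c)) (subst (part β (row c) ≤_) eq (proj₁ (∈-cells⁻ α β c∈)))))
  same : ∀ {c d} → c ∈ cells α β → d ∈ cells α β → col c ≡ col d → row c ≡ row d
  same c∈ d∈ eq = ℕₚ.≤-antisym (ℕₚ.≮⇒≥ (apart d∈ c∈ (sym eq))) (ℕₚ.≮⇒≥ (apart c∈ d∈ eq))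

vertical-parts : ∀ {k α β} → VerticalStrip k α β → ∀ i → part α i ≤ suc (part β i)
vertical-parts {k} {α} {β} (_ , one , _) i = ℕₚ.≮⇒≥ λ lt →
  let c∈ = ∈-cells⁺ α β {i} {part β i} ℕₚ.≤-refl (ℕₚ.<-trans (ℕₚ.n<1+n _) lt)
      d∈ = ∈-cells⁺ α β {i} {suc (part β i)} (ℕₚ.n≤1+n _) lt
  in ℕₚ.1+n≢n (sym (cong proj₂ (All.lookup (All.lookup one c∈) d∈ refl)))

vertical-intro : ∀ {k α β} → SkewShape α β → (∀ i → part α i ≤ suc (part β i)) → sum α ≡ sum β + k → VerticalStrip k α β
vertical-intro {k} {α} {β} skew@(_ , _ , β⊆α) rows sizes =
  skew , All.tabulate (λ c∈ → All.tabulate (λ d∈ eq → cong₂ _,_ eq (trans (position c∈) (trans (cong (part β) eq) (sym (position d∈)))))) ,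
  ℕₚ.+-cancelˡ-≡ (sum β) _ _ (trans (length-cells β⊆α) sizes)
  where
  position : ∀ {c} → c ∈ cells α β → col c ≡ part β (row c)
  position {c} c∈ = let β≤c , c<α = ∈-cells⁻ α β c∈ in
    ℕₚ.≤-antisym (ℕₚ.≤-pred (ℕₚ.<-≤-trans c<α (rows (row c)))) β≤c

strip-size : ∀ {α β k} → β ⊆ α → length (cells α β) ≡ k → sum α ≡ sum β + k
strip-size β⊆α refl = sym (length-cells β⊆α)

-- `pad` and `unpad` identify the strips with the interlacing vectors of the right size. No
-- partition condition appears on `x`, because `Inter` already makes it decreasing.
sum-horizontalStrips : ∀ {B k lam} (F : Vec ℕ (suc (length lam)) → ℤ) → IsPartition lam → sum lam + k < B →
  sumOver (horizontalStripsOver k lam) (λ α → F (pad (suc (length lam)) α)) ≡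
  sumOver (box B (suc (length lam))) (λ x → ⟦ inter? B x (pad (suc (length lam)) lam) ⟧ *
    (⟦ size x ≟ size (pad (suc (length lam)) lam) + k ⟧ * F x))
sum-horizontalStrips {B} {k} {lam} F plam small = begin
  sumOver strips (λ α → F (pad L α))
    ≡⟨ sum-reindex (pad L) F (horizontalStripsOver-unique k lam) (Unique.filter⁺ P? (vbox-unique B L)) into inj onto ⟨
  sumOver (filter P? (box B L)) F
    ≡⟨ sum-filter P? (box B L) F ⟩
  sumOver (box B L) (λ x → ⟦ P? x ⟧ * F x)
    ≡⟨ sum-cong (box B L) (λ {x} _ → trans (cong (_* F x) (⟦⟧-× (inter? B x v) (size x ≟ size v + k))) (ℤₚ.*-assoc ⟦ inter? B x v ⟧ _ (F x))) ⟩
  sumOver (box B L) (λ x → ⟦ inter? B x v ⟧ * (⟦ size x ≟ size v + k ⟧ * F x)) ∎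
  where
  open ≡-Reasoning
  L = suc (length lam)
  v = pad L lam
  lam≤L = ℕₚ.n≤1+n (length lam)
  strips = horizontalStripsOver k lam
  P? = λ (x : Vec ℕ L) → inter? B x v ×-dec (size x ≟ size v + k)
  strip : ∀ {α} → α ∈ strips → HorizontalStrip k α lam
  strip = Equivalence.to ∈-horizontalStripsOver
  α≤L : ∀ {α} → α ∈ strips → length α ≤ L
  α≤L α∈ = horizontal-length (strip α∈)
  into : ∀ {α} → α ∈ strips → pad L α ∈ filter P? (box B L)
  into {α} α∈ = ∈-filter⁺ P? (∈-box⁺ B below) (inter , sizes)
    where
    hyp = strip α∈
    lam⊆α = proj₂ (proj₂ (proj₁ hyp))
    !αβ = pad-! L α (α≤L α∈)
    !lam = pad-! L lam lam≤L
    sizes : size (pad L α) ≡ size v + k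
    sizes = trans (size-pad L α (α≤L α∈)) (trans (strip-size lam⊆α (proj₂ (proj₂ hyp))) (cong (_+ k) (sym (size-pad L lam lam≤L))))
    below : VAll (_< B) (pad L α)
    below = size<⇒below B _ (subst (_< B) (sym (trans sizes (cong (_+ k) (size-pad L lam lam≤L)))) small)
    inter : Inter B (pad L α) v
    inter = !⇒Inter _ _ (!⇒≼ _ _ (λ i → subst₂ _≤_ (sym (!lam i)) (sym (!αβ i)) (⊆⇒part lam⊆α i)))
      (λ i → subst₂ _≤_ (sym (!αβ (suc i))) (sym (!lam i)) (horizontal-parts hyp i)) (below-top below)
  inj : ∀ {α β} → α ∈ strips → β ∈ strips → pad L α ≡ pad L β → α ≡ β
  inj α∈ β∈ = pad-injective (proj₁ (proj₁ (strip α∈))) (proj₁ (proj₁ (strip β∈))) (α≤L α∈) (α≤L β∈)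
  onto : ∀ {x} → x ∈ filter P? (box B L) → ∃ λ α → α ∈ strips × x ≡ pad L α
  onto {x} x∈ with ∈-filter⁻ P? {xs = box B L} x∈
  ... | _ , i , sizes = unpad x , Equivalence.from ∈-horizontalStripsOver
      (horizontal-intro (unpad-partition x dec , plam , part⇒⊆ (unpad x) lam (proj₂ plam) (λ j →
          subst₂ _≤_ (pad-! L lam lam≤L j) (sym (unpad-part x dec j)) (≼⇒! (Inter⇒≼ x v i) j)))
        (λ j → subst₂ _≤_ (sym (unpad-part x dec (suc j))) (pad-! L lam lam≤L j) (Inter⇒! x v i j))
        (trans (sym (trans (cong size x≡) (size-pad L (unpad x) (unpad-length x)))) (trans sizes (cong (_+ k) (size-pad L lam lam≤L))))) , x≡
    where
    dec = Inter⇒decreasing x v i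
    x≡  = pad-unpad x dec

descending? : ∀ {L} u (x : Vec ℕ L) → Dec (Descending u x)
descending? u []      = yes tt
descending? u (v ∷ x) = v ≤? u ×-dec descending? v x

Descending⇒decreasing : ∀ {L u} (x : Vec ℕ L) → Descending u x → Decreasing x
Descending⇒decreasing []          _            i       = z≤n
Descending⇒decreasing (v ∷ [])    _            zero    = z≤n
Descending⇒decreasing (v ∷ w ∷ x) (_ , p , _)  zero    = p
Descending⇒decreasing (v ∷ x)     (_ , d)      (suc i) = Descending⇒decreasing x d i

decreasing⇒Descending : ∀ {L u} (x : Vec ℕ L) → x ! 0 ≤ u → Decreasing x → Descending u x
decreasing⇒Descending []      _ _   = tt
decreasing⇒Descending (v ∷ x) p dec = p , decreasing⇒Descending x (dec 0) (dec ∘ suc)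

Vertical : ∀ {L} → Vec ℕ L → Vec ℕ L → Set
Vertical []      []      = ⊤
Vertical (m ∷ μ) (v ∷ y) = (v ≤ m × m ≤ suc v) × Vertical μ y

vertical? : ∀ {L} (μ y : Vec ℕ L) → Dec (Vertical μ y)
vertical? []      []      = yes tt
vertical? (m ∷ μ) (v ∷ y) = (v ≤? m ×-dec m ≤? suc v) ×-dec vertical? μ y

Vertical⇒≼ : ∀ {L} (μ y : Vec ℕ L) → Vertical μ y → y ≼ μ
Vertical⇒≼ []      []      _             = []
Vertical⇒≼ (m ∷ μ) (v ∷ y) ((p , _) , r) = p ∷ Vertical⇒≼ μ y r

Vertical⇒! : ∀ {L} (μ y : Vec ℕ L) → Vertical μ y → ∀ i → μ ! i ≤ suc (y ! i)
Vertical⇒! []      []      _             i       = z≤n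
Vertical⇒! (m ∷ μ) (v ∷ y) ((_ , p) , _) zero    = p
Vertical⇒! (m ∷ μ) (v ∷ y) (_ , r)       (suc i) = Vertical⇒! μ y r i

!⇒Vertical : ∀ {L} (μ y : Vec ℕ L) → y ≼ μ → (∀ i → μ ! i ≤ suc (y ! i)) → Vertical μ y
!⇒Vertical []      []      _        _ = tt
!⇒Vertical (m ∷ μ) (v ∷ y) (p ∷ ps) q = (p , q 0) , !⇒Vertical μ y ps (q ∘ suc)

-- Unlike `Inter`, `Vertical` does not make `y` decreasing, hence the additional `Descending`;
-- inside the box its bound `B` is vacuous.
sum-verticalStrips : ∀ {B L k mu} (F : Vec ℕ L → ℤ) → IsPartition mu → length mu ≤ L → sum mu < B →
  sumOver (verticalStripsUnder k mu) (λ β → F (pad L β)) ≡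
  sumOver (box B L) (λ y → ⟦ descending? B y ×-dec vertical? (pad L mu) y ⟧ * (⟦ size (pad L mu) ≟ size y + k ⟧ * F y))
sum-verticalStrips {B} {L} {k} {mu} F pmu mu≤L small = begin
  sumOver strips (λ β → F (pad L β))
    ≡⟨ sum-reindex (pad L) F (verticalStripsUnder-unique k mu) (Unique.filter⁺ P? (vbox-unique B L)) into inj onto ⟨
  sumOver (filter P? (box B L)) F
    ≡⟨ sum-filter P? (box B L) F ⟩
  sumOver (box B L) (λ y → ⟦ P? y ⟧ * F y)
    ≡⟨ sum-cong (box B L) (λ {y} _ → trans (cong (_* F y) (⟦⟧-× (V? y) (size μ ≟ size y + k))) (ℤₚ.*-assoc ⟦ V? y ⟧ _ (F y))) ⟩
  sumOver (box B L) (λ y → ⟦ V? y ⟧ * (⟦ size μ ≟ size y + k ⟧ * F y)) ∎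
  where
  open ≡-Reasoning
  μ = pad L mu
  strips = verticalStripsUnder k mu
  V? = λ (y : Vec ℕ L) → descending? B y ×-dec vertical? μ y
  P? = λ (y : Vec ℕ L) → V? y ×-dec (size μ ≟ size y + k)
  μ<B : VAll (_< B) μ
  μ<B = size<⇒below B μ (subst (_< B) (sym (size-pad L mu mu≤L)) small)
  strip : ∀ {β} → β ∈ strips → VerticalStrip k mu β
  strip = Equivalence.to ∈-verticalStripsUnder
  β≤L : ∀ {β} → β ∈ strips → length β ≤ L
  β≤L β∈ = ℕₚ.≤-trans (⊆⇒length (proj₂ (proj₂ (proj₁ (strip β∈))))) mu≤L
  into : ∀ {β} → β ∈ strips → pad L β ∈ filter P? (box B L)
  into {β} β∈ = ∈-filter⁺ P? (∈-box⁺ B below)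
    ((decreasing⇒Descending _ (below-top below) (pad-decreasing (proj₁ (proj₂ (proj₁ hyp))) (β≤L β∈)) ,
      !⇒Vertical μ _ β≼μ (λ i → subst₂ _≤_ (sym (!mu i)) (cong suc (sym (!αβ i))) (vertical-parts hyp i))) ,
     trans (size-pad L mu mu≤L) (trans (strip-size β⊆mu (proj₂ (proj₂ hyp))) (cong (_+ k) (sym (size-pad L β (β≤L β∈))))))
    where
    hyp = strip β∈
    β⊆mu = proj₂ (proj₂ (proj₁ hyp))
    !αβ = pad-! L β (β≤L β∈)
    !mu = pad-! L mu mu≤L
    β≼μ : pad L β ≼ μ
    β≼μ = !⇒≼ _ _ (λ i → subst₂ _≤_ (sym (!αβ i)) (sym (!mu i)) (⊆⇒part β⊆mu i))
    below : VAll (_< B) (pad L β)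
    below = ≼-below β≼μ μ<B
  inj : ∀ {α β} → α ∈ strips → β ∈ strips → pad L α ≡ pad L β → α ≡ β
  inj α∈ β∈ = pad-injective (proj₁ (proj₂ (proj₁ (strip α∈)))) (proj₁ (proj₂ (proj₁ (strip β∈)))) (β≤L α∈) (β≤L β∈)
  onto : ∀ {y} → y ∈ filter P? (box B L) → ∃ λ β → β ∈ strips × y ≡ pad L β
  onto {y} y∈ with ∈-filter⁻ P? {xs = box B L} y∈
  ... | _ , (desc , vert) , sizes = unpad y , Equivalence.from ∈-verticalStripsUnder
      (vertical-intro (pmu , unpad-partition y dec , part⇒⊆ mu (unpad y) (unpad-positive y) (λ j →
          subst₂ _≤_ (sym (unpad-part y dec j)) (pad-! L mu mu≤L j) (≼⇒! (Vertical⇒≼ μ y vert) j)))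
        (λ j → subst₂ _≤_ (pad-! L mu mu≤L j) (cong suc (sym (unpad-part y dec j))) (Vertical⇒! μ y vert j))
        (trans (sym (size-pad L mu mu≤L)) (trans sizes (cong (_+ k) (trans (cong size y≡) (size-pad L (unpad y) (unpad-length y))))))) , y≡
    where
    dec = Descending⇒decreasing y desc
    y≡  = pad-unpad y dec

-- The skew Pieri rule

signedStrip-sign : ∀ {L} (μ y : Vec ℕ L) k → Vertical μ y → size μ ≡ size y + k → signedStrip μ y ≡ -1ℤ ^ k
signedStrip-sign []      []      zero    _ _ = refl
signedStrip-sign (m ∷ μ) (v ∷ y) k ((v≤m , m≤1+v) , vert) sizes with ℕₚ.m≤n⇒m<n∨m≡n v≤m
... | inj₂ refl = begin
  (⟦ v ≟ v ⟧ ℤ.- ⟦ suc v ≟ v ⟧) * signedStrip μ y ≡⟨ cong₂ (λ a b → (a ℤ.- b) * signedStrip μ y) (⟦⟧-yes (v ≟ v) refl) (⟦⟧-no (suc v ≟ v) ℕₚ.1+n≢n) ⟩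
  1ℤ * signedStrip μ y                            ≡⟨ ℤₚ.*-identityˡ (signedStrip μ y) ⟩
  signedStrip μ y                                 ≡⟨ signedStrip-sign μ y k vert (ℕₚ.+-cancelˡ-≡ v _ _ (trans sizes (ℕₚ.+-assoc v (size y) k))) ⟩
  -1ℤ ^ k                                         ∎
  where open ≡-Reasoning
... | inj₁ v<m with ℕₚ.≤-antisym m≤1+v v<m
... | refl = begin
  (⟦ v ≟ suc v ⟧ ℤ.- ⟦ suc v ≟ suc v ⟧) * signedStrip μ y ≡⟨ cong₂ (λ a b → (a ℤ.- b) * signedStrip μ y) (⟦⟧-no (v ≟ suc v) (ℕₚ.1+n≢n ∘ sym)) (⟦⟧-yes (suc v ≟ suc v) refl) ⟩
  -1ℤ * signedStrip μ y                                   ≡⟨ cong (-1ℤ *_) (signedStrip-sign μ y k′ vert (sym μ≡)) ⟩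
  -1ℤ ^ suc k′                                            ≡⟨ cong (-1ℤ ^_) k≡ ⟨
  -1ℤ ^ k                                                 ∎
  where
  open ≡-Reasoning
  -- The number of cells in the remaining rows; the present row has one cell, which accounts for one
  -- factor -1.
  k′ = size μ ∸ size y
  μ≡ : size y + k′ ≡ size μ
  μ≡ = ℕₚ.m+[n∸m]≡n (size-mono (Vertical⇒≼ μ y vert))
  k≡ : k ≡ suc k′
  k≡ = ℕₚ.+-cancelˡ-≡ (v + size y) k (suc k′) (begin
    v + size y + k        ≡⟨ sizes ⟨
    suc (v + size μ)      ≡⟨ cong (λ t → suc (v + t)) μ≡ ⟨
    suc (v + (size y + k′)) ≡⟨ cong suc (ℕₚ.+-assoc v (size y) k′) ⟨
    suc (v + size y + k′) ≡⟨ ℕₚ.+-suc (v + size y) k′ ⟨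
    v + size y + suc k′   ∎)

signedStrip-nonvertical : ∀ {L} (μ y : Vec ℕ L) → ¬ Vertical μ y → signedStrip μ y ≡ 0ℤ
signedStrip-nonvertical []      []      ¬vert = ⊥-elim (¬vert tt)
signedStrip-nonvertical (m ∷ μ) (v ∷ y) ¬vert with v ≤? m ×-dec m ≤? suc v
... | yes r = trans (cong ((⟦ v ≟ m ⟧ ℤ.- ⟦ suc v ≟ m ⟧) *_) (signedStrip-nonvertical μ y (λ p → ¬vert (r , p))))
                    (ℤₚ.*-zeroʳ (⟦ v ≟ m ⟧ ℤ.- ⟦ suc v ≟ m ⟧))
... | no ¬r = trans (cong (_* signedStrip μ y) (cong₂ ℤ._-_
                (⟦⟧-no (v ≟ m) (λ { refl → ¬r (ℕₚ.≤-refl , ℕₚ.n≤1+n v) })) (⟦⟧-no (suc v ≟ m) (λ { refl → ¬r (ℕₚ.n≤1+n v , ℕₚ.≤-refl) }))))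
              (ℤₚ.*-zeroˡ (signedStrip μ y))

-- Reconciles the signed sum over all vectors `y` with the theorem's sum over partitions. A first
-- step from `y` to `ν` gives `y ! suc j ≤ ν ! suc j ≤ y ! j`, so no chain starts at a vector that
-- is not decreasing.
K-nondecreasing : ∀ {L B} (x y : Vec ℕ L) γ → Decreasing x → ¬ Decreasing y → K B x y γ ≡ 0ℤ
K-nondecreasing x y [] dec ¬dec = ⟦⟧-no (x ≟ᵥ y) (λ { refl → ¬dec dec })
K-nondecreasing {L} {B} x y (a ∷ γ) dec ¬dec = sum-zero (box B L) (λ {ν} _ → ⟦⟧*-no (inter? B ν y)
  (λ i → ¬dec (λ j → ℕₚ.≤-trans (≼⇒! (Inter⇒≼ ν y i) (suc j)) (Inter⇒! ν y i j))))

∑-sum : ∀ {A : Set} (xs : List A) (f : A → Series) γ → ∑ xs f γ ≡ sumOver xs (λ x → f x γ)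
∑-sum []       f γ = refl
∑-sum (x ∷ xs) f γ = cong (ℤ._+_ (f x γ)) (∑-sum xs f γ)

divisor-sum : ∀ γ {β} → β ∈ divisors γ → sum (zipWith _∸_ γ β) + sum β ≡ sum γ
divisor-sum [] (here refl) = refl
divisor-sum (a ∷ γ) β∈ with ∈-cartesianProductWith⁻ _∷_ (upTo (suc a)) (divisors γ) β∈
... | b , β , b∈ , β∈′ , refl = begin
  a ∸ b + sum (zipWith _∸_ γ β) + (b + sum β)   ≡⟨ interchange ℕₚ.+-commutativeSemigroup (a ∸ b) (sum (zipWith _∸_ γ β)) b (sum β) ⟩
  a ∸ b + b + (sum (zipWith _∸_ γ β) + sum β)   ≡⟨ cong₂ _+_ (ℕₚ.m∸n+n≡m (ℕₚ.≤-pred (∈-upTo⁻ b∈))) (divisor-sum γ β∈′) ⟩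
  a + sum γ                                     ∎
  where
  open ≡-Reasoning

-- The chain is forced: each exponent lengthens the row by that amount. If this leaves the box, the
-- row is already longer than `n`, and both sides are zero.
K-one-row : ∀ {B n} → n < B → ∀ k γ → K B (n ∷ []) (k ∷ []) γ ≡ ⟦ k + sum γ ≟ n ⟧
K-one-row {B} {n} n<B k [] = ⟦⟧-cong ((n ∷ []) ≟ᵥ (k ∷ [])) (k + 0 ≟ n)
  (λ { refl → ℕₚ.+-identityʳ k }) (λ eq → cong (_∷ []) (trans (sym eq) (ℕₚ.+-identityʳ k)))
K-one-row {B} {n} n<B k (a ∷ γ) with k + a <? B
... | yes k+a<B = begin
  sumOver (box B 1) F
    ≡⟨ sum-single F (vbox-unique B 1) (∈-box⁺ B (k+a<B ∷ [])) (λ { {v ∷ []} _ ν≢ → trans (cong (⟦ inter? B (v ∷ []) (k ∷ []) ⟧ *_)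
         (⟦⟧*-no (v + 0 ≟ k + 0 + a) (λ eq → ν≢ (cong (_∷ []) (normalise eq))))) (ℤₚ.*-zeroʳ ⟦ inter? B (v ∷ []) (k ∷ []) ⟧) }) ⟩
  F (k + a ∷ [])
    ≡⟨ trans (⟦⟧*-yes (inter? B (k + a ∷ []) (k ∷ [])) ((ℕₚ.m≤m+n k a , ℕₚ.<⇒≤ k+a<B) , tt))
             (⟦⟧*-yes (k + a + 0 ≟ k + 0 + a) (trans (ℕₚ.+-identityʳ (k + a)) (cong (_+ a) (sym (ℕₚ.+-identityʳ k))))) ⟩
  K B (n ∷ []) (k + a ∷ []) γ
    ≡⟨ K-one-row n<B (k + a) γ ⟩
  ⟦ k + a + sum γ ≟ n ⟧
    ≡⟨ cong (λ t → ⟦ t ≟ n ⟧) (ℕₚ.+-assoc k a (sum γ)) ⟩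
  ⟦ k + (a + sum γ) ≟ n ⟧ ∎
  where
  open ≡-Reasoning
  F : Vec ℕ 1 → ℤ
  F ν = ⟦ inter? B ν (k ∷ []) ⟧ * (⟦ size ν ≟ size (k ∷ []) + a ⟧ * K B (n ∷ []) ν γ)
  normalise : ∀ {v} → v + 0 ≡ k + 0 + a → v ≡ k + a
  normalise {v} eq = trans (sym (ℕₚ.+-identityʳ v)) (trans eq (cong (_+ a) (ℕₚ.+-identityʳ k)))
... | no k+a≮B = trans
  (sum-zero (box B 1) (λ { {v ∷ []} ν∈ → trans (cong (⟦ inter? B (v ∷ []) (k ∷ []) ⟧ *_)
     (⟦⟧*-no (v + 0 ≟ k + 0 + a) (λ eq → k+a≮B (subst (_< B) (trans (sym (ℕₚ.+-identityʳ v)) (trans eq (cong (_+ a) (ℕₚ.+-identityʳ k)))) (VAll.head (∈-box⁻ B ν∈))))))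
     (ℤₚ.*-zeroʳ ⟦ inter? B (v ∷ []) (k ∷ []) ⟧) }))
  (sym (⟦⟧-no (k + (a + sum γ) ≟ n) (λ eq → k+a≮B (ℕₚ.≤-<-trans (ℕₚ.≤-trans (ℕₚ.m≤m+n (k + a) (sum γ)) (ℕₚ.≤-reflexive (trans (ℕₚ.+-assoc k a (sum γ)) eq))) n<B))))

s≈h : ∀ n → s n ≈ h n
s≈h n γ = trans
  -- For a single row the inner shapes `0 ∷ []` and `[]` give the same cells by computation.
  (tabs-K (n ∷ []) (0 ∷ []) γ (λ _ → z≤n) (λ { zero → z≤n ; (suc _) → z≤n }) (z≤n ∷ []) (ℕₚ.n<1+n n ∷ []))
  (K-one-row (ℕₚ.n<1+n n) 0 γ)

-- Comparison of the two sides at a fixed monomial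

module _ (lam mu : List ℕ) (skew : SkewShape lam mu) (n : ℕ) (γ : List ℕ) where

  private
    L B : ℕ
    L = suc (length lam)
    -- The largest `lam⁺` has size `sum lam + n`, which is also the value of `size μ + sum γ` when
    -- the degrees balance; the successor makes these bounds strict.
    B = suc (sum lam + n)
    lam≤L : length lam ≤ L
    lam≤L = ℕₚ.n≤1+n (length lam)
    mu⊆lam = proj₂ (proj₂ skew)
    plam = proj₁ skew
    pmu  = proj₁ (proj₂ skew)
    mu≤L : length mu ≤ L
    mu≤L = ℕₚ.≤-trans (⊆⇒length mu⊆lam) lam≤L
    V = box B L
    α μ : Vec ℕ L
    α = pad L lam
    μ = pad L mu
    size-α : size α ≡ sum lam
    size-α = size-pad L lam lam≤L
    size-μ : size μ ≡ sum mu
    size-μ = size-pad L mu mu≤L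
    lam<B : sum lam < B
    lam<B = s≤s (ℕₚ.m≤m+n (sum lam) n)
    mu≤lam : sum mu ≤ sum lam
    mu≤lam = ℕₚ.≤-trans (ℕₚ.m≤m+n _ _) (ℕₚ.≤-reflexive (length-cells mu⊆lam))

  -- The degree condition for `x^γ` to occur on either side. It takes the place of extracting the
  -- coefficient of t^n.
  Balanced : Set
  Balanced = size μ + sum γ ≡ size α + n

  private
    balanced? : Dec Balanced
    balanced? = size μ + sum γ ≟ size α + n

  -- By `K-size`, a divisor `β` contributes only in degree |α| - |μ|. The condition that the
  -- complementary monomial has degree `n` is therefore the same for all of them.
  product-KH : (skewSchur lam mu *ₛ h n) γ ≡ ⟦ balanced? ⟧ * KH B α μ γ
  product-KH = begin
    sumOver (divisors γ) (λ β → skewSchur lam mu β * h n (zipWith _∸_ γ β))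
      ≡⟨ sum-cong (divisors γ) (λ {β} β∈ → trans (cong (_* h n (zipWith _∸_ γ β)) (skewSchur-K β skew lam≤L lam<B)) (term β β∈)) ⟩
    sumOver (divisors γ) (λ β → ⟦ balanced? ⟧ * K B α μ β)
      ≡⟨ *-sum ⟦ balanced? ⟧ (divisors γ) (K B α μ) ⟨
    ⟦ balanced? ⟧ * KH B α μ γ ∎
    where
    open ≡-Reasoning
    term : ∀ β → β ∈ divisors γ → K B α μ β * ⟦ sum (zipWith _∸_ γ β) ≟ n ⟧ ≡ ⟦ balanced? ⟧ * K B α μ β
    term β β∈ with size α ≟ size μ + sum β
    ... | no ≢ = trans (cong (_* ⟦ sum (zipWith _∸_ γ β) ≟ n ⟧) (K-size B α μ β ≢))
                       (sym (trans (cong (⟦ balanced? ⟧ *_) (K-size B α μ β ≢)) (ℤₚ.*-zeroʳ ⟦ balanced? ⟧)))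
    ... | yes eq = trans (ℤₚ.*-comm (K B α μ β) _) (cong (_* K B α μ β) (⟦⟧-cong (sum (zipWith _∸_ γ β) ≟ n) balanced?
        (λ { refl → trans total (ℕₚ.+-comm _ (size α)) })
        (λ bal → ℕₚ.+-cancelʳ-≡ (size α) _ _ (trans (sym total) (trans bal (ℕₚ.+-comm (size α) n))))))
      where
      total : size μ + sum γ ≡ sum (zipWith _∸_ γ β) + size α
      total = begin
        size μ + sum γ                                  ≡⟨ cong (λ t → size μ + t) (divisor-sum γ β∈) ⟨
        size μ + (sum (zipWith _∸_ γ β) + sum β)        ≡⟨ ℕₚ.+-comm (size μ) _ ⟩
        sum (zipWith _∸_ γ β) + sum β + size μ          ≡⟨ ℕₚ.+-assoc (sum (zipWith _∸_ γ β)) (sum β) (size μ) ⟩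
        sum (zipWith _∸_ γ β) + (sum β + size μ)        ≡⟨ cong (λ t → sum (zipWith _∸_ γ β) + t) (trans (ℕₚ.+-comm (sum β) (size μ)) (sym eq)) ⟩
        sum (zipWith _∸_ γ β) + size α                  ∎

  private
    term : ℕ → Vec ℕ L → Vec ℕ L → ℤ
    term k x y = -1ℤ ^ k * (⟦ inter? B x α ⟧ * (⟦ size x ≟ size α + (n ∸ k) ⟧ *
      (⟦ descending? B y ×-dec vertical? μ y ⟧ * (⟦ size μ ≟ size y + k ⟧ * K B x y γ))))

  expansion : (∑[ k ∈ upTo (suc n) ] (-1ℤ ^ k) ·ₛ
      (∑[ (lam⁺ , mu⁻) ∈ cartesianProduct (horizontalStripsOver (n ∸ k) lam) (verticalStripsUnder k mu) ] skewSchur lam⁺ mu⁻)) γ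
    ≡ sumOver (upTo (suc n)) (λ k → sumOver V (λ x → sumOver V (λ y → term k x y)))
  expansion = trans (∑-sum (upTo (suc n)) summand γ) (sum-cong (upTo (suc n)) (λ {k} _ → inner k))
    where
    open ≡-Reasoning
    summand : ℕ → Series
    summand k = (-1ℤ ^ k) ·ₛ
      (∑[ (lam⁺ , mu⁻) ∈ cartesianProduct (horizontalStripsOver (n ∸ k) lam) (verticalStripsUnder k mu) ] skewSchur lam⁺ mu⁻)
    inner : ∀ k → -1ℤ ^ k * (∑[ (lam⁺ , mu⁻) ∈ cartesianProduct (horizontalStripsOver (n ∸ k) lam) (verticalStripsUnder k mu) ] skewSchur lam⁺ mu⁻) γ
      ≡ sumOver V (λ x → sumOver V (λ y → term k x y))
    inner k = begin
      -1ℤ ^ k * (∑[ (lam⁺ , mu⁻) ∈ cartesianProduct hs vs ] skewSchur lam⁺ mu⁻) γ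
        ≡⟨ cong (-1ℤ ^ k *_) (trans (∑-sum (cartesianProduct hs vs) _ γ) (sum-productWith _,_ hs vs _)) ⟩
      -1ℤ ^ k * sumOver hs (λ lam⁺ → sumOver vs (λ mu⁻ → skewSchur lam⁺ mu⁻ γ))
        ≡⟨ cong (-1ℤ ^ k *_) (sum-cong hs (λ lam⁺∈ → sum-cong vs (λ mu⁻∈ → to-K lam⁺∈ mu⁻∈))) ⟩
      -1ℤ ^ k * sumOver hs (λ lam⁺ → sumOver vs (λ mu⁻ → K B (pad L lam⁺) (pad L mu⁻) γ))
        ≡⟨ cong (-1ℤ ^ k *_) (sum-cong hs (λ {lam⁺} _ → sum-verticalStrips (λ y → K B (pad L lam⁺) y γ) pmu mu≤L (ℕₚ.≤-<-trans mu≤lam lam<B))) ⟩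
      -1ℤ ^ k * sumOver hs (λ lam⁺ → G (pad L lam⁺))
        ≡⟨ cong (-1ℤ ^ k *_) (sum-horizontalStrips G plam (s≤s (ℕₚ.+-monoʳ-≤ (sum lam) (ℕₚ.m∸n≤m n k)))) ⟩
      -1ℤ ^ k * sumOver V (λ x → ⟦ inter? B x α ⟧ * (⟦ size x ≟ size α + (n ∸ k) ⟧ * G x))
        ≡⟨ *-sum (-1ℤ ^ k) V _ ⟩
      sumOver V (λ x → -1ℤ ^ k * (⟦ inter? B x α ⟧ * (⟦ size x ≟ size α + (n ∸ k) ⟧ * G x)))
        ≡⟨ sum-cong V (λ {x} _ → push x) ⟩
      sumOver V (λ x → sumOver V (λ y → term k x y)) ∎
      where
      hs = horizontalStripsOver (n ∸ k) lam
      vs = verticalStripsUnder k mu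
      G : Vec ℕ L → ℤ
      G x = sumOver V (λ y → ⟦ descending? B y ×-dec vertical? μ y ⟧ * (⟦ size μ ≟ size y + k ⟧ * K B x y γ))
      push : ∀ x → -1ℤ ^ k * (⟦ inter? B x α ⟧ * (⟦ size x ≟ size α + (n ∸ k) ⟧ * G x)) ≡ sumOver V (λ y → term k x y)
      push x = begin
        a * (b * (c * G x))                  ≡⟨ cong (λ t → a * (b * t)) (*-sum c V _) ⟩
        a * (b * sumOver V (λ y → c * _))    ≡⟨ cong (a *_) (*-sum b V _) ⟩
        a * sumOver V (λ y → b * (c * _))    ≡⟨ *-sum a V _ ⟩
        sumOver V (λ y → term k x y)         ∎
        where
        a = -1ℤ ^ k
        b = ⟦ inter? B x α ⟧
        c = ⟦ size x ≟ size α + (n ∸ k) ⟧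
      to-K : ∀ {lam⁺ mu⁻} → lam⁺ ∈ hs → mu⁻ ∈ vs → skewSchur lam⁺ mu⁻ γ ≡ K B (pad L lam⁺) (pad L mu⁻) γ
      to-K {lam⁺} {mu⁻} lam⁺∈ mu⁻∈ = skewSchur-K γ (p⁺ , p⁻ , part⇒⊆ lam⁺ mu⁻ (proj₂ p⁻) (λ i →
          ℕₚ.≤-trans (⊆⇒part mu⁻⊆mu i) (ℕₚ.≤-trans (⊆⇒part mu⊆lam i) (⊆⇒part lam⊆lam⁺ i))))
        (horizontal-length hstrip)
        (subst (_< B) (sym (strip-size lam⊆lam⁺ (proj₂ (proj₂ hstrip)))) (s≤s (ℕₚ.+-monoʳ-≤ (sum lam) (ℕₚ.m∸n≤m n k))))
        where
        hstrip : HorizontalStrip (n ∸ k) lam⁺ lam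
        hstrip = Equivalence.to ∈-horizontalStripsOver lam⁺∈
        vstrip : VerticalStrip k mu mu⁻
        vstrip = Equivalence.to ∈-verticalStripsUnder mu⁻∈
        p⁺ = proj₁ (proj₁ hstrip)
        p⁻ = proj₁ (proj₂ (proj₁ vstrip))
        lam⊆lam⁺ = proj₂ (proj₂ (proj₁ hstrip))
        mu⁻⊆mu = proj₂ (proj₂ (proj₁ vstrip))

  private
    term-vanish : ∀ k x y → (Inter B x α → size x ≡ size α + (n ∸ k) → Descending B y → Vertical μ y →
      size μ ≡ size y + k → size x ≢ size y + sum γ) → term k x y ≡ 0ℤ
    term-vanish k x y excluded = trans (cong (-1ℤ ^ k *_)
      (⟦⟧*-zero (inter? B x α) (λ i → ⟦⟧*-zero (size x ≟ size α + (n ∸ k)) (λ e →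
        ⟦⟧*-zero (descending? B y ×-dec vertical? μ y) (λ (d , v) →
          ⟦⟧*-zero (size μ ≟ size y + k) (λ e′ → K-size B x y γ (excluded i e d v e′)))))))
      (ℤₚ.*-zeroʳ (-1ℤ ^ k))

  -- The sizes of x and y force k = |μ| - |y|, and k ≤ n because |α| ≤ |x|.
  collapse : ∀ x y → VAll (_< B) y → sumOver (upTo (suc n)) (λ k → term k x y) ≡
    ⟦ balanced? ⟧ * (signedStrip μ y * (⟦ inter? B x α ⟧ * K B x y γ))
  collapse x y y<B = by-balance balanced?
    where
    open ≡-Reasoning
    σ = signedStrip μ y
    F : ℕ → ℤ
    F k = term k x y
    annihilate : ∀ a b → a * (b * 0ℤ) ≡ 0ℤ
    annihilate = solve-∀
    -- If one condition fails, every `term k x y` vanishes, and so does a factor on the right: the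
    -- indicator of `Inter`, the sign, or `K`, the latter by `K-size` or `K-nondecreasing`.
    cases : Balanced → Dec (Inter B x α) → Dec (Vertical μ y) → Dec (size x ≡ size y + sum γ) → Dec (Descending B y) →
      sumOver (upTo (suc n)) (λ k → term k x y) ≡ σ * (⟦ inter? B x α ⟧ * K B x y γ)
    cases bal (no ¬i) _ _ _ = trans (sum-zero {f = F} (upTo (suc n)) (λ {k} _ → term-vanish k x y (λ i → ⊥-elim (¬i i))))
      (sym (trans (cong (σ *_) (⟦⟧*-no (inter? B x α) {K B x y γ} ¬i)) (ℤₚ.*-zeroʳ σ)))
    cases bal (yes _) (no ¬v) _ _ = trans (sum-zero {f = F} (upTo (suc n)) (λ {k} _ → term-vanish k x y (λ _ _ _ v → ⊥-elim (¬v v))))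
      (sym (trans (cong (_* (⟦ inter? B x α ⟧ * K B x y γ)) (signedStrip-nonvertical μ y ¬v)) (ℤₚ.*-zeroˡ (⟦ inter? B x α ⟧ * K B x y γ))))
    cases bal (yes _) (yes _) (no ≢) _ = trans (sum-zero {f = F} (upTo (suc n)) (λ {k} _ → term-vanish k x y (λ _ _ _ _ _ → ≢)))
      (sym (trans (cong (λ t → σ * (⟦ inter? B x α ⟧ * t)) (K-size B x y γ ≢)) (annihilate σ ⟦ inter? B x α ⟧)))
    cases bal (yes i) (yes _) (yes _) (no ¬d) = trans (sum-zero {f = F} (upTo (suc n)) (λ {k} _ → term-vanish k x y (λ _ _ d → ⊥-elim (¬d d))))
      (sym (trans (cong (λ t → σ * (⟦ inter? B x α ⟧ * t)) (K-nondecreasing x y γ (Inter⇒decreasing x α i)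
        (λ dec → ¬d (decreasing⇒Descending y (below-top y<B) dec)))) (annihilate σ ⟦ inter? B x α ⟧)))
    cases bal (yes i) (yes v) (yes x≡) (yes d) = begin
      sumOver (upTo (suc n)) (λ k → term k x y)
        ≡⟨ sum-single F (Unique.upTo⁺ (suc n)) (∈-upTo⁺ (s≤s k₀≤n)) (λ {k} _ k≢ → term-vanish k x y
             (λ _ _ _ _ μ≡′ _ → k≢ (ℕₚ.+-cancelˡ-≡ (size y) k k₀ (trans (sym μ≡′) μ≡)))) ⟩
      term k₀ x y
        ≡⟨ cong (-1ℤ ^ k₀ *_) (cong (⟦ inter? B x α ⟧ *_) (trans (⟦⟧*-yes (size x ≟ size α + (n ∸ k₀)) x-size)
             (trans (⟦⟧*-yes (descending? B y ×-dec vertical? μ y) (d , v)) (⟦⟧*-yes (size μ ≟ size y + k₀) μ≡)))) ⟩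
      -1ℤ ^ k₀ * (⟦ inter? B x α ⟧ * K B x y γ)
        ≡⟨ cong (_* (⟦ inter? B x α ⟧ * K B x y γ)) (signedStrip-sign μ y k₀ v μ≡) ⟨
      σ * (⟦ inter? B x α ⟧ * K B x y γ) ∎
      where
      k₀ = size μ ∸ size y
      μ≡ : size μ ≡ size y + k₀
      μ≡ = sym (ℕₚ.m+[n∸m]≡n (size-mono (Vertical⇒≼ μ y v)))
      x+k₀ : size x + k₀ ≡ size α + n
      x+k₀ = begin
        size x + k₀          ≡⟨ cong (_+ k₀) x≡ ⟩
        size y + sum γ + k₀  ≡⟨ xy∙z≈xz∙y ℕₚ.+-commutativeSemigroup (size y) (sum γ) k₀ ⟩
        size y + k₀ + sum γ  ≡⟨ cong (_+ sum γ) μ≡ ⟨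
        size μ + sum γ       ≡⟨ bal ⟩
        size α + n           ∎
      k₀≤n : k₀ ≤ n
      k₀≤n = ℕₚ.+-cancelˡ-≤ (size α) k₀ n (ℕₚ.≤-trans (ℕₚ.+-monoˡ-≤ k₀ (size-mono (Inter⇒≼ x α i))) (ℕₚ.≤-reflexive x+k₀))
      x-size : size x ≡ size α + (n ∸ k₀)
      x-size = ℕₚ.+-cancelʳ-≡ k₀ _ _ (trans x+k₀ (trans (cong (λ t → size α + t) (sym (ℕₚ.m∸n+n≡m k₀≤n))) (sym (ℕₚ.+-assoc (size α) (n ∸ k₀) k₀))))

    by-balance : (bal? : Dec Balanced) → sumOver (upTo (suc n)) (λ k → term k x y) ≡ ⟦ bal? ⟧ * (σ * (⟦ inter? B x α ⟧ * K B x y γ))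
    by-balance (yes bal) = trans (cases bal (inter? B x α) (vertical? μ y) (size x ≟ size y + sum γ) (descending? B y))
                                 (sym (ℤₚ.*-identityˡ (σ * (⟦ inter? B x α ⟧ * K B x y γ))))
    by-balance (no ¬bal) = sum-zero {f = F} (upTo (suc n)) (λ {k} k∈ → term-vanish k x y (λ _ x≡ _ _ μ≡ x≡′ → ¬bal (begin
      size μ + sum γ         ≡⟨ cong (_+ sum γ) μ≡ ⟩
      size y + k + sum γ     ≡⟨ xy∙z≈xz∙y ℕₚ.+-commutativeSemigroup (size y) k (sum γ) ⟩
      size y + sum γ + k     ≡⟨ cong (_+ k) (trans (sym x≡′) x≡) ⟩
      size α + (n ∸ k) + k   ≡⟨ ℕₚ.+-assoc (size α) (n ∸ k) k ⟩
      size α + (n ∸ k + k)   ≡⟨ cong (λ t → size α + t) (ℕₚ.m∸n+n≡m (ℕₚ.≤-pred (∈-upTo⁻ k∈))) ⟩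
      size α + n             ∎)))

  expansion-KH : sumOver (upTo (suc n)) (λ k → sumOver V (λ x → sumOver V (λ y → term k x y))) ≡ ⟦ balanced? ⟧ * KH B α μ γ
  expansion-KH = begin
    sumOver (upTo (suc n)) (λ k → sumOver V (λ x → sumOver V (λ y → term k x y)))
      ≡⟨ sum-swap (upTo (suc n)) V _ ⟩
    sumOver V (λ x → sumOver (upTo (suc n)) (λ k → sumOver V (λ y → term k x y)))
      ≡⟨ sum-cong V (λ {x} _ → trans (sum-swap (upTo (suc n)) V _) (sum-cong V (λ {y} y∈ → collapse x y (∈-box⁻ B y∈)))) ⟩
    sumOver V (λ x → sumOver V (λ y → ⟦ balanced? ⟧ * (signedStrip μ y * (⟦ inter? B x α ⟧ * K B x y γ))))
      ≡⟨ sum-swap V V _ ⟩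
    sumOver V (λ y → sumOver V (λ x → ⟦ balanced? ⟧ * (signedStrip μ y * (⟦ inter? B x α ⟧ * K B x y γ))))
      ≡⟨ sum-cong V (λ {y} _ → trans (sym (*-sum ⟦ balanced? ⟧ V _)) (cong (⟦ balanced? ⟧ *_) (sym (*-sum (signedStrip μ y) V _)))) ⟩
    sumOver V (λ y → ⟦ balanced? ⟧ * (signedStrip μ y * sumOver V (λ x → ⟦ inter? B x α ⟧ * K B x y γ)))
      ≡⟨ *-sum ⟦ balanced? ⟧ V _ ⟨
    ⟦ balanced? ⟧ * sumOver V (λ y → signedStrip μ y * sumOver V (λ x → ⟦ inter? B x α ⟧ * K B x y γ))
      -- The balance of degrees supplies the size bound of `skewPieri-vec`, which an arbitrary `γ`
      -- would violate.
      ≡⟨ ⟦⟧*-cong balanced? (λ bal → skewPieri-vec B α μ γ α<B (endsInZero-pad lam) μ<B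
           (decreasing⇒Descending μ (below-top μ<B) (pad-decreasing pmu mu≤L))
           (subst (_< B) (sym (trans bal (cong (_+ n) size-α))) (ℕₚ.n<1+n (sum lam + n)))) ⟩
    ⟦ balanced? ⟧ * KH B α μ γ ∎
    where
    open ≡-Reasoning
    α<B : VAll (_< B) α
    α<B = size<⇒below B α (subst (_< B) (sym size-α) lam<B)
    μ<B : VAll (_< B) μ
    μ<B = size<⇒below B μ (subst (_< B) (sym size-μ) (ℕₚ.≤-<-trans mu≤lam lam<B))

theorem3p2 : (lam mu : List ℕ) → SkewShape lam mu → (n : ℕ) → 0 < n →
    (skewSchur lam mu *ₛ s n ≈ skewSchur lam mu *ₛ h n) ×
    (skewSchur lam mu *ₛ h n ≈
    (∑[ k ∈ upTo (suc n) ] (-1ℤ ^ k) ·ₛ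
    (∑[ (lam⁺ , mu⁻) ∈ cartesianProduct (horizontalStripsOver (n ∸ k) lam) (verticalStripsUnder k mu) ]
    skewSchur lam⁺ mu⁻)))
theorem3p2 lam mu skew n _ =
  (λ γ → sum-cong (divisors γ) (λ {β} _ → cong (skewSchur lam mu β *_) (s≈h n (zipWith _∸_ γ β)))) ,
  (λ γ → trans (product-KH lam mu skew n γ) (sym (trans (expansion lam mu skew n γ) (expansion-KH lam mu skew n γ))))
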